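{- Let $N\ge 1$, $T\ge 1$ and $1\le S\le T$ be integers. The matrix $P^S_{S\mapsto S-1}$ with rows indexed by $\Omega(N,T,S)$ and columns indexed by $\Omega(N,T,S-1)$ (defined in the context) is stochastic, i.e. its entries are nonnegative and $\sum_{Y\in\Omega(N,T,S-1)}P^S_{S\mapsto S-1}(X,Y)=1$ for every $X\in\Omega(N,T,S)$. Moreover it maps the uniform measure to the uniform measure: for every $Y\in\Omega(N,T,S-1)$, $$\mu(N,T,S-1)(Y)=\sum_{X\in\Omega(N,T,S)}P^S_{S\mapsto S-1}(X,Y)\,\mu(N,T,S)(X).$$
   Context: Fix integers $N\ge1$, $T\ge1$. For an integer $0\le S\le T$, $\Omega(N,T,S)$ is the set of families of $N$ non-intersecting lattice paths $\tau_1,\dots,\tau_N:\{0,1,\dots,T\}\to\mathbb Z$ with $\tau_i(0)=i-1$, $\tau_i(T)=S+i-1$, $\tau_i(t+1)-\tau_i(t)\in\{0,1\}$ and $\tau_1(t)<\dots<\tau_N(t)$ for all $t$. Such a family is identified with the sequence $X=(X(0),X(1),\dots,X(T))$, $X(t)=(\tau_1(t),\dots,\tau_N(t))$. $\mu(N,T,S)$ is the uniform probability measure on $\Omega(N,T,S)$. For $0\le S,t\le T$ put $$\mathfrak X^{S,t}=\{x\in\mathbb Z:\max(0,t+S-T)\le x\le\min(t+N-1,S+N-1)\},$$ $$\mathcal X^{S,t}=\{(x_1,\dots,x_N)\in(\mathfrak X^{S,t})^N: x_1<\dots<x_N\};$$ then $X(t)\in\mathcal X^{S,t}$ for $X\in\Omega(N,T,S)$.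 $(a)_k=a(a+1)\cdots(a+k-1)$. Matrix $P^{S,t}_{t+}$ ($0\le t\le T-1$), of size $|\mathcal X^{S,t}|\times|\mathcal X^{S,t+1}|$: $$P^{S,t}_{t+}(X,Y)=\frac{\prod_{i<j}(y_j-y_i)\prod_{i:y_i=x_i+1}(N+S-x_i-1)\prod_{i:y_i=x_i}(x_i+T-t-S)}{(T-t)_N\prod_{i<j}(x_j-x_i)}$$ if $y_i-x_i\in\{0,1\}$ for all $i$, and $0$ otherwise. Matrix $P^{S,t}_{S+}$ ($0\le S\le T-1$), of size $|\mathcal X^{S,t}|\times|\mathcal X^{S+1,t}|$: $$P^{S,t}_{S+}(X,Y)=\frac{\prod_{i<j}(y_j-y_i)\prod_{i:y_i=x_i+1}(N+t-x_i-1)\prod_{i:y_i=x_i}(x_i+T-t-S)}{(T-S)_N\prod_{i<j}(x_j-x_i)}$$ if $y_i-x_i\in\{0,1\}$ for all $i$, and $0$ otherwise. For $1\le S\le T$, $X\in\Omega(N,T,S)$, $Y\in\Omega(N,T,S-1)$ define $$P^S_{S\mapsto S-1}(X,Y)=\prod_{t=0}^{T-1}\frac{P^{S-1,t}_{t+}(Y(t),Y(t+1))\,P^{S-1,t+1}_{S+}(Y(t+1),X(t+1))}{(P^{S-1,t}_{t+}P^{S-1,t+1}_{S+})(Y(t),X(t+1))}$$ if $\prod_{t=0}^{T-1}(P^{S-1,t}_{t+}P^{S-1,t+1}_{S+})(Y(t),X(t+1))>0$, and $P^S_{S\mapsto S-1}(X,Y)=0$ otherwise. (Juxtaposition of matrices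 is the matrix product.) -}

module Defs where

open import Data.Bool.Base using (if_then_else_)
open import Data.Fin.Base as Fin using (Fin; zero; suc; toℕ; fromℕ; inject₁)
open import Data.Fin.Properties using (all?)
import Data.Fin.Properties as Finₚ
open import Data.Integer.Base as ℤ using (ℤ; +_; 0ℤ; 1ℤ)
import Data.Integer.Properties as ℤₚ
open import Data.List.Base
  using (List; []; _∷_; [_]; map; foldr; filter; upTo; allFin; length; cartesianProductWith)
open import Data.List.Membership.Propositional using (_∈_)
open import Data.List.Membership.Propositional.Properties
  using (∈-map⁺; ∈-upTo⁺; ∈-filter⁺; ∈-filter⁻; ∈-cartesianProductWith⁺)
open import Data.List.Relation.Unary.All using ([])
open import Data.List.Relation.Unary.AllPairs using ([]; _∷_)
open import Data.List.Relation.Unary.Any using (here)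
open import Data.List.Relation.Unary.Unique.Propositional using (Unique)
import Data.List.Relation.Unary.Unique.Propositional.Properties as Uniqueₚ
open import Data.Nat.Base as ℕ using (ℕ; zero; suc)
import Data.Nat.Properties as ℕₚ
open import Data.Product.Base using (_×_; _,_; proj₁; proj₂)
open import Data.Rational.Base as ℚ using (ℚ; 0ℚ; 1ℚ; ≢-nonZero)
import Data.Rational.Properties as ℚₚ
open import Data.Sum.Base using (_⊎_; inj₁; inj₂)
open import Data.Vec.Base using (Vec; []; _∷_; lookup)
import Data.Vec.Properties as Vecₚ
open import Function.Bundles using (_⇔_; mk⇔)
open import Relation.Binary.PropositionalEquality
  using (_≡_; refl; sym; subst)
open import Relation.Nullary.Decidable
  using (Dec; yes; no; does; _×-dec_; _⊎-dec_; _→-dec_)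
open import Relation.Unary using (Decidable)

private
  variable
    A : Set

∑ : List A → (A → ℚ) → ℚ
∑ xs f = foldr ℚ._+_ 0ℚ (map f xs)

∏ : List A → (A → ℚ) → ℚ
∏ xs f = foldr ℚ._*_ 1ℚ (map f xs)

∏ℤ : List A → (A → ℤ) → ℤ
∏ℤ xs f = foldr ℤ._*_ 1ℤ (map f xs)

syntax ∑ xs (λ x → e) = ∑[ x ∈ xs ] e
syntax ∏ xs (λ x → e) = ∏[ x ∈ xs ] e
syntax ∏ℤ xs (λ x → e) = ∏ℤ[ x ∈ xs ] e

infix 5 ∑ ∏ ∏ℤ

fromℤ : ℤ → ℚ
fromℤ i = i ℚ./ 1

infixl 7 _÷₀_

-- Division made total by p ÷₀ 0 = 0. Below, the value at a zero divisor only
-- occurs outside the domain of the matrices or is discarded by a guard.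
_÷₀_ : ℚ → ℚ → ℚ
p ÷₀ q with q ℚₚ.≟ 0ℚ
... | yes _   = 0ℚ
... | no q≢0 = ℚ._÷_ p q {{≢-nonZero q≢0}}

pochhammer : ℤ → ℕ → ℤ
pochhammer a zero    = 1ℤ
pochhammer a (suc k) = pochhammer a k ℤ.* (a ℤ.+ + k)

-- The position of the (i+1)-st particle is  lookup x i.
Config : ℕ → Set
Config N = Vec ℤ N

-- The configuration at time t is  lookup X t.
Family : ℕ → ℕ → Set
Family N T = Vec (Config N) (suc T)

Increasing : ∀ {N} → Config N → Set
Increasing x = ∀ i j → i Fin.< j → lookup x i ℤ.< lookup x j

Step : ∀ {N} → Config N → Config N → Set
Step x y = ∀ i → (lookup y i ℤ.- lookup x i ≡ 0ℤ) ⊎ (lookup y i ℤ.- lookup x i ≡ 1ℤ)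

𝔛 : (N T S t : ℕ) → ℤ → Set
𝔛 N T S t x =
    (0ℤ ℤ.⊔ (+ t ℤ.+ + S ℤ.- + T) ℤ.≤ x)
  × (x ℤ.≤ (+ t ℤ.+ + N ℤ.- 1ℤ) ℤ.⊓ (+ S ℤ.+ + N ℤ.- 1ℤ))

𝒳 : (N T S t : ℕ) → Config N → Set
𝒳 N T S t x = (∀ i → 𝔛 N T S t (lookup x i)) × Increasing x

-- Particles are numbered from 0, so the i-th path starts at i and ends at S + i.
Ω : (N T S : ℕ) → Family N T → Set
Ω N T S X =
    (∀ i → lookup (lookup X zero) i ≡ + toℕ i)
  × (∀ i → lookup (lookup X (fromℕ T)) i ≡ + S ℤ.+ + toℕ i)
  × (∀ (t : Fin T) → Step (lookup X (inject₁ t)) (lookup X (suc t)))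
  × (∀ t → Increasing (lookup X t))

increasing? : ∀ {N} → Decidable (Increasing {N})
increasing? x =
  all? λ i → all? λ j → (i Finₚ.<? j) →-dec (lookup x i ℤₚ.<? lookup x j)

step? : ∀ {N} (x y : Config N) → Dec (Step x y)
step? x y = all? λ i →
  ((lookup y i ℤ.- lookup x i) ℤₚ.≟ 0ℤ) ⊎-dec ((lookup y i ℤ.- lookup x i) ℤₚ.≟ 1ℤ)

𝔛? : ∀ N T S t → Decidable (𝔛 N T S t)
𝔛? N T S t x = (_ ℤₚ.≤? _) ×-dec (_ ℤₚ.≤? _)

𝒳? : ∀ N T S t → Decidable (𝒳 N T S t)
𝒳? N T S t x = (all? λ i → 𝔛? N T S t (lookup x i)) ×-dec increasing? x

Ω? : ∀ N T S → Decidable (Ω N T S)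
Ω? N T S X =
        (all? λ i → _ ℤₚ.≟ _)
  ×-dec (all? λ i → _ ℤₚ.≟ _)
  ×-dec (all? λ t → step? (lookup X (inject₁ t)) (lookup X (suc t)))
  ×-dec (all? λ t → increasing? (lookup X t))

vectors : List A → ∀ n → List (Vec A n)
vectors xs zero    = [ [] ]
vectors xs (suc n) = cartesianProductWith _∷_ xs (vectors xs n)

-- All particles live in {0, …, S + N - 1}.
box : (N S : ℕ) → List (Config N)
box N S = vectors (map +_ (upTo (S ℕ.+ N))) N

-- 𝒳s and Ωs list 𝒳 and Ω exactly and without repetition, by ∈-𝒳s,
-- 𝒳s-unique, ∈-Ωs and Ωs-unique.
𝒳s : (N T S t : ℕ) → List (Config N)
𝒳s N T S t = filter (𝒳? N T S t) (box N S)

Ωs : (N T S : ℕ) → List (Family N T)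
Ωs N T S = filter (Ω? N T S) (vectors (box N S) (suc T))

∏[i<j]_ : ∀ {N} → Config N → ℤ
∏[i<j]_ {N} x =
  ∏ℤ[ i ∈ allFin N ] ∏ℤ[ j ∈ filter (i Finₚ.<?_) (allFin N) ] (lookup x j ℤ.- lookup x i)

jumping : ∀ {N} → Config N → Config N → List (Fin N)
jumping {N} x y = filter (λ i → lookup y i ℤₚ.≟ (lookup x i ℤ.+ 1ℤ)) (allFin N)

staying : ∀ {N} → Config N → Config N → List (Fin N)
staying {N} x y = filter (λ i → lookup y i ℤₚ.≟ lookup x i) (allFin N)

-- Rows are indexed by 𝒳 N T S t and columns by 𝒳 N T S (suc t).
Pt+ : (N T S t : ℕ) → Config N → Config N → ℚ
Pt+ N T S t x y =
  if does (step? x y)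
  then fromℤ ( (∏[i<j] y)
         ℤ.* (∏ℤ[ i ∈ jumping x y ] (+ N ℤ.+ + S ℤ.- lookup x i ℤ.- 1ℤ))
         ℤ.* (∏ℤ[ i ∈ staying x y ] (lookup x i ℤ.+ + T ℤ.- + t ℤ.- + S)))
       ÷₀ fromℤ (pochhammer (+ T ℤ.- + t) N ℤ.* (∏[i<j] x))
  else 0ℚ

-- Rows are indexed by 𝒳 N T S t and columns by 𝒳 N T (suc S) t.
PS+ : (N T S t : ℕ) → Config N → Config N → ℚ
PS+ N T S t x y =
  if does (step? x y)
  then fromℤ ( (∏[i<j] y)
         ℤ.* (∏ℤ[ i ∈ jumping x y ] (+ N ℤ.+ + t ℤ.- lookup x i ℤ.- 1ℤ))
         ℤ.* (∏ℤ[ i ∈ staying x y ] (lookup x i ℤ.+ + T ℤ.- + t ℤ.- + S)))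
       ÷₀ fromℤ (pochhammer (+ T ℤ.- + S) N ℤ.* (∏[i<j] x))
  else 0ℚ

-- The matrix product of  Pt+ N T S t  and  PS+ N T S (suc t),  with rows
-- indexed by 𝒳 N T S t and columns by 𝒳 N T (suc S) (suc t).
Pt+PS+ : (N T S t : ℕ) → Config N → Config N → ℚ
Pt+PS+ N T S t x z =
  ∑[ y ∈ 𝒳s N T S (suc t) ] (Pt+ N T S t x y ℚ.* PS+ N T S (suc t) y z)

-- The matrix from level S to level S - 1; rows are indexed by Ω N T S and
-- columns by Ω N T (S - 1). Only meaningful for S ≥ 1.
P↦ : (N T S : ℕ) → Family N T → Family N T → ℚ
P↦ N T S X Y =
  if does (0ℚ ℚₚ.<? (∏[ t ∈ allFin T ] denominator t))
  then (∏[ t ∈ allFin T ] (numerator t ÷₀ denominator t))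
  else 0ℚ
  where
  S-1 : ℕ
  S-1 = S ℕ.∸ 1

  numerator denominator : Fin T → ℚ
  numerator t =
        Pt+ N T S-1 (toℕ t) (lookup Y (inject₁ t)) (lookup Y (suc t))
    ℚ.* PS+ N T S-1 (suc (toℕ t)) (lookup Y (suc t)) (lookup X (suc t))
  denominator t =
    Pt+PS+ N T S-1 (toℕ t) (lookup Y (inject₁ t)) (lookup X (suc t))

μ : (N T S : ℕ) → Family N T → ℚ
μ N T S X =
  if does (Ω? N T S X) then 1ℚ ÷₀ fromℤ (+ length (Ωs N T S)) else 0ℚ

vectors-unique : ∀ {xs : List A} → Unique xs → ∀ n → Unique (vectors xs n)
vectors-unique u zero    = [] ∷ []
vectors-unique u (suc n) =
  Uniqueₚ.cartesianProductWith⁺ _∷_ Vecₚ.∷-injective u (vectors-unique u n)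

∈-vectors : ∀ {xs : List A} {n} (v : Vec A n) → (∀ i → lookup v i ∈ xs) → v ∈ vectors xs n
∈-vectors []      h = here refl
∈-vectors (x ∷ v) h =
  ∈-cartesianProductWith⁺ _∷_ (h zero) (∈-vectors v (λ i → h (suc i)))

box-unique : ∀ N S → Unique (box N S)
box-unique N S =
  vectors-unique (Uniqueₚ.map⁺ ℤₚ.+-injective (Uniqueₚ.upTo⁺ (S ℕ.+ N))) N

∈-box : ∀ {N S} (x : Config N) →
        (∀ i → 0ℤ ℤ.≤ lookup x i × lookup x i ℤ.< + (S ℕ.+ N)) → x ∈ box N S
∈-box {N} {S} x h = ∈-vectors x λ i → aux (proj₁ (h i)) (proj₂ (h i))
  where
  aux : ∀ {z} → 0ℤ ℤ.≤ z → z ℤ.< + (S ℕ.+ N) → z ∈ map +_ (upTo (S ℕ.+ N))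
  aux {+ n} _ (ℤ.+<+ n<S+N) = ∈-map⁺ +_ (∈-upTo⁺ n<S+N)

𝒳s-unique : ∀ N T S t → Unique (𝒳s N T S t)
𝒳s-unique N T S t = Uniqueₚ.filter⁺ (𝒳? N T S t) (box-unique N S)

∈-𝒳s : ∀ N T S t x → x ∈ 𝒳s N T S t ⇔ 𝒳 N T S t x
∈-𝒳s N T S t x = mk⇔
  (λ x∈ → proj₂ (∈-filter⁻ (𝒳? N T S t) {xs = box N S} x∈))
  (λ p → ∈-filter⁺ (𝒳? N T S t) (∈-box x (λ i → bounds (proj₁ p i))) p)
  where
  bounds : ∀ {z} → 𝔛 N T S t z → 0ℤ ℤ.≤ z × z ℤ.< + (S ℕ.+ N)
  bounds (l , u) =
      ℤₚ.≤-trans (ℤₚ.i≤i⊔j 0ℤ _) l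
    , ℤₚ.i≤pred[j]⇒i<j
        (subst (_ ℤ.≤_) (ℤₚ.+-comm (+ S ℤ.+ + N) (ℤ.- 1ℤ))
          (ℤₚ.≤-trans u (ℤₚ.i⊓j≤j (+ t ℤ.+ + N ℤ.- 1ℤ) _)))

Ωs-unique : ∀ N T S → Unique (Ωs N T S)
Ωs-unique N T S =
  Uniqueₚ.filter⁺ (Ω? N T S) (vectors-unique (box-unique N S) (suc T))

step-≤ : ∀ {a b} → (b ℤ.- a ≡ 0ℤ) ⊎ (b ℤ.- a ≡ 1ℤ) → a ℤ.≤ b
step-≤ (inj₁ e) = ℤₚ.0≤i-j⇒j≤i (subst (0ℤ ℤ.≤_) (sym e) (ℤ.+≤+ ℕ.z≤n))
step-≤ (inj₂ e) = ℤₚ.0≤i-j⇒j≤i (subst (0ℤ ℤ.≤_) (sym e) (ℤ.+≤+ ℕ.z≤n))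

first≤ : ∀ {T} (f : Fin (suc T) → ℤ) → (∀ t → f (inject₁ t) ℤ.≤ f (suc t)) →
         ∀ t → f zero ℤ.≤ f t
first≤ f h zero = ℤₚ.≤-refl
first≤ {suc T} f h (suc t) =
  ℤₚ.≤-trans (h zero) (first≤ (λ s → f (suc s)) (λ s → h (suc s)) t)

≤last : ∀ {T} (f : Fin (suc T) → ℤ) → (∀ t → f (inject₁ t) ℤ.≤ f (suc t)) →
        ∀ t → f t ℤ.≤ f (fromℕ T)
≤last {zero}  f h zero    = ℤₚ.≤-refl
≤last {suc T} f h zero    =
  ℤₚ.≤-trans (h zero) (≤last (λ s → f (suc s)) (λ s → h (suc s)) zero)
≤last {suc T} f h (suc t) = ≤last (λ s → f (suc s)) (λ s → h (suc s)) t

∈-Ωs : ∀ N T S X → X ∈ Ωs N T S ⇔ Ω N T S X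
∈-Ωs N T S X = mk⇔
  (λ X∈ → proj₂ (∈-filter⁻ (Ω? N T S) {xs = vectors (box N S) (suc T)} X∈))
  (λ p → ∈-filter⁺ (Ω? N T S) (∈-vectors X (λ t → ∈-box (lookup X t) (bounds p t))) p)
  where
  bounds : Ω N T S X → ∀ t i →
           0ℤ ℤ.≤ lookup (lookup X t) i × lookup (lookup X t) i ℤ.< + (S ℕ.+ N)
  bounds (start , end , steps , _) t i =
      ℤₚ.≤-trans (subst (0ℤ ℤ.≤_) (sym (start i)) (ℤ.+≤+ ℕ.z≤n)) (first≤ τ mono t)
    , ℤₚ.≤-<-trans (ℤₚ.≤-trans (≤last τ mono t) (ℤₚ.≤-reflexive (end i)))
        (ℤ.+<+ (ℕₚ.+-monoʳ-< S (Finₚ.toℕ<n i)))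
    where
    τ : Fin (suc T) → ℤ
    τ s = lookup (lookup X s) i
    mono : ∀ s → τ (inject₁ s) ℤ.≤ τ (suc s)
    mono s = step-≤ (steps s i)

{-# OPTIONS --safe #-}

-- The matrices Pt+ and PS+ commute. In the product of two transitions the Vandermonde
-- factor of the intermediate configuration cancels, and what remains is a sum over the
-- intermediate positions yᵢ ∈ {xᵢ, xᵢ + 1}, whose particles only interact inside runs of
-- adjacent particles with total displacement 1; the two orders of the sum are compared
-- particle by particle. Commutation makes all the denominators of P↦ positive, so that
-- summing Y(T), Y(T-1), … successively gives the row sums. Given Y, summing X(0), X(1), …
-- successively shows that P↦ maps the weight ∏ Pt+ of paths at level S to the one at
-- level S - 1. These weights are constant, because Pt+ is a ratio of potentials times a
-- factor depending on time only, so P↦ maps the uniform measure to a multiple of it.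
module Submission where

open import Data.Bool.Base using (if_then_else_)
open import Data.Empty using (⊥-elim)
open import Data.Fin.Base as Fin using (Fin; zero; suc; toℕ; fromℕ; inject₁)
import Data.Fin.Properties as Finₚ
open Finₚ using (toℕ-inject₁; toℕ-fromℕ; toℕ<n)
open import Data.Integer.Base as ℤ using (ℤ; +_; 0ℤ; 1ℤ)
import Data.Integer.Properties as ℤₚ
open import Data.Integer.Tactic.RingSolver using (solve-∀)
open import Data.List.Base
  using (List; []; _∷_; _++_; map; foldr; filter; allFin; length; cartesianProductWith)
open import Data.List.Membership.Propositional using (_∈_)
open import Data.List.Membership.Propositional.Properties
  using (∈-filter⁺; ∈-filter⁻; ∈-allFin; ∈-cartesianProductWith⁺; ∈-cartesianProductWith⁻)
open import Data.List.Membership.Propositional.Properties.WithK using (unique∧set⇒bag)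
import Data.List.Properties as Listₚ
open import Data.List.Relation.Binary.BagAndSetEquality using (∼bag⇒↭)
open import Data.List.Relation.Binary.Permutation.Propositional using (_↭_; ↭⇒↭ₛ)
open import Data.List.Relation.Binary.Permutation.Propositional.Properties using (map⁺)
open import Data.List.Relation.Binary.Permutation.Setoid.Properties using (foldr-commMonoid)
open import Data.List.Relation.Unary.All using ([]; _∷_)
open import Data.List.Relation.Unary.AllPairs using ([]; _∷_)
open import Data.List.Relation.Unary.Any using (here; there)
open import Data.List.Relation.Unary.Unique.Propositional using (Unique)
import Data.List.Relation.Unary.Unique.Propositional.Properties as Uniqueₚ
open import Data.Maybe.Base using (Maybe; just; nothing)
open import Data.Nat.Base as ℕ using (ℕ; zero; suc; _≤_; _∸_; z≤n; s≤s; _!)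
import Data.Nat.Properties as ℕₚ
open import Data.Product.Base using (∃; _×_; _,_; proj₁; proj₂)
open import Data.Rational.Base as ℚ using (ℚ; 0ℚ; 1ℚ)
import Data.Rational.Properties as ℚₚ
open import Data.Rational.Unnormalised.Base as ℚᵘ using (mkℚᵘ; *≡*)
import Data.Rational.Unnormalised.Properties as ℚᵘₚ
open import Data.Sum.Base as Sum using (_⊎_; inj₁; inj₂)
open import Data.Unit.Base using (⊤; tt)
open import Data.Vec.Base using (Vec; []; _∷_; lookup)
import Data.Vec.Properties as Vecₚ
open import Function.Base using (_∘_)
open import Function.Bundles using (_⇔_; mk⇔; Equivalence)
open import Level using (0ℓ)
open import Relation.Binary.PropositionalEquality
  using (_≡_; _≢_; refl; sym; trans; cong; cong₂; subst; subst₂; setoid; module ≡-Reasoning)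
open import Relation.Nullary using (¬_; Dec; yes; no; does; ¬?)
import Tactic.RingSolver as RingSolver
open import Tactic.RingSolver.Core.AlmostCommutativeRing using (AlmostCommutativeRing; fromCommutativeRing)
open import Defs

-- Particle by particle, commutation does not close under induction. Once the first particle is
-- placed at `x` or `x + 1`, the others must stay above it, and the two orders weight these two
-- choices differently. For total displacement 1 both orders carry the factor `x + k`, and equality
-- reduces to (a - x) A = (b - x) B + (a - b) C. Here A and B are the tail sums of the two orders
-- above `x + 1`, C is a tail sum above `x`, and a, b stand for N + S - 1, N + t - 1. This relation
-- is proved by mutual induction with commutation. A denominator of `P↦` may vanish for an unrelated
-- pair Y, X. It is nonzero as long as `PS+` from Y(t) to X(t) is nonzero. This holds at time 0,
-- where each level has a single configuration and `PS+` is 1, and it persists because the numerator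
-- contains `PS+` at the next time. The same boundary value lets the factors `PS+` slide by one time
-- step, which turns the kernel for Y given X into a kernel for X given Y.

private
  variable
    A B : Set
    n : ℕ

-- Total division on the rationals and the embedding of the integers

ℚ-ring : AlmostCommutativeRing 0ℓ 0ℓ
ℚ-ring = fromCommutativeRing ℚₚ.+-*-commutativeRing isZero
  where
  isZero : ∀ p → Maybe (0ℚ ≡ p)
  isZero p with 0ℚ ℚₚ.≟ p
  ... | yes e = just e
  ... | no _  = nothing

*-nonzero : ∀ {p q} → p ≢ 0ℚ → q ≢ 0ℚ → p ℚ.* q ≢ 0ℚ
*-nonzero {p} {q} p≢0 q≢0 pq≡0 = q≢0 (begin
  q                        ≡⟨ ℚₚ.*-identityˡ q ⟨
  1ℚ ℚ.* q                 ≡⟨ cong (ℚ._* q) (ℚₚ.*-inverseˡ p) ⟨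
  ℚ.1/ p ℚ.* p ℚ.* q       ≡⟨ ℚₚ.*-assoc (ℚ.1/ p) p q ⟩
  ℚ.1/ p ℚ.* (p ℚ.* q)     ≡⟨ cong (ℚ.1/ p ℚ.*_) pq≡0 ⟩
  ℚ.1/ p ℚ.* 0ℚ            ≡⟨ ℚₚ.*-zeroʳ (ℚ.1/ p) ⟩
  0ℚ                       ∎)
  where
  open ≡-Reasoning
  instance _ = ℚ.≢-nonZero p≢0

*-nonzeroˡ : ∀ {p q} → p ℚ.* q ≢ 0ℚ → p ≢ 0ℚ
*-nonzeroˡ {q = q} h refl = h (ℚₚ.*-zeroˡ q)

*-nonzeroʳ : ∀ {p q} → p ℚ.* q ≢ 0ℚ → q ≢ 0ℚ
*-nonzeroʳ {p = p} h refl = h (ℚₚ.*-zeroʳ p)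

*-nonneg : ∀ {p q} → 0ℚ ℚ.≤ p → 0ℚ ℚ.≤ q → 0ℚ ℚ.≤ p ℚ.* q
*-nonneg {p} {q} 0≤p 0≤q = ℚₚ.nonNegative⁻¹ (p ℚ.* q)
  {{ℚₚ.nonNeg*nonNeg⇒nonNeg p {{ℚ.nonNegative 0≤p}} q {{ℚ.nonNegative 0≤q}}}}

nonneg∧nonzero⇒pos : ∀ {p} → 0ℚ ℚ.≤ p → p ≢ 0ℚ → 0ℚ ℚ.< p
nonneg∧nonzero⇒pos {p} 0≤p p≢0 = ℚₚ.≰⇒> λ p≤0 → p≢0 (ℚₚ.≤-antisym p≤0 0≤p)

*-cancelʳ : ∀ {p q} r → r ≢ 0ℚ → p ℚ.* r ≡ q ℚ.* r → p ≡ q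
*-cancelʳ {p} {q} r r≢0 e = begin
  p                      ≡⟨ lemma p ⟨
  p ℚ.* r ℚ.* ℚ.1/ r     ≡⟨ cong (ℚ._* ℚ.1/ r) e ⟩
  q ℚ.* r ℚ.* ℚ.1/ r     ≡⟨ lemma q ⟩
  q                      ∎
  where
  open ≡-Reasoning
  instance _ = ℚ.≢-nonZero r≢0
  lemma : ∀ p → p ℚ.* r ℚ.* ℚ.1/ r ≡ p
  lemma p = trans (ℚₚ.*-assoc p r (ℚ.1/ r))
    (trans (cong (p ℚ.*_) (ℚₚ.*-inverseʳ r)) (ℚₚ.*-identityʳ p))

-- With the value 0 at 0 the inverse is multiplicative without side conditions (`inv₀-*`), so
-- products of quotients can be split before it is known which denominators vanish.
inv₀ : ℚ → ℚ
inv₀ q = 1ℚ ÷₀ q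

÷₀-inv₀ : ∀ p q → p ÷₀ q ≡ p ℚ.* inv₀ q
÷₀-inv₀ p q with q ℚₚ.≟ 0ℚ
... | yes _  = sym (ℚₚ.*-zeroʳ p)
... | no q≢0 = cong (p ℚ.*_) (sym (ℚₚ.*-identityˡ _))

inv₀-zero : ∀ {q} → q ≡ 0ℚ → inv₀ q ≡ 0ℚ
inv₀-zero refl = refl

inv₀-inverse : ∀ {q} → q ≢ 0ℚ → q ℚ.* inv₀ q ≡ 1ℚ
inv₀-inverse {q} q≢0 with q ℚₚ.≟ 0ℚ
... | yes q≡0 = ⊥-elim (q≢0 q≡0)
... | no  q≢0 = trans (cong (q ℚ.*_) (ℚₚ.*-identityˡ _))
                      (ℚₚ.*-inverseʳ q {{ℚ.≢-nonZero q≢0}})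

inv₀-nonzero : ∀ {q} → q ≢ 0ℚ → inv₀ q ≢ 0ℚ
inv₀-nonzero {q} q≢0 e =
  ℚₚ.1≢0 (trans (sym (inv₀-inverse q≢0)) (trans (cong (q ℚ.*_) e) (ℚₚ.*-zeroʳ q)))

inv₀-nonneg : ∀ {q} → 0ℚ ℚ.≤ q → 0ℚ ℚ.≤ inv₀ q
inv₀-nonneg {q} 0≤q with q ℚₚ.≟ 0ℚ
... | yes _  = ℚₚ.≤-refl
... | no q≢0 = *-nonneg (ℚₚ.nonNegative⁻¹ 1ℚ)
  (ℚₚ.<⇒≤ (ℚₚ.positive⁻¹ ((ℚ.1/ q) {{ℚ.≢-nonZero q≢0}})
    {{ℚₚ.1/pos⇒pos q {{ℚ.positive (nonneg∧nonzero⇒pos 0≤q q≢0)}}}}))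

inv₀-* : ∀ p q → inv₀ (p ℚ.* q) ≡ inv₀ p ℚ.* inv₀ q
inv₀-* p q = by-cases (p ℚₚ.≟ 0ℚ) (q ℚₚ.≟ 0ℚ)
  where
  open ≡-Reasoning
  rearrange : ∀ p q i j → (p ℚ.* i) ℚ.* (q ℚ.* j) ≡ (i ℚ.* j) ℚ.* (p ℚ.* q)
  rearrange = RingSolver.solve-∀ ℚ-ring
  by-cases : Dec (p ≡ 0ℚ) → Dec (q ≡ 0ℚ) → inv₀ (p ℚ.* q) ≡ inv₀ p ℚ.* inv₀ q
  by-cases (yes refl) _ = trans (inv₀-zero (ℚₚ.*-zeroˡ q)) (sym (ℚₚ.*-zeroˡ (inv₀ q)))
  by-cases (no _) (yes refl) = trans (inv₀-zero (ℚₚ.*-zeroʳ p)) (sym (ℚₚ.*-zeroʳ (inv₀ p)))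
  by-cases (no p≢0) (no q≢0) = *-cancelʳ (p ℚ.* q) (*-nonzero p≢0 q≢0) (begin
    inv₀ (p ℚ.* q) ℚ.* (p ℚ.* q)            ≡⟨ ℚₚ.*-comm (inv₀ (p ℚ.* q)) _ ⟩
    (p ℚ.* q) ℚ.* inv₀ (p ℚ.* q)            ≡⟨ inv₀-inverse (*-nonzero p≢0 q≢0) ⟩
    1ℚ                                      ≡⟨ cong₂ ℚ._*_ (inv₀-inverse p≢0) (inv₀-inverse q≢0) ⟨
    (p ℚ.* inv₀ p) ℚ.* (q ℚ.* inv₀ q)       ≡⟨ rearrange p q (inv₀ p) (inv₀ q) ⟩
    (inv₀ p ℚ.* inv₀ q) ℚ.* (p ℚ.* q)       ∎)

-- Unnormalised rationals carry the literal fraction i over 1, with no reduction by a gcd in the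
-- way; the laws of `fromℤ` are checked there and pulled back.
fromℤ-≃ : ∀ i → ℚ.toℚᵘ (fromℤ i) ℚᵘ.≃ mkℚᵘ i 0
fromℤ-≃ i = ℚₚ.toℚᵘ-fromℚᵘ (mkℚᵘ i 0)

fromℤ-+ : ∀ i j → fromℤ (i ℤ.+ j) ≡ fromℤ i ℚ.+ fromℤ j
fromℤ-+ i j = ℚₚ.toℚᵘ-injective (begin
  ℚ.toℚᵘ (fromℤ (i ℤ.+ j))                  ≈⟨ fromℤ-≃ (i ℤ.+ j) ⟩
  mkℚᵘ (i ℤ.+ j) 0                          ≈⟨ *≡* (cong (ℤ._* 1ℤ) (cong₂ ℤ._+_ (sym (ℤₚ.*-identityʳ i)) (sym (ℤₚ.*-identityʳ j)))) ⟩
  mkℚᵘ i 0 ℚᵘ.+ mkℚᵘ j 0                    ≈⟨ ℚᵘₚ.+-cong (fromℤ-≃ i) (fromℤ-≃ j) ⟨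
  ℚ.toℚᵘ (fromℤ i) ℚᵘ.+ ℚ.toℚᵘ (fromℤ j)    ≈⟨ ℚₚ.toℚᵘ-homo-+ (fromℤ i) (fromℤ j) ⟨
  ℚ.toℚᵘ (fromℤ i ℚ.+ fromℤ j)              ∎)
  where open ℚᵘₚ.≃-Reasoning

fromℤ-* : ∀ i j → fromℤ (i ℤ.* j) ≡ fromℤ i ℚ.* fromℤ j
fromℤ-* i j = ℚₚ.toℚᵘ-injective (begin
  ℚ.toℚᵘ (fromℤ (i ℤ.* j))                  ≈⟨ fromℤ-≃ (i ℤ.* j) ⟩
  mkℚᵘ i 0 ℚᵘ.* mkℚᵘ j 0                    ≈⟨ ℚᵘₚ.*-cong (fromℤ-≃ i) (fromℤ-≃ j) ⟨
  ℚ.toℚᵘ (fromℤ i) ℚᵘ.* ℚ.toℚᵘ (fromℤ j)    ≈⟨ ℚₚ.toℚᵘ-homo-* (fromℤ i) (fromℤ j) ⟨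
  ℚ.toℚᵘ (fromℤ i ℚ.* fromℤ j)              ∎)
  where open ℚᵘₚ.≃-Reasoning

fromℤ-nonneg : ∀ {i} → 0ℤ ℤ.≤ i → 0ℚ ℚ.≤ fromℤ i
fromℤ-nonneg {+ i} _ = ℚₚ.nonNegative⁻¹ (fromℤ (+ i)) {{ℚₚ.normalize-nonNeg i 1}}

fromℤ-injective : ∀ {i j} → fromℤ i ≡ fromℤ j → i ≡ j
fromℤ-injective {i} {j} e
  with *≡* h ← ℚᵘₚ.≃-trans (ℚᵘₚ.≃-sym (fromℤ-≃ i)) (ℚᵘₚ.≃-trans (ℚₚ.toℚᵘ-cong e) (fromℤ-≃ j))
  = ℤₚ.*-cancelʳ-≡ i j 1ℤ h

fromℤ-nonzero : ∀ {i} → i ≢ 0ℤ → fromℤ i ≢ 0ℚ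
fromℤ-nonzero i≢0 e = i≢0 (fromℤ-injective e)

-- Finite sums and products

∑-cong : ∀ (xs : List A) {f g : A → ℚ} → (∀ {x} → x ∈ xs → f x ≡ g x) → ∑ xs f ≡ ∑ xs g
∑-cong []       h = refl
∑-cong (x ∷ xs) h = cong₂ ℚ._+_ (h (here refl)) (∑-cong xs (h ∘ there))

∑-zero : ∀ (xs : List A) → (∑[ x ∈ xs ] 0ℚ) ≡ 0ℚ
∑-zero []       = refl
∑-zero (x ∷ xs) = trans (ℚₚ.+-identityˡ _) (∑-zero xs)

∑-+ : ∀ (xs : List A) (f g : A → ℚ) → (∑[ x ∈ xs ] (f x ℚ.+ g x)) ≡ ∑ xs f ℚ.+ ∑ xs g
∑-+ []       f g = refl
∑-+ (x ∷ xs) f g =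
  trans (cong ((f x ℚ.+ g x) ℚ.+_) (∑-+ xs f g)) (rearrange (f x) (g x) (∑ xs f) (∑ xs g))
  where
  rearrange : ∀ a b c d → (a ℚ.+ b) ℚ.+ (c ℚ.+ d) ≡ (a ℚ.+ c) ℚ.+ (b ℚ.+ d)
  rearrange = RingSolver.solve-∀ ℚ-ring

∑-*ˡ : ∀ (xs : List A) c (f : A → ℚ) → (∑[ x ∈ xs ] (c ℚ.* f x)) ≡ c ℚ.* ∑ xs f
∑-*ˡ []       c f = sym (ℚₚ.*-zeroʳ c)
∑-*ˡ (x ∷ xs) c f =
  trans (cong (c ℚ.* f x ℚ.+_) (∑-*ˡ xs c f)) (sym (ℚₚ.*-distribˡ-+ c (f x) (∑ xs f)))

∑-*ʳ : ∀ (xs : List A) c (f : A → ℚ) → (∑[ x ∈ xs ] (f x ℚ.* c)) ≡ ∑ xs f ℚ.* c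
∑-*ʳ xs c f = trans (∑-cong xs (λ {x} _ → ℚₚ.*-comm (f x) c))
  (trans (∑-*ˡ xs c f) (ℚₚ.*-comm c (∑ xs f)))

∑-swap : ∀ (xs : List A) (ys : List B) (f : A → B → ℚ) →
         (∑[ x ∈ xs ] ∑[ y ∈ ys ] f x y) ≡ (∑[ y ∈ ys ] ∑[ x ∈ xs ] f x y)
∑-swap []       ys f = sym (∑-zero ys)
∑-swap (x ∷ xs) ys f =
  trans (cong (∑ ys (f x) ℚ.+_) (∑-swap xs ys f)) (sym (∑-+ ys (f x) _))

∑-const : ∀ (xs : List A) c → (∑[ x ∈ xs ] c) ≡ c ℚ.* fromℤ (+ length xs)
∑-const []       c = sym (ℚₚ.*-zeroʳ c)
∑-const (x ∷ xs) c = begin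
  c ℚ.+ (∑[ x ∈ xs ] c)                      ≡⟨ cong₂ ℚ._+_ (sym (ℚₚ.*-identityʳ c)) (∑-const xs c) ⟩
  c ℚ.* 1ℚ ℚ.+ c ℚ.* fromℤ (+ length xs)     ≡⟨ ℚₚ.*-distribˡ-+ c 1ℚ _ ⟨
  c ℚ.* (1ℚ ℚ.+ fromℤ (+ length xs))         ≡⟨ cong (c ℚ.*_) (fromℤ-+ 1ℤ (+ length xs)) ⟨
  c ℚ.* fromℤ (+ suc (length xs))            ∎
  where open ≡-Reasoning

∑-++ : ∀ (xs ys : List A) (f : A → ℚ) → ∑ (xs ++ ys) f ≡ ∑ xs f ℚ.+ ∑ ys f
∑-++ []       ys f = sym (ℚₚ.+-identityˡ _)
∑-++ (x ∷ xs) ys f = trans (cong (f x ℚ.+_) (∑-++ xs ys f)) (sym (ℚₚ.+-assoc (f x) _ _))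

∑-map : ∀ (g : A → B) (xs : List A) (f : B → ℚ) → ∑ (map g xs) f ≡ ∑ xs (f ∘ g)
∑-map g xs f = cong (foldr ℚ._+_ 0ℚ) (sym (Listₚ.map-∘ xs))

∑-product : ∀ {C : Set} (g : A → B → C) (xs : List A) (ys : List B) (f : C → ℚ) →
            ∑ (cartesianProductWith g xs ys) f ≡ (∑[ x ∈ xs ] ∑[ y ∈ ys ] f (g x y))
∑-product g []       ys f = refl
∑-product g (x ∷ xs) ys f =
  trans (∑-++ (map (g x) ys) _ f) (cong₂ ℚ._+_ (∑-map (g x) ys f) (∑-product g xs ys f))

∑-nonneg : ∀ (xs : List A) {f : A → ℚ} → (∀ {x} → x ∈ xs → 0ℚ ℚ.≤ f x) → 0ℚ ℚ.≤ ∑ xs f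
∑-nonneg []       h = ℚₚ.≤-refl
∑-nonneg (x ∷ xs) h = ℚₚ.+-mono-≤ (h (here refl)) (∑-nonneg xs (h ∘ there))

term≤∑ : ∀ (xs : List A) {f : A → ℚ} → (∀ {x} → x ∈ xs → 0ℚ ℚ.≤ f x) →
         ∀ {x} → x ∈ xs → f x ℚ.≤ ∑ xs f
term≤∑ (x ∷ xs) {f} h (here refl) =
  subst (ℚ._≤ ∑ (x ∷ xs) f) (ℚₚ.+-identityʳ (f x)) (ℚₚ.+-monoʳ-≤ (f x) (∑-nonneg xs (h ∘ there)))
term≤∑ (y ∷ xs) {f} h (there x∈) =
  subst (ℚ._≤ ∑ (y ∷ xs) f) (ℚₚ.+-identityˡ (f _)) (ℚₚ.+-mono-≤ (h (here refl)) (term≤∑ xs (h ∘ there) x∈))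

∑-nonzero : ∀ (xs : List A) {f : A → ℚ} → (∀ {x} → x ∈ xs → 0ℚ ℚ.≤ f x) →
            ∀ {x} → x ∈ xs → f x ≢ 0ℚ → ∑ xs f ≢ 0ℚ
∑-nonzero xs h x∈ fx≢0 e =
  fx≢0 (ℚₚ.≤-antisym (ℚₚ.≤-trans (term≤∑ xs h x∈) (ℚₚ.≤-reflexive e)) (h x∈))

∑-↭ : ∀ {xs ys : List A} (f : A → ℚ) → xs ↭ ys → ∑ xs f ≡ ∑ ys f
∑-↭ f p = foldr-commMonoid (setoid ℚ) ℚₚ.+-0-isCommutativeMonoid (↭⇒↭ₛ (map⁺ f p))

∑-filter-nonzero : ∀ (xs : List A) (f : A → ℚ) →
                   ∑ (filter (λ x → ¬? (f x ℚₚ.≟ 0ℚ)) xs) f ≡ ∑ xs f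
∑-filter-nonzero []       f = refl
∑-filter-nonzero (x ∷ xs) f with f x ℚₚ.≟ 0ℚ
... | yes e = trans (∑-filter-nonzero xs f)
                (trans (sym (ℚₚ.+-identityˡ _)) (cong (ℚ._+ ∑ xs f) (sym e)))
... | no _  = cong (f x ℚ.+_) (∑-filter-nonzero xs f)

-- After the zero terms are filtered out, both lists are free of repetitions and have the same
-- elements, so they are permutations of each other. This replaces one enumeration of states or
-- paths by another.
∑-support : ∀ {xs ys : List A} (f : A → ℚ) → Unique xs → Unique ys →
            (∀ {x} → f x ≢ 0ℚ → x ∈ xs ⇔ x ∈ ys) → ∑ xs f ≡ ∑ ys f
∑-support {A} {xs} {ys} f xs! ys! h = begin
  ∑ xs f                    ≡⟨ ∑-filter-nonzero xs f ⟨
  ∑ (filter nonzero? xs) f  ≡⟨ ∑-↭ f (∼bag⇒↭ (unique∧set⇒bag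
                                 (Uniqueₚ.filter⁺ nonzero? xs!) (Uniqueₚ.filter⁺ nonzero? ys!)
                                 (mk⇔ (transfer (Equivalence.to ∘ h)) (transfer (Equivalence.from ∘ h))))) ⟩
  ∑ (filter nonzero? ys) f  ≡⟨ ∑-filter-nonzero ys f ⟩
  ∑ ys f                    ∎
  where
  open ≡-Reasoning
  nonzero? = λ x → ¬? (f x ℚₚ.≟ 0ℚ)
  transfer : ∀ {us vs : List A} {x} → (f x ≢ 0ℚ → x ∈ us → x ∈ vs) →
             x ∈ filter nonzero? us → x ∈ filter nonzero? vs
  transfer {us} g x∈ with ∈-filter⁻ nonzero? {xs = us} x∈
  ... | x∈us , fx≢0 = ∈-filter⁺ nonzero? (g fx≢0 x∈us) fx≢0

∏-cong : ∀ (xs : List A) {f g : A → ℚ} → (∀ {x} → x ∈ xs → f x ≡ g x) → ∏ xs f ≡ ∏ xs g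
∏-cong []       h = refl
∏-cong (x ∷ xs) h = cong₂ ℚ._*_ (h (here refl)) (∏-cong xs (h ∘ there))

∏-* : ∀ (xs : List A) (f g : A → ℚ) → (∏[ x ∈ xs ] (f x ℚ.* g x)) ≡ ∏ xs f ℚ.* ∏ xs g
∏-* []       f g = refl
∏-* (x ∷ xs) f g =
  trans (cong ((f x ℚ.* g x) ℚ.*_) (∏-* xs f g)) (rearrange (f x) (g x) (∏ xs f) (∏ xs g))
  where
  rearrange : ∀ a b c d → (a ℚ.* b) ℚ.* (c ℚ.* d) ≡ (a ℚ.* c) ℚ.* (b ℚ.* d)
  rearrange = RingSolver.solve-∀ ℚ-ring

∏-nonneg : ∀ (xs : List A) {f : A → ℚ} → (∀ {x} → x ∈ xs → 0ℚ ℚ.≤ f x) → 0ℚ ℚ.≤ ∏ xs f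
∏-nonneg []       h = ℚₚ.nonNegative⁻¹ 1ℚ
∏-nonneg (x ∷ xs) h = *-nonneg (h (here refl)) (∏-nonneg xs (h ∘ there))

∏-nonzero : ∀ (xs : List A) {f : A → ℚ} → (∀ {x} → x ∈ xs → f x ≢ 0ℚ) → ∏ xs f ≢ 0ℚ
∏-nonzero []       h = ℚₚ.1≢0
∏-nonzero (x ∷ xs) h = *-nonzero (h (here refl)) (∏-nonzero xs (h ∘ there))

∏-zero-term : ∀ (xs : List A) {f : A → ℚ} {x} → x ∈ xs → f x ≡ 0ℚ → ∏ xs f ≡ 0ℚ
∏-zero-term (x ∷ xs) {f} (here refl) e = trans (cong (ℚ._* ∏ xs f) e) (ℚₚ.*-zeroˡ (∏ xs f))
∏-zero-term (x ∷ xs) {f} (there x∈) e =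
  trans (cong (f x ℚ.*_) (∏-zero-term xs x∈ e)) (ℚₚ.*-zeroʳ (f x))

∏-inv₀ : ∀ (xs : List A) (f : A → ℚ) → (∏[ x ∈ xs ] inv₀ (f x)) ≡ inv₀ (∏ xs f)
∏-inv₀ []       f = refl
∏-inv₀ (x ∷ xs) f = trans (cong (inv₀ (f x) ℚ.*_) (∏-inv₀ xs f)) (sym (inv₀-* (f x) (∏ xs f)))

∏-allFin-suc : ∀ (f : Fin (suc n) → ℚ) →
               ∏ (allFin (suc n)) f ≡ f zero ℚ.* ∏ (allFin n) (f ∘ suc)
∏-allFin-suc f = cong (λ ps → f zero ℚ.* foldr ℚ._*_ 1ℚ ps)
  (trans (Listₚ.map-tabulate suc f) (sym (Listₚ.map-tabulate (λ i → i) (λ i → f (suc i)))))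

-- Both sides are the product over all indices, split at the front or at the back. It moves factors
-- attached to the later end of each step to the earlier end.
∏-allFin-shift : ∀ n (f : Fin (suc n) → ℚ) →
  f zero ℚ.* ∏ (allFin n) (f ∘ suc) ≡ ∏ (allFin n) (f ∘ inject₁) ℚ.* f (fromℕ n)
∏-allFin-shift zero    f = ℚₚ.*-comm (f zero) 1ℚ
∏-allFin-shift (suc n) f = begin
  f zero ℚ.* ∏ (allFin (suc n)) (f ∘ suc)
    ≡⟨ cong (f zero ℚ.*_) (∏-allFin-suc (f ∘ suc)) ⟩
  f zero ℚ.* (f (suc zero) ℚ.* (∏[ i ∈ allFin n ] f (suc (suc i))))
    ≡⟨ cong (f zero ℚ.*_) (∏-allFin-shift n (f ∘ suc)) ⟩
  f zero ℚ.* ((∏[ i ∈ allFin n ] f (suc (inject₁ i))) ℚ.* f (fromℕ (suc n)))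
    ≡⟨ ℚₚ.*-assoc (f zero) _ _ ⟨
  f zero ℚ.* (∏[ i ∈ allFin n ] f (suc (inject₁ i))) ℚ.* f (fromℕ (suc n))
    ≡⟨ cong (ℚ._* f (fromℕ (suc n))) (∏-allFin-suc (f ∘ inject₁)) ⟨
  ∏ (allFin (suc n)) (f ∘ inject₁) ℚ.* f (fromℕ (suc n)) ∎
  where open ≡-Reasoning

-- Paths through varying state lists and sums of their weights

sections : (ℕ → List A) → ∀ n → List (Vec A n)
sections L zero    = [] ∷ []
sections L (suc n) = cartesianProductWith _∷_ (L 0) (sections (L ∘ suc) n)

sections-unique : ∀ {L : ℕ → List A} → (∀ t → Unique (L t)) → ∀ n → Unique (sections L n)
sections-unique L! zero    = [] ∷ []
sections-unique L! (suc n) =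
  Uniqueₚ.cartesianProductWith⁺ _∷_ Vecₚ.∷-injective (L! 0) (sections-unique (L! ∘ suc) n)

∈-sections⁺ : ∀ {L : ℕ → List A} (v : Vec A n) → (∀ t → lookup v t ∈ L (toℕ t)) → v ∈ sections L n
∈-sections⁺ []      h = here refl
∈-sections⁺ (x ∷ v) h = ∈-cartesianProductWith⁺ _∷_ (h zero) (∈-sections⁺ v (h ∘ suc))

∈-sections⁻ : ∀ (L : ℕ → List A) {v : Vec A n} → v ∈ sections L n → ∀ t → lookup v t ∈ L (toℕ t)
∈-sections⁻ {n = suc n} L v∈ t
  with ∈-cartesianProductWith⁻ _∷_ (L 0) (sections (L ∘ suc) n) v∈
∈-sections⁻ L v∈ zero    | x , w , x∈ , w∈ , refl = x∈
∈-sections⁻ L v∈ (suc t) | x , w , x∈ , w∈ , refl = ∈-sections⁻ (L ∘ suc) w∈ t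

∈-inject₁ : ∀ (L : ℕ → List A) (v : Vec A (suc n)) → (∀ t → lookup v t ∈ L (toℕ t)) →
            ∀ (t : Fin n) → lookup v (inject₁ t) ∈ L (toℕ t)
∈-inject₁ L v h t = subst (λ i → lookup v (inject₁ t) ∈ L i) (toℕ-inject₁ t) (h (inject₁ t))

pathWeight : (Fin n → A → A → ℚ) → Vec A (suc n) → ℚ
pathWeight {n} k v = ∏[ t ∈ allFin n ] k t (lookup v (inject₁ t)) (lookup v (suc t))

pathWeight-∷ : ∀ (k : Fin (suc n) → A → A → ℚ) x y (v : Vec A n) →
               pathWeight k (x ∷ y ∷ v) ≡ k zero x y ℚ.* pathWeight (k ∘ suc) (y ∷ v)
pathWeight-∷ k x y v =
  ∏-allFin-suc (λ t → k t (lookup (x ∷ y ∷ v) (inject₁ t)) (lookup (x ∷ y ∷ v) (suc t)))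

-- Only the rows at good states `G` are normalised. If `k zero x y` is nonzero, then y is good and
-- the tail sums to 1 by induction; otherwise the tail sum, whatever its value, is multiplied by
-- zero.
∑-paths-forward : ∀ n (L : ℕ → List A) (k : Fin n → A → A → ℚ) (G : Fin (suc n) → A → Set) →
  (∀ t {x} → x ∈ L (toℕ t) → G (inject₁ t) x → (∑[ y ∈ L (suc (toℕ t)) ] k t x y) ≡ 1ℚ) →
  (∀ t {x y} → y ∈ L (suc (toℕ t)) → k t x y ≢ 0ℚ → G (suc t) y) →
  ∀ {x} → x ∈ L 0 → G zero x → (∑[ v ∈ sections (L ∘ suc) n ] pathWeight k (x ∷ v)) ≡ 1ℚ
∑-paths-forward zero    L k G row step x∈ g = refl
∑-paths-forward (suc n) L k G row step {x} x∈ g = begin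
  (∑[ v ∈ sections (L ∘ suc) (suc n) ] pathWeight k (x ∷ v))
    ≡⟨ ∑-product _∷_ (L 1) (sections (λ i → L (suc (suc i))) n) (λ v → pathWeight k (x ∷ v)) ⟩
  (∑[ y ∈ L 1 ] ∑[ v ∈ sections (λ i → L (suc (suc i))) n ] pathWeight k (x ∷ y ∷ v))
    ≡⟨ ∑-cong (L 1) (λ {y} y∈ → trans
         (∑-cong (sections (λ i → L (suc (suc i))) n) (λ {v} _ → pathWeight-∷ k x y v))
         (trans (∑-*ˡ (sections (λ i → L (suc (suc i))) n) (k zero x y) _)
                (tail-sum y∈ (k zero x y ℚₚ.≟ 0ℚ)))) ⟩
  (∑[ y ∈ L 1 ] k zero x y)
    ≡⟨ row zero x∈ g ⟩
  1ℚ ∎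
  where
  open ≡-Reasoning
  tail-sum : ∀ {y} → y ∈ L 1 → Dec (k zero x y ≡ 0ℚ) →
    k zero x y ℚ.* (∑[ v ∈ sections (λ i → L (suc (suc i))) n ] pathWeight (k ∘ suc) (y ∷ v)) ≡ k zero x y
  tail-sum y∈ (yes e) = trans (cong (ℚ._* tail) e) (trans (ℚₚ.*-zeroˡ tail) (sym e))
    where tail = ∑[ v ∈ sections (λ i → L (suc (suc i))) n ] pathWeight (k ∘ suc) (_ ∷ v)
  tail-sum {y} y∈ (no k≢0) = trans
    (cong (k zero x y ℚ.*_)
      (∑-paths-forward n (L ∘ suc) (k ∘ suc) (G ∘ suc) (row ∘ suc) (step ∘ suc) y∈ (step zero y∈ k≢0)))
    (ℚₚ.*-identityʳ (k zero x y))

∑-paths-backward : ∀ n (L : ℕ → List A) (k : Fin n → A → A → ℚ) (e : A → ℚ) (G : Fin (suc n) → A → Set) →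
  (∀ t x → Dec (G t x)) →
  (∀ t {y} → y ∈ L (suc (toℕ t)) → G (suc t) y → (∑[ x ∈ L (toℕ t) ] k t x y) ≡ 1ℚ) →
  (∀ t {x y} → ¬ G (inject₁ t) x → k t x y ≡ 0ℚ) →
  (∀ {x} → ¬ G (fromℕ n) x → e x ≡ 0ℚ) →
  (∑[ v ∈ sections L (suc n) ] (pathWeight k v ℚ.* e (lookup v (fromℕ n)))) ≡ ∑ (L n) e
∑-paths-backward zero L k e G G? col k-zero e-zero = trans
  (∑-product _∷_ (L 0) ([] ∷ []) (λ v → pathWeight k v ℚ.* e (lookup v zero)))
  (∑-cong (L 0) (λ {x} _ → trans (ℚₚ.+-identityʳ (1ℚ ℚ.* e x)) (ℚₚ.*-identityˡ (e x))))
∑-paths-backward {A} (suc n) L k e G G? col k-zero e-zero = begin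
  (∑[ v ∈ sections L (suc (suc n)) ] (pathWeight k v ℚ.* e (lookup v (fromℕ (suc n)))))
    ≡⟨ ∑-product _∷_ (L 0) S (λ v → pathWeight k v ℚ.* e (lookup v (fromℕ (suc n)))) ⟩
  (∑[ x ∈ L 0 ] ∑[ v ∈ S ] (pathWeight k (x ∷ v) ℚ.* e (lookup v (fromℕ n))))
    ≡⟨ ∑-swap (L 0) S _ ⟩
  (∑[ v ∈ S ] ∑[ x ∈ L 0 ] (pathWeight k (x ∷ v) ℚ.* e (lookup v (fromℕ n))))
    ≡⟨ ∑-cong S (λ {v} v∈ → head-sum v (∈-sections⁻ (L ∘ suc) v∈ zero)) ⟩
  (∑[ v ∈ S ] (pathWeight (k ∘ suc) v ℚ.* e (lookup v (fromℕ n))))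
    ≡⟨ ∑-paths-backward n (L ∘ suc) (k ∘ suc) e (G ∘ suc) (G? ∘ suc) (col ∘ suc) (k-zero ∘ suc) e-zero ⟩
  ∑ (L (suc n)) e ∎
  where
  open ≡-Reasoning
  S = sections (L ∘ suc) (suc n)
  rest : Vec A (suc n) → ℚ
  rest v = pathWeight (k ∘ suc) v ℚ.* e (lookup v (fromℕ n))
  rest-zero : ∀ m (k : Fin m → A → A → ℚ) (G : Fin (suc m) → A → Set) →
    (∀ t {x y} → ¬ G (inject₁ t) x → k t x y ≡ 0ℚ) → (∀ {x} → ¬ G (fromℕ m) x → e x ≡ 0ℚ) →
    ∀ v → ¬ G zero (lookup v zero) → pathWeight k v ℚ.* e (lookup v (fromℕ m)) ≡ 0ℚ
  rest-zero zero    k G k-zero e-zero (y ∷ []) ¬g =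
    trans (cong (1ℚ ℚ.*_) (e-zero ¬g)) (ℚₚ.*-zeroʳ 1ℚ)
  rest-zero (suc m) k G k-zero e-zero (y ∷ z ∷ v) ¬g =
    trans (cong (ℚ._* e (lookup v′ (fromℕ m)))
            (trans (pathWeight-∷ k y z v)
              (trans (cong (ℚ._* w) (k-zero zero ¬g)) (ℚₚ.*-zeroˡ w))))
          (ℚₚ.*-zeroˡ (e (lookup v′ (fromℕ m))))
    where
    v′ = z ∷ v
    w = pathWeight (k ∘ suc) v′
  col-sum : ∀ v → lookup v zero ∈ L 1 → Dec (G (suc zero) (lookup v zero)) →
            (∑[ x ∈ L 0 ] k zero x (lookup v zero)) ℚ.* rest v ≡ rest v
  col-sum v y∈ (yes g) = trans (cong (ℚ._* rest v) (col zero y∈ g)) (ℚₚ.*-identityˡ (rest v))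
  col-sum v y∈ (no ¬g) = trans (cong (s ℚ.*_) rest≡0) (trans (ℚₚ.*-zeroʳ s) (sym rest≡0))
    where
    s = ∑[ x ∈ L 0 ] k zero x (lookup v zero)
    rest≡0 = rest-zero n (k ∘ suc) (G ∘ suc) (k-zero ∘ suc) e-zero v ¬g
  head-sum : ∀ v → lookup v zero ∈ L 1 →
    (∑[ x ∈ L 0 ] (pathWeight k (x ∷ v) ℚ.* e (lookup v (fromℕ n)))) ≡ rest v
  head-sum (y ∷ v) y∈ = begin
    (∑[ x ∈ L 0 ] (pathWeight k (x ∷ y ∷ v) ℚ.* e (lookup (y ∷ v) (fromℕ n))))
      ≡⟨ ∑-cong (L 0) (λ {x} _ → trans (cong (ℚ._* e (lookup (y ∷ v) (fromℕ n))) (pathWeight-∷ k x y v))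
                                       (ℚₚ.*-assoc (k zero x y) _ _)) ⟩
    (∑[ x ∈ L 0 ] (k zero x y ℚ.* rest (y ∷ v)))
      ≡⟨ ∑-*ʳ (L 0) (rest (y ∷ v)) (λ x → k zero x y) ⟩
    (∑[ x ∈ L 0 ] k zero x y) ℚ.* rest (y ∷ v)
      ≡⟨ col-sum (y ∷ v) y∈ (G? (suc zero) y) ⟩
    rest (y ∷ v) ∎

-- The coupling kernel of two intertwined chains

module Intertwining
  {A : Set} (n : ℕ) (L M : ℕ → List A)
  (p r : Fin n → A → A → ℚ) (q : Fin (suc n) → A → A → ℚ)
  (pq≥0 : ∀ t {x y z} → x ∈ L (toℕ t) → y ∈ L (suc (toℕ t)) → z ∈ M (suc (toℕ t)) →
          0ℚ ℚ.≤ p t x y ℚ.* q (suc t) y z)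
  (qr≥0 : ∀ t {x y z} → x ∈ L (toℕ t) → y ∈ M (toℕ t) → z ∈ M (suc (toℕ t)) →
          0ℚ ℚ.≤ q (inject₁ t) x y ℚ.* r t y z)
  (intertwine : ∀ t {x z} → x ∈ L (toℕ t) → z ∈ M (suc (toℕ t)) →
                (∑[ y ∈ L (suc (toℕ t)) ] (p t x y ℚ.* q (suc t) y z)) ≡
                (∑[ y ∈ M (toℕ t) ] (q (inject₁ t) x y ℚ.* r t y z)))
  (q-start : ∀ {x y} → x ∈ L 0 → y ∈ M 0 → q zero x y ≡ 1ℚ)
  (q-end : ∀ {x y} → x ∈ L n → y ∈ M n → q (fromℕ n) x y ≡ 1ℚ)
  (L-start : (∑[ x ∈ L 0 ] 1ℚ) ≡ 1ℚ)
  (M-end : (∑[ x ∈ M n ] 1ℚ) ≡ 1ℚ)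
  where

  Δ : Fin n → A → A → ℚ
  Δ t x z = ∑[ y ∈ L (suc (toℕ t)) ] (p t x y ℚ.* q (suc t) y z)

  -- The conditional weight of the middle state y given x and z in the two-step chain `p` followed
  -- by `q`, as in the Diaconis-Fill construction.
  kernel : Fin n → A → A → A → ℚ
  kernel t x y z = p t x y ℚ.* q (suc t) y z ÷₀ Δ t x z

  private
    ∑-normalised : ∀ (xs : List A) (f : A → ℚ) {d} → ∑ xs f ≡ d → d ≢ 0ℚ → (∑[ x ∈ xs ] (f x ÷₀ d)) ≡ 1ℚ
    ∑-normalised xs f {d} e d≢0 = begin
      (∑[ x ∈ xs ] (f x ÷₀ d))        ≡⟨ ∑-cong xs (λ {x} _ → ÷₀-inv₀ (f x) d) ⟩
      (∑[ x ∈ xs ] (f x ℚ.* inv₀ d))  ≡⟨ ∑-*ʳ xs (inv₀ d) f ⟩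
      ∑ xs f ℚ.* inv₀ d               ≡⟨ cong (ℚ._* inv₀ d) e ⟩
      d ℚ.* inv₀ d                    ≡⟨ inv₀-inverse d≢0 ⟩
      1ℚ                              ∎
      where open ≡-Reasoning

    ÷₀-nonzeroˡ : ∀ {p} q → p ÷₀ q ≢ 0ℚ → p ≢ 0ℚ
    ÷₀-nonzeroˡ {p} q h = *-nonzeroˡ {p} {inv₀ q} (λ e → h (trans (÷₀-inv₀ p q) e))

  Δ-nonneg : ∀ t {x z} → x ∈ L (toℕ t) → z ∈ M (suc (toℕ t)) → 0ℚ ℚ.≤ Δ t x z
  Δ-nonneg t x∈ z∈ = ∑-nonneg (L (suc (toℕ t))) (λ y∈ → pq≥0 t x∈ y∈ z∈)

  kernel-nonneg : ∀ t {x y z} → x ∈ L (toℕ t) → y ∈ L (suc (toℕ t)) → z ∈ M (suc (toℕ t)) →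
                  0ℚ ℚ.≤ kernel t x y z
  kernel-nonneg t x∈ y∈ z∈ = subst (0ℚ ℚ.≤_) (sym (÷₀-inv₀ (p t _ _ ℚ.* q (suc t) _ _) (Δ t _ _)))
    (*-nonneg (pq≥0 t x∈ y∈ z∈) (inv₀-nonneg (Δ-nonneg t x∈ z∈)))

  -- With X fixed, a state x at time t is good if q from x to X(t) is nonzero. By `intertwine`, `Δ`
  -- is then a sum of nonnegative terms containing the nonzero one through X(t), so the row can be
  -- normalised. A nonzero kernel entry contains q at the next time, hence goodness persists.
  kernel-stochastic : ∀ (X : Vec A (suc n)) → (∀ t → lookup X t ∈ M (toℕ t)) →
    (∀ t → r t (lookup X (inject₁ t)) (lookup X (suc t)) ≢ 0ℚ) →
    (∑[ Y ∈ sections L (suc n) ] pathWeight (λ t x y → kernel t x y (lookup X (suc t))) Y) ≡ 1ℚ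
  kernel-stochastic X X∈ r≢0 = begin
    (∑[ Y ∈ sections L (suc n) ] pathWeight k Y)
      ≡⟨ ∑-product _∷_ (L 0) (sections (L ∘ suc) n) (pathWeight k) ⟩
    (∑[ x ∈ L 0 ] ∑[ Y ∈ sections (L ∘ suc) n ] pathWeight k (x ∷ Y))
      ≡⟨ ∑-cong (L 0) (λ {x} x∈ → ∑-paths-forward n L k G row step x∈
           (λ e → ℚₚ.1≢0 (trans (sym (q-start x∈ (X∈ zero))) e))) ⟩
    (∑[ x ∈ L 0 ] 1ℚ)
      ≡⟨ L-start ⟩
    1ℚ ∎
    where
    open ≡-Reasoning
    k : Fin n → A → A → ℚ
    k t x y = kernel t x y (lookup X (suc t))
    G : Fin (suc n) → A → Set
    G t x = q t x (lookup X t) ≢ 0ℚ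
    row : ∀ t {x} → x ∈ L (toℕ t) → G (inject₁ t) x → (∑[ y ∈ L (suc (toℕ t)) ] k t x y) ≡ 1ℚ
    row t {x} x∈ g = ∑-normalised (L (suc (toℕ t))) _ refl
      (λ e → ∑-nonzero (M (toℕ t)) (λ y∈ → qr≥0 t x∈ y∈ (X∈ (suc t)))
               (∈-inject₁ M X X∈ t) (*-nonzero g (r≢0 t))
               (trans (sym (intertwine t x∈ (X∈ (suc t)))) e))
    step : ∀ t {x y} → y ∈ L (suc (toℕ t)) → k t x y ≢ 0ℚ → G (suc t) y
    step t {x} {y} _ k≢0 = *-nonzeroʳ {p t x y} (÷₀-nonzeroˡ (Δ t x (lookup X (suc t))) k≢0)

  -- Bayes' rule along the path. As q is 1 at the start, its factors can be moved from time t + 1 to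
  -- time t, at the price of one factor q at the end. What multiplies the weight of Y is then a
  -- kernel in X normalised over the earlier state, because `intertwine` writes the same `Δ` as a
  -- sum of products q r.
  kernel-transport : ∀ (Y : Vec A (suc n)) → (∀ t → lookup Y t ∈ L (toℕ t)) →
    (∀ t → p t (lookup Y (inject₁ t)) (lookup Y (suc t)) ≢ 0ℚ) →
    (∑[ X ∈ sections M (suc n) ]
       (pathWeight (λ t x y → kernel t x y (lookup X (suc t))) Y ℚ.* pathWeight r X))
    ≡ pathWeight p Y
  kernel-transport Y Y∈ p≢0 = begin
    (∑[ X ∈ sections M (suc n) ]
       (pathWeight (λ t x y → kernel t x y (lookup X (suc t))) Y ℚ.* pathWeight r X))
      ≡⟨ ∑-cong (sections M (suc n)) (λ {X} X∈ → rearrange X (∈-sections⁻ M X∈ zero)) ⟩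
    (∑[ X ∈ sections M (suc n) ] (pathWeight p Y ℚ.* (pathWeight k X ℚ.* q (fromℕ n) (lookup Y (fromℕ n)) (lookup X (fromℕ n)))))
      ≡⟨ ∑-*ˡ (sections M (suc n)) (pathWeight p Y) _ ⟩
    pathWeight p Y ℚ.* (∑[ X ∈ sections M (suc n) ] (pathWeight k X ℚ.* q (fromℕ n) (lookup Y (fromℕ n)) (lookup X (fromℕ n))))
      ≡⟨ cong (pathWeight p Y ℚ.*_) (∑-paths-backward n M k (q (fromℕ n) (lookup Y (fromℕ n))) G
           (λ t x → ¬? (q t (lookup Y t) x ℚₚ.≟ 0ℚ)) col k-zero decide) ⟩
    pathWeight p Y ℚ.* ∑ (M n) (q (fromℕ n) (lookup Y (fromℕ n)))
      ≡⟨ cong (pathWeight p Y ℚ.*_) (trans (∑-cong (M n) (q-end Yₙ∈)) M-end) ⟩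
    pathWeight p Y ℚ.* 1ℚ
      ≡⟨ ℚₚ.*-identityʳ (pathWeight p Y) ⟩
    pathWeight p Y ∎
    where
    open ≡-Reasoning
    y : Fin (suc n) → A
    y = lookup Y
    Yₙ∈ : y (fromℕ n) ∈ L n
    Yₙ∈ = subst (λ i → y (fromℕ n) ∈ L i) (toℕ-fromℕ n) (Y∈ (fromℕ n))
    k : Fin n → A → A → ℚ
    k t x z = q (inject₁ t) (y (inject₁ t)) x ℚ.* r t x z ÷₀ Δ t (y (inject₁ t)) z
    G : Fin (suc n) → A → Set
    G t x = q t (y t) x ≢ 0ℚ
    decide : ∀ {a : ℚ} → ¬ (a ≢ 0ℚ) → a ≡ 0ℚ
    decide {a} h with a ℚₚ.≟ 0ℚ
    ... | yes e = e
    ... | no ne = ⊥-elim (h ne)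
    k-zero : ∀ t {x z} → ¬ G (inject₁ t) x → k t x z ≡ 0ℚ
    k-zero t {x} {z} ¬g = decide λ k≢0 →
      ¬g (*-nonzeroˡ {q = r t x z} (÷₀-nonzeroˡ (Δ t (y (inject₁ t)) z) k≢0))
    col : ∀ t {z} → z ∈ M (suc (toℕ t)) → G (suc t) z → (∑[ x ∈ M (toℕ t) ] k t x z) ≡ 1ℚ
    col t {z} z∈ g = ∑-normalised (M (toℕ t)) _ (sym (intertwine t yₜ∈ z∈))
      (∑-nonzero (L (suc (toℕ t))) (λ y∈ → pq≥0 t yₜ∈ y∈ z∈) (Y∈ (suc t)) (*-nonzero (p≢0 t) g))
      where yₜ∈ = ∈-inject₁ L Y Y∈ t
    rearrange : ∀ X → lookup X zero ∈ M 0 →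
      pathWeight (λ t x y → kernel t x y (lookup X (suc t))) Y ℚ.* pathWeight r X
      ≡ pathWeight p Y ℚ.* (pathWeight k X ℚ.* q (fromℕ n) (y (fromℕ n)) (lookup X (fromℕ n)))
    rearrange X x₀∈ = begin
      ∏ T (λ t → kernel t (y (inject₁ t)) (y (suc t)) (x (suc t))) ℚ.* ∏ T R
        ≡⟨ cong (ℚ._* ∏ T R) (trans (∏-cong T (λ {t} _ → ÷₀-inv₀ (P t ℚ.* Q (suc t)) (D t)))
             (trans (∏-* T (λ t → P t ℚ.* Q (suc t)) I) (cong (ℚ._* ∏ T I) (∏-* T P (Q ∘ suc))))) ⟩
      (∏ T P ℚ.* ∏ T (Q ∘ suc)) ℚ.* ∏ T I ℚ.* ∏ T R
        ≡⟨ cong (λ s → (∏ T P ℚ.* s) ℚ.* ∏ T I ℚ.* ∏ T R)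
             (trans (sym (ℚₚ.*-identityˡ (∏ T (Q ∘ suc))))
               (trans (cong (ℚ._* ∏ T (Q ∘ suc)) (sym (q-start (Y∈ zero) x₀∈)))
                 (∏-allFin-shift n Q))) ⟩
      (∏ T P ℚ.* (∏ T (Q ∘ inject₁) ℚ.* Q (fromℕ n))) ℚ.* ∏ T I ℚ.* ∏ T R
        ≡⟨ regroup (∏ T P) (∏ T (Q ∘ inject₁)) (Q (fromℕ n)) (∏ T I) (∏ T R) ⟩
      ∏ T P ℚ.* (((∏ T (Q ∘ inject₁) ℚ.* ∏ T R) ℚ.* ∏ T I) ℚ.* Q (fromℕ n))
        ≡⟨ cong (λ s → ∏ T P ℚ.* (s ℚ.* Q (fromℕ n)))
             (trans (∏-cong T (λ {t} _ → ÷₀-inv₀ (Q (inject₁ t) ℚ.* R t) (D t)))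
               (trans (∏-* T (λ t → Q (inject₁ t) ℚ.* R t) I)
                 (cong (ℚ._* ∏ T I) (∏-* T (Q ∘ inject₁) R)))) ⟨
      ∏ T P ℚ.* (pathWeight k X ℚ.* Q (fromℕ n)) ∎
      where
      x : Fin (suc n) → A
      x = lookup X
      T = allFin n
      P R D I : Fin n → ℚ
      P t = p t (y (inject₁ t)) (y (suc t))
      R t = r t (x (inject₁ t)) (x (suc t))
      D t = Δ t (y (inject₁ t)) (x (suc t))
      I t = inv₀ (D t)
      Q : Fin (suc n) → ℚ
      Q t = q t (y t) (x t)
      regroup : ∀ a b c d e → (a ℚ.* (b ℚ.* c)) ℚ.* d ℚ.* e ≡ a ℚ.* (((b ℚ.* e) ℚ.* d) ℚ.* c)
      regroup = RingSolver.solve-∀ ℚ-ring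

-- One-particle weights and the sum over intermediate configurations

i<i+1 : ∀ i → i ℤ.< i ℤ.+ 1ℤ
i<i+1 i = subst (i ℤ.<_) (ℤₚ.+-comm 1ℤ i) (ℤₚ.suc[i]≤j⇒i<j ℤₚ.≤-refl)

i<j⇒i+1≤j : ∀ {i j} → i ℤ.< j → i ℤ.+ 1ℤ ℤ.≤ j
i<j⇒i+1≤j {i} i<j = subst (ℤ._≤ _) (ℤₚ.+-comm 1ℤ i) (ℤₚ.i<j⇒suc[i]≤j i<j)

i<j⇒i+1≡j⊎i+1<j : ∀ {i j} → i ℤ.< j → i ℤ.+ 1ℤ ≡ j ⊎ i ℤ.+ 1ℤ ℤ.< j
i<j⇒i+1≡j⊎i+1<j {i} {j} i<j with i ℤ.+ 1ℤ ℤₚ.≟ j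
... | yes e = inj₁ e
... | no ne = inj₂ (ℤₚ.≤∧≢⇒< (i<j⇒i+1≤j i<j) ne)

i≢i+1 : ∀ i → i ≢ i ℤ.+ 1ℤ
i≢i+1 i = ℤₚ.<⇒≢ (i<i+1 i)

abstract

  -- The weight of one particle in Pt+ for a = N + S - 1, and in PS+ for a = N + t - 1;
  -- in both cases k = T - t - S.
  ω : (a k x y : ℤ) → ℤ
  ω a k x y =
    if does (y ℤₚ.≟ x ℤ.+ 1ℤ) then a ℤ.- x
    else if does (y ℤₚ.≟ x) then x ℤ.+ k
    else 0ℤ

  ω-jump : ∀ a k x {y} → y ≡ x ℤ.+ 1ℤ → ω a k x y ≡ a ℤ.- x
  ω-jump a k x {y} e with y ℤₚ.≟ x ℤ.+ 1ℤ
  ... | yes _ = refl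
  ... | no ne = ⊥-elim (ne e)

  ω-stay : ∀ a k x {y} → y ≡ x → ω a k x y ≡ x ℤ.+ k
  ω-stay a k x {y} e with y ℤₚ.≟ x ℤ.+ 1ℤ
  ... | yes e′ = ⊥-elim (i≢i+1 x (trans (sym e) e′))
  ... | no _ with y ℤₚ.≟ x
  ...   | yes _ = refl
  ...   | no ne = ⊥-elim (ne e)

  ω-zero : ∀ a k x {y} → y ≢ x ℤ.+ 1ℤ → y ≢ x → ω a k x y ≡ 0ℤ
  ω-zero a k x {y} ne₁ ne₀ with y ℤₚ.≟ x ℤ.+ 1ℤ
  ... | yes e = ⊥-elim (ne₁ e)
  ... | no _ with y ℤₚ.≟ x
  ...   | yes e = ⊥-elim (ne₀ e)
  ...   | no _ = refl

  [_<_] : ℤ → ℤ → ℤ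
  [ p < x ] = if does (p ℤₚ.<? x) then 1ℤ else 0ℤ

  [<]-true : ∀ {p x} → p ℤ.< x → [ p < x ] ≡ 1ℤ
  [<]-true {p} {x} p<x with p ℤₚ.<? x
  ... | yes _ = refl
  ... | no ¬p = ⊥-elim (¬p p<x)

  [<]-false : ∀ {p x} → ¬ p ℤ.< x → [ p < x ] ≡ 0ℤ
  [<]-false {p} {x} ¬p with p ℤₚ.<? x
  ... | yes p = ⊥-elim (¬p p)
  ... | no _ = refl

-- A form of `Increasing` adapted to recursion: the bound is the position of the preceding particle,
-- as in `H`.
Chain : ℤ → Config n → Set
Chain p []      = ⊤
Chain p (x ∷ v) = p ℤ.< x × Chain x v

-- Sum of ∏ u xᵢ yᵢ · w yᵢ zᵢ over the intermediate configurations p < y₁ < y₂ < …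
-- with every yᵢ ∈ {xᵢ, xᵢ + 1}.
H : (u w : ℤ → ℤ → ℤ) → ℤ → Config n → Config n → ℤ
H u w p []      []      = 1ℤ
H u w p (x ∷ v) (z ∷ s) =
  [ p < x ] ℤ.* (u x x ℤ.* w x z) ℤ.* H u w x v s ℤ.+
  [ p < x ℤ.+ 1ℤ ] ℤ.* (u x (x ℤ.+ 1ℤ) ℤ.* w (x ℤ.+ 1ℤ) z) ℤ.* H u w (x ℤ.+ 1ℤ) v s

term : ∀ {i i′ u u′ w w′ h h′} → i ≡ i′ → u ≡ u′ → w ≡ w′ → h ≡ h′ →
       i ℤ.* (u ℤ.* w) ℤ.* h ≡ i′ ℤ.* (u′ ℤ.* w′) ℤ.* h′
term refl refl refl refl = refl

-- H-0, H-1 and H-2 are named after the total displacement z - x.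
module _ (a b k k′ p x : ℤ) {z : ℤ} (v s : Config n) where

  private
    u = ω a k
    w = ω b k′
    h₀ = H u w x v s
    h₁ = H u w (x ℤ.+ 1ℤ) v s

    both : ∀ {i i′ w₀ w₁} → [ p < x ] ≡ i → [ p < x ℤ.+ 1ℤ ] ≡ i′ → w x z ≡ w₀ → w (x ℤ.+ 1ℤ) z ≡ w₁ →
      H u w p (x ∷ v) (z ∷ s) ≡
      i ℤ.* ((x ℤ.+ k) ℤ.* w₀) ℤ.* h₀ ℤ.+ i′ ℤ.* ((a ℤ.- x) ℤ.* w₁) ℤ.* h₁
    both e e′ e₀ e₁ = cong₂ ℤ._+_
      (term {h = h₀} e (ω-stay a k x refl) e₀ refl) (term {h = h₁} e′ (ω-jump a k x refl) e₁ refl)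

    x≢x+2 : x ≢ x ℤ.+ 1ℤ ℤ.+ 1ℤ
    x≢x+2 = ℤₚ.<⇒≢ (ℤₚ.<-trans (i<i+1 x) (i<i+1 (x ℤ.+ 1ℤ)))

  H-0 : p ℤ.< x → z ≡ x → H u w p (x ∷ v) (z ∷ s) ≡ (x ℤ.+ k) ℤ.* (x ℤ.+ k′) ℤ.* h₀
  H-0 p<x refl = trans
    (both ([<]-true p<x) ([<]-true (ℤₚ.<-trans p<x (i<i+1 x))) (ω-stay b k′ x refl)
      (ω-zero b k′ (x ℤ.+ 1ℤ) x≢x+2 (i≢i+1 x)))
    (simplify (x ℤ.+ k) (x ℤ.+ k′) (a ℤ.- x) h₀ h₁)
    where
    simplify : ∀ c c′ d h₀ h₁ → 1ℤ ℤ.* (c ℤ.* c′) ℤ.* h₀ ℤ.+ 1ℤ ℤ.* (d ℤ.* 0ℤ) ℤ.* h₁ ≡ c ℤ.* c′ ℤ.* h₀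
    simplify = solve-∀

  H-1 : ∀ {i} → [ p < x ] ≡ i → p ℤ.< x ℤ.+ 1ℤ → z ≡ x ℤ.+ 1ℤ → H u w p (x ∷ v) (z ∷ s) ≡
        i ℤ.* ((x ℤ.+ k) ℤ.* (b ℤ.- x)) ℤ.* h₀ ℤ.+ 1ℤ ℤ.* ((a ℤ.- x) ℤ.* (x ℤ.+ 1ℤ ℤ.+ k′)) ℤ.* h₁
  H-1 e p<x+1 z≡x+1 = both e ([<]-true p<x+1) (ω-jump b k′ x z≡x+1) (ω-stay b k′ (x ℤ.+ 1ℤ) z≡x+1)

  H-2 : p ℤ.< x ℤ.+ 1ℤ → z ≡ x ℤ.+ 1ℤ ℤ.+ 1ℤ → H u w p (x ∷ v) (z ∷ s) ≡
        (a ℤ.- x) ℤ.* (b ℤ.- (x ℤ.+ 1ℤ)) ℤ.* h₁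
  H-2 p<x+1 refl = trans
    (both refl ([<]-true p<x+1) (ω-zero b k′ x (λ e → i≢i+1 (x ℤ.+ 1ℤ) (sym e)) (λ e → x≢x+2 (sym e)))
      (ω-jump b k′ (x ℤ.+ 1ℤ) refl))
    (simplify [ p < x ] (x ℤ.+ k) (a ℤ.- x) (b ℤ.- (x ℤ.+ 1ℤ)) h₀ h₁)
    where
    simplify : ∀ i c d d′ h₀ h₁ → i ℤ.* (c ℤ.* 0ℤ) ℤ.* h₀ ℤ.+ 1ℤ ℤ.* (d ℤ.* d′) ℤ.* h₁ ≡ d ℤ.* d′ ℤ.* h₁
    simplify = solve-∀

  H-else : z ≢ x → z ≢ x ℤ.+ 1ℤ → z ≢ x ℤ.+ 1ℤ ℤ.+ 1ℤ → H u w p (x ∷ v) (z ∷ s) ≡ 0ℤ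
  H-else z≢x z≢x+1 z≢x+2 = trans
    (both refl refl (ω-zero b k′ x z≢x+1 z≢x) (ω-zero b k′ (x ℤ.+ 1ℤ) z≢x+2 z≢x+1))
    (simplify [ p < x ] [ p < x ℤ.+ 1ℤ ] (x ℤ.+ k) (a ℤ.- x) h₀ h₁)
    where
    simplify : ∀ i i′ c d h₀ h₁ → i ℤ.* (c ℤ.* 0ℤ) ℤ.* h₀ ℤ.+ i′ ℤ.* (d ℤ.* 0ℤ) ℤ.* h₁ ≡ 0ℤ
    simplify = solve-∀

H-below : ∀ u w {p p′} x (v : Config n) z s → p ℤ.< x → p′ ℤ.< x →
          H u w p (x ∷ v) (z ∷ s) ≡ H u w p′ (x ∷ v) (z ∷ s)
H-below u w x v z s p<x p′<x = cong₂
  (λ i j → i ℤ.* (u x x ℤ.* w x z) ℤ.* H u w x v s ℤ.+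
           j ℤ.* (u x (x ℤ.+ 1ℤ) ℤ.* w (x ℤ.+ 1ℤ) z) ℤ.* H u w (x ℤ.+ 1ℤ) v s)
  (trans ([<]-true p<x) (sym ([<]-true p′<x)))
  (trans ([<]-true (ℤₚ.<-trans p<x (i<i+1 x))) (sym ([<]-true (ℤₚ.<-trans p′<x (i<i+1 x)))))

-- The two bounds differ only if the first particle sits at `p + 1`, where the larger bound forbids
-- it to stay. But its target lies beyond `p + 2`, so it has to jump in both steps, or the sum is
-- zero.
H-bound-irrelevant : ∀ {a b k k′} p (x z : Config n) → Chain p x → Chain (p ℤ.+ 1ℤ ℤ.+ 1ℤ) z →
  H (ω a k) (ω b k′) (p ℤ.+ 1ℤ) x z ≡ H (ω a k) (ω b k′) p x z
H-bound-irrelevant p [] [] _ _ = refl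
H-bound-irrelevant {a = a} {b} {k} {k′} p (x ∷ v) (z ∷ s) (p<x , _) (p+2<z , _)
  with i<j⇒i+1≡j⊎i+1<j p<x
... | inj₂ p+1<x = H-below (ω a k) (ω b k′) x v z s p+1<x p<x
... | inj₁ refl with z ℤₚ.≟ x ℤ.+ 1ℤ ℤ.+ 1ℤ
...   | yes z≡x+2 = trans (H-2 a b k k′ (p ℤ.+ 1ℤ) x v s (i<i+1 x) z≡x+2)
                     (sym (H-2 a b k k′ p x v s (ℤₚ.<-trans p<x (i<i+1 x)) z≡x+2))
...   | no z≢x+2 = trans (H-else a b k k′ (p ℤ.+ 1ℤ) x v s z≢x z≢x+1 z≢x+2)
                    (sym (H-else a b k k′ p x v s z≢x z≢x+1 z≢x+2))
  where
  z≢x+1 : z ≢ x ℤ.+ 1ℤ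
  z≢x+1 e = ℤₚ.<⇒≢ p+2<z (sym e)
  z≢x : z ≢ x
  z≢x e = ℤₚ.<⇒≢ (ℤₚ.<-trans (i<i+1 x) p+2<z) (sym e)

-- Comparison of the two orders of transition

module Exchange (a b k : ℤ) where

  -- A time step raises b = N + t - 1 by one, a level step raises a = N + S - 1 by one, and either
  -- lowers k = T - t - S by one. This gives the parameters of the second transition in each order.
  HA HB : ℤ → Config n → Config n → ℤ
  HA = H (ω a k) (ω (b ℤ.+ 1ℤ) (k ℤ.- 1ℤ))
  HB = H (ω b k) (ω (a ℤ.+ 1ℤ) (k ℤ.- 1ℤ))

  private
    -- Brings an equation e = f into a ring identity: it suffices to exhibit the difference of the
    -- two sides as a multiple of e - f.
    modulo : ∀ {l r} c {e f} → e ≡ f → l ≡ r ℤ.+ c ℤ.* (e ℤ.- f) → l ≡ r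
    modulo {r = r} c {e} refl h = trans h (cancel r c e)
      where
      cancel : ∀ r c e → r ℤ.+ c ℤ.* (e ℤ.- e) ≡ r
      cancel = solve-∀

  -- Induction on the particles, by the total displacement of the first one. For 0 and 2 its
  -- intermediate position is determined and the product of its two weights agrees in both orders.
  -- For 1 both intermediate positions occur, and the tails must be compared for two bounds at once,
  -- which is what `exchange-forced` provides.
  exchange : ∀ p {q} (x z : Config n) → Chain p x → Chain q z → HA p x z ≡ HB p x z

  -- The sums over y₁ > p + 1 (forced to jump when x₁ = p + 1) are not equal; they
  -- differ in a way that makes the induction for exchange close.
  exchange-forced : ∀ p (x z : Config n) → Chain p x → Chain (p ℤ.+ 1ℤ) z →
    (a ℤ.- p) ℤ.* HA (p ℤ.+ 1ℤ) x z ≡ (b ℤ.- p) ℤ.* HB (p ℤ.+ 1ℤ) x z ℤ.+ (a ℤ.- b) ℤ.* HA p x z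

  exchange p [] [] _ _ = refl
  exchange p (x ∷ v) (z ∷ s) (p<x , v>x) (_ , s>z) with z ℤₚ.≟ x
  ... | yes refl = trans (H-0 a (b ℤ.+ 1ℤ) k (k ℤ.- 1ℤ) p x v s p<x refl)
    (trans (cong ((x ℤ.+ k) ℤ.* (x ℤ.+ (k ℤ.- 1ℤ)) ℤ.*_) (exchange x v s v>x s>z))
    (sym (H-0 b (a ℤ.+ 1ℤ) k (k ℤ.- 1ℤ) p x v s p<x refl)))
  ... | no z≢x with z ℤₚ.≟ x ℤ.+ 1ℤ
  ...   | yes refl = begin
    HA p (x ∷ v) (z ∷ s)
      ≡⟨ H-1 a (b ℤ.+ 1ℤ) k (k ℤ.- 1ℤ) p x v s ([<]-true p<x) p<x+1 refl ⟩
    1ℤ ℤ.* ((x ℤ.+ k) ℤ.* (b ℤ.+ 1ℤ ℤ.- x)) ℤ.* hA₀ ℤ.+ 1ℤ ℤ.* ((a ℤ.- x) ℤ.* (x ℤ.+ 1ℤ ℤ.+ (k ℤ.- 1ℤ))) ℤ.* hA₁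
      -- The particle stays in exactly one of the two steps, with weight `x + k` in both cases, as x
      -- + 1 + (k - 1) = x + k. Without this factor the difference of the two sides is the forced
      -- relation for the tail at bound x.
      ≡⟨ modulo (x ℤ.+ k) (exchange-forced x v s v>x s>z) (identity a b k x hA₀ hA₁ hB₁) ⟩
    1ℤ ℤ.* ((x ℤ.+ k) ℤ.* (a ℤ.+ 1ℤ ℤ.- x)) ℤ.* hA₀ ℤ.+ 1ℤ ℤ.* ((b ℤ.- x) ℤ.* (x ℤ.+ 1ℤ ℤ.+ (k ℤ.- 1ℤ))) ℤ.* hB₁
      ≡⟨ cong (λ h → 1ℤ ℤ.* ((x ℤ.+ k) ℤ.* (a ℤ.+ 1ℤ ℤ.- x)) ℤ.* h ℤ.+ 1ℤ ℤ.* ((b ℤ.- x) ℤ.* (x ℤ.+ 1ℤ ℤ.+ (k ℤ.- 1ℤ))) ℤ.* hB₁)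
           (exchange x v s v>x s>z) ⟩
    1ℤ ℤ.* ((x ℤ.+ k) ℤ.* (a ℤ.+ 1ℤ ℤ.- x)) ℤ.* hB₀ ℤ.+ 1ℤ ℤ.* ((b ℤ.- x) ℤ.* (x ℤ.+ 1ℤ ℤ.+ (k ℤ.- 1ℤ))) ℤ.* hB₁
      ≡⟨ H-1 b (a ℤ.+ 1ℤ) k (k ℤ.- 1ℤ) p x v s ([<]-true p<x) p<x+1 refl ⟨
    HB p (x ∷ v) (z ∷ s) ∎
    where
    open ≡-Reasoning
    p<x+1 = ℤₚ.<-trans p<x (i<i+1 x)
    hA₀ = HA x v s
    hA₁ = HA (x ℤ.+ 1ℤ) v s
    hB₀ = HB x v s
    hB₁ = HB (x ℤ.+ 1ℤ) v s
    identity : ∀ a b k x hA₀ hA₁ hB₁ →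
      1ℤ ℤ.* ((x ℤ.+ k) ℤ.* (b ℤ.+ 1ℤ ℤ.- x)) ℤ.* hA₀ ℤ.+ 1ℤ ℤ.* ((a ℤ.- x) ℤ.* (x ℤ.+ 1ℤ ℤ.+ (k ℤ.- 1ℤ))) ℤ.* hA₁
      ≡ 1ℤ ℤ.* ((x ℤ.+ k) ℤ.* (a ℤ.+ 1ℤ ℤ.- x)) ℤ.* hA₀ ℤ.+ 1ℤ ℤ.* ((b ℤ.- x) ℤ.* (x ℤ.+ 1ℤ ℤ.+ (k ℤ.- 1ℤ))) ℤ.* hB₁
        ℤ.+ (x ℤ.+ k) ℤ.* ((a ℤ.- x) ℤ.* hA₁ ℤ.- ((b ℤ.- x) ℤ.* hB₁ ℤ.+ (a ℤ.- b) ℤ.* hA₀))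
    identity = solve-∀
  ...   | no z≢x+1 with z ℤₚ.≟ x ℤ.+ 1ℤ ℤ.+ 1ℤ
  ...     | no z≢x+2 = trans (H-else a (b ℤ.+ 1ℤ) k (k ℤ.- 1ℤ) p x v s z≢x z≢x+1 z≢x+2)
                        (sym (H-else b (a ℤ.+ 1ℤ) k (k ℤ.- 1ℤ) p x v s z≢x z≢x+1 z≢x+2))
  ...     | yes refl = begin
    HA p (x ∷ v) (z ∷ s)
      ≡⟨ H-2 a (b ℤ.+ 1ℤ) k (k ℤ.- 1ℤ) p x v s p<x+1 refl ⟩
    (a ℤ.- x) ℤ.* (b ℤ.+ 1ℤ ℤ.- (x ℤ.+ 1ℤ)) ℤ.* HA (x ℤ.+ 1ℤ) v s
      ≡⟨ cong ((a ℤ.- x) ℤ.* (b ℤ.+ 1ℤ ℤ.- (x ℤ.+ 1ℤ)) ℤ.*_)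
           -- The tail v is only known to lie above x, so the bound is lowered to x for the
           -- induction hypothesis and raised again afterwards.
           (trans (H-bound-irrelevant x v s v>x s>z)
           (trans (exchange x v s v>x s>z) (sym (H-bound-irrelevant x v s v>x s>z)))) ⟩
    (a ℤ.- x) ℤ.* (b ℤ.+ 1ℤ ℤ.- (x ℤ.+ 1ℤ)) ℤ.* HB (x ℤ.+ 1ℤ) v s
      ≡⟨ identity a b x (HB (x ℤ.+ 1ℤ) v s) ⟩
    (b ℤ.- x) ℤ.* (a ℤ.+ 1ℤ ℤ.- (x ℤ.+ 1ℤ)) ℤ.* HB (x ℤ.+ 1ℤ) v s
      ≡⟨ H-2 b (a ℤ.+ 1ℤ) k (k ℤ.- 1ℤ) p x v s p<x+1 refl ⟨
    HB p (x ∷ v) (z ∷ s) ∎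
    where
    open ≡-Reasoning
    p<x+1 = ℤₚ.<-trans p<x (i<i+1 x)
    identity : ∀ a b x h → (a ℤ.- x) ℤ.* (b ℤ.+ 1ℤ ℤ.- (x ℤ.+ 1ℤ)) ℤ.* h ≡ (b ℤ.- x) ℤ.* (a ℤ.+ 1ℤ ℤ.- (x ℤ.+ 1ℤ)) ℤ.* h
    identity = solve-∀

  exchange-forced p [] [] _ _ = identity a b p
    where
    identity : ∀ a b p → (a ℤ.- p) ℤ.* 1ℤ ≡ (b ℤ.- p) ℤ.* 1ℤ ℤ.+ (a ℤ.- b) ℤ.* 1ℤ
    identity = solve-∀
  exchange-forced p (x₁ ∷ v) (z₁ ∷ s) (p<x , v>x) (p+1<z , s>z) =
    -- The call to `exchange` at the same length is well-founded, since `exchange` refers back to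
    -- this lemma only for the tail.
    by-cases (exchange p (x₁ ∷ v) (z₁ ∷ s) (p<x , v>x) (p+1<z , s>z)) (i<j⇒i+1≡j⊎i+1<j p<x) (i<j⇒i+1≡j⊎i+1<j p+1<z)
    where
    open ≡-Reasoning
    x = x₁ ∷ v
    z = z₁ ∷ s
    Goal = (a ℤ.- p) ℤ.* HA (p ℤ.+ 1ℤ) x z ≡ (b ℤ.- p) ℤ.* HB (p ℤ.+ 1ℤ) x z ℤ.+ (a ℤ.- b) ℤ.* HA p x z
    -- If raising the bound to `p + 1` changes neither sum, the relation is just a - p = (b - p) +
    -- (a - b).
    unforced : HA p x z ≡ HB p x z → HA (p ℤ.+ 1ℤ) x z ≡ HA p x z → HB (p ℤ.+ 1ℤ) x z ≡ HB p x z → Goal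
    unforced e eA eB = begin
      (a ℤ.- p) ℤ.* HA (p ℤ.+ 1ℤ) x z
        ≡⟨ cong ((a ℤ.- p) ℤ.*_) eA ⟩
      (a ℤ.- p) ℤ.* HA p x z
        ≡⟨ split a b p (HA p x z) ⟩
      (b ℤ.- p) ℤ.* HA p x z ℤ.+ (a ℤ.- b) ℤ.* HA p x z
        ≡⟨ cong (λ h → (b ℤ.- p) ℤ.* h ℤ.+ (a ℤ.- b) ℤ.* HA p x z)
             (trans e (sym eB)) ⟩
      (b ℤ.- p) ℤ.* HB (p ℤ.+ 1ℤ) x z ℤ.+ (a ℤ.- b) ℤ.* HA p x z ∎
      where
      split : ∀ a b p h → (a ℤ.- p) ℤ.* h ≡ (b ℤ.- p) ℤ.* h ℤ.+ (a ℤ.- b) ℤ.* h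
      split = solve-∀
    by-cases : HA p x z ≡ HB p x z → p ℤ.+ 1ℤ ≡ x₁ ⊎ p ℤ.+ 1ℤ ℤ.< x₁ → p ℤ.+ 1ℤ ℤ.+ 1ℤ ≡ z₁ ⊎ p ℤ.+ 1ℤ ℤ.+ 1ℤ ℤ.< z₁ → Goal
    by-cases e (inj₂ p+1<x) _ = unforced e
      (H-below (ω a k) (ω (b ℤ.+ 1ℤ) (k ℤ.- 1ℤ)) x₁ v z₁ s p+1<x p<x)
      (H-below (ω b k) (ω (a ℤ.+ 1ℤ) (k ℤ.- 1ℤ)) x₁ v z₁ s p+1<x p<x)
    by-cases e (inj₁ _) (inj₂ p+2<z) = unforced e
      (H-bound-irrelevant p x z (p<x , v>x) (p+2<z , s>z)) (H-bound-irrelevant p x z (p<x , v>x) (p+2<z , s>z))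
    by-cases _ (inj₁ refl) (inj₁ refl) = begin
      (a ℤ.- p) ℤ.* HA x₁ x z
        ≡⟨ cong ((a ℤ.- p) ℤ.*_) (H-1 a (b ℤ.+ 1ℤ) k (k ℤ.- 1ℤ) x₁ x₁ v s x≮x (i<i+1 x₁) refl) ⟩
      (a ℤ.- p) ℤ.* (0ℤ ℤ.* ((p ℤ.+ 1ℤ ℤ.+ k) ℤ.* (b ℤ.+ 1ℤ ℤ.- (p ℤ.+ 1ℤ))) ℤ.* hA₀ ℤ.+ 1ℤ ℤ.* ((a ℤ.- (p ℤ.+ 1ℤ)) ℤ.* (p ℤ.+ 1ℤ ℤ.+ 1ℤ ℤ.+ (k ℤ.- 1ℤ))) ℤ.* hA₁)
        -- Moving the term with a - b to the left changes the coefficient of `hA₁` from a - p to (a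
        -- - p) - (a - b) = b - p, up to common factors. The rest is a multiple of the forced
        -- relation for the tail at bound `x₁`.
        ≡⟨ modulo ((b ℤ.- p) ℤ.* (p ℤ.+ 1ℤ ℤ.+ k)) (exchange-forced x₁ v s v>x s>z)
             (identity a b k p hA₀ hA₁ hB₀ hB₁) ⟩
      (b ℤ.- p) ℤ.* (0ℤ ℤ.* ((p ℤ.+ 1ℤ ℤ.+ k) ℤ.* (a ℤ.+ 1ℤ ℤ.- (p ℤ.+ 1ℤ))) ℤ.* hB₀ ℤ.+ 1ℤ ℤ.* ((b ℤ.- (p ℤ.+ 1ℤ)) ℤ.* (p ℤ.+ 1ℤ ℤ.+ 1ℤ ℤ.+ (k ℤ.- 1ℤ))) ℤ.* hB₁)
      ℤ.+ (a ℤ.- b) ℤ.* (1ℤ ℤ.* ((p ℤ.+ 1ℤ ℤ.+ k) ℤ.* (b ℤ.+ 1ℤ ℤ.- (p ℤ.+ 1ℤ))) ℤ.* hA₀ ℤ.+ 1ℤ ℤ.* ((a ℤ.- (p ℤ.+ 1ℤ)) ℤ.* (p ℤ.+ 1ℤ ℤ.+ 1ℤ ℤ.+ (k ℤ.- 1ℤ))) ℤ.* hA₁)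
        ≡⟨ cong₂ (λ h h′ → (b ℤ.- p) ℤ.* h ℤ.+ (a ℤ.- b) ℤ.* h′)
             (H-1 b (a ℤ.+ 1ℤ) k (k ℤ.- 1ℤ) x₁ x₁ v s x≮x (i<i+1 x₁) refl)
             (H-1 a (b ℤ.+ 1ℤ) k (k ℤ.- 1ℤ) p x₁ v s ([<]-true p<x) (ℤₚ.<-trans p<x (i<i+1 x₁)) refl) ⟨
      (b ℤ.- p) ℤ.* HB x₁ x z ℤ.+ (a ℤ.- b) ℤ.* HA p x z ∎
      where
      -- The first particle sits exactly at the raised bound, so the indicator of staying is 0 in
      -- the forced sums and 1 in the sum with bound p.
      x≮x = [<]-false (ℤₚ.<-irrefl {x₁} refl)
      hA₀ = HA x₁ v s
      hA₁ = HA (x₁ ℤ.+ 1ℤ) v s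
      hB₀ = HB x₁ v s
      hB₁ = HB (x₁ ℤ.+ 1ℤ) v s
      identity : ∀ a b k p hA₀ hA₁ hB₀ hB₁ →
        (a ℤ.- p) ℤ.* (0ℤ ℤ.* ((p ℤ.+ 1ℤ ℤ.+ k) ℤ.* (b ℤ.+ 1ℤ ℤ.- (p ℤ.+ 1ℤ))) ℤ.* hA₀ ℤ.+ 1ℤ ℤ.* ((a ℤ.- (p ℤ.+ 1ℤ)) ℤ.* (p ℤ.+ 1ℤ ℤ.+ 1ℤ ℤ.+ (k ℤ.- 1ℤ))) ℤ.* hA₁)
        ≡ (b ℤ.- p) ℤ.* (0ℤ ℤ.* ((p ℤ.+ 1ℤ ℤ.+ k) ℤ.* (a ℤ.+ 1ℤ ℤ.- (p ℤ.+ 1ℤ))) ℤ.* hB₀ ℤ.+ 1ℤ ℤ.* ((b ℤ.- (p ℤ.+ 1ℤ)) ℤ.* (p ℤ.+ 1ℤ ℤ.+ 1ℤ ℤ.+ (k ℤ.- 1ℤ))) ℤ.* hB₁)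
        ℤ.+ (a ℤ.- b) ℤ.* (1ℤ ℤ.* ((p ℤ.+ 1ℤ ℤ.+ k) ℤ.* (b ℤ.+ 1ℤ ℤ.- (p ℤ.+ 1ℤ))) ℤ.* hA₀ ℤ.+ 1ℤ ℤ.* ((a ℤ.- (p ℤ.+ 1ℤ)) ℤ.* (p ℤ.+ 1ℤ ℤ.+ 1ℤ ℤ.+ (k ℤ.- 1ℤ))) ℤ.* hA₁)
        ℤ.+ ((b ℤ.- p) ℤ.* (p ℤ.+ 1ℤ ℤ.+ k)) ℤ.* ((a ℤ.- (p ℤ.+ 1ℤ)) ℤ.* hA₁ ℤ.- ((b ℤ.- (p ℤ.+ 1ℤ)) ℤ.* hB₁ ℤ.+ (a ℤ.- b) ℤ.* hA₀))
      identity = solve-∀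

-- From the recursive sum to sums over lists of configurations

Chain⇒< : ∀ {p} (x : Config n) → Chain p x → ∀ i → p ℤ.< lookup x i
Chain⇒< (x ∷ v) (p<x , _)   zero    = p<x
Chain⇒< (x ∷ v) (p<x , x<v) (suc i) = ℤₚ.<-trans p<x (Chain⇒< v x<v i)

Chain⇒Increasing : ∀ {p} (x : Config n) → Chain p x → Increasing x
Chain⇒Increasing (x ∷ v) (_ , x<v) zero    (suc j) _         = Chain⇒< v x<v j
Chain⇒Increasing (x ∷ v) (_ , x<v) (suc i) (suc j) (s≤s i<j) = Chain⇒Increasing v x<v i j i<j

Increasing⇒Chain : ∀ {p} (x : Config n) → (∀ i → p ℤ.< lookup x i) → Increasing x → Chain p x
Increasing⇒Chain []      _   _   = tt
Increasing⇒Chain (x ∷ v) p<x inc = p<x zero ,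
  Increasing⇒Chain v (λ i → inc zero (suc i) (s≤s z≤n)) (λ i j i<j → inc (suc i) (suc j) (s≤s i<j))

wt : (a k : ℤ) → Config n → Config n → ℤ
wt a k []      []      = 1ℤ
wt a k (x ∷ v) (y ∷ s) = ω a k x y ℤ.* wt a k v s

cands : Config n → List (Config n)
cands []      = [] ∷ []
cands (x ∷ v) = cartesianProductWith _∷_ (x ∷ x ℤ.+ 1ℤ ∷ []) (cands v)

cands-unique : ∀ (x : Config n) → Unique (cands x)
cands-unique []      = [] ∷ []
cands-unique (x ∷ v) =
  Uniqueₚ.cartesianProductWith⁺ _∷_ Vecₚ.∷-injective ((i≢i+1 x ∷ []) ∷ [] ∷ []) (cands-unique v)

ℤ-*-nonzeroˡ : ∀ {i} j → i ℤ.* j ≢ 0ℤ → i ≢ 0ℤ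
ℤ-*-nonzeroˡ j h refl = h (ℤₚ.*-zeroˡ j)

ℤ-*-nonzeroʳ : ∀ i {j} → i ℤ.* j ≢ 0ℤ → j ≢ 0ℤ
ℤ-*-nonzeroʳ i h refl = h (ℤₚ.*-zeroʳ i)

ω-nonzero : ∀ {a k x y} → ω a k x y ≢ 0ℤ → y ≡ x ℤ.+ 1ℤ ⊎ y ≡ x
ω-nonzero {a} {k} {x} {y} h = by-cases (y ℤₚ.≟ x ℤ.+ 1ℤ) (y ℤₚ.≟ x)
  where
  by-cases : Dec (y ≡ x ℤ.+ 1ℤ) → Dec (y ≡ x) → y ≡ x ℤ.+ 1ℤ ⊎ y ≡ x
  by-cases (yes e) _       = inj₁ e
  by-cases (no _)  (yes e) = inj₂ e
  by-cases (no ne) (no ne′) = ⊥-elim (h (ω-zero a k x ne ne′))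

wt-nonzero : ∀ {a k} (x y : Config n) → wt a k x y ≢ 0ℤ → ∀ i → ω a k (lookup x i) (lookup y i) ≢ 0ℤ
wt-nonzero {a = a} {k} (x ∷ v) (y ∷ s) h zero    = ℤ-*-nonzeroˡ (wt a k v s) h
wt-nonzero {a = a} {k} (x ∷ v) (y ∷ s) h (suc i) = wt-nonzero v s (ℤ-*-nonzeroʳ (ω a k x y) h) i

wt-nonzero⇒∈cands : ∀ {a k} (x y : Config n) → wt a k x y ≢ 0ℤ → y ∈ cands x
wt-nonzero⇒∈cands []      []      _ = here refl
wt-nonzero⇒∈cands {a = a} {k} (x ∷ v) (y ∷ s) h =
  ∈-cartesianProductWith⁺ _∷_ (head-∈ (ω-nonzero (ℤ-*-nonzeroˡ (wt a k v s) h)))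
    (wt-nonzero⇒∈cands v s (ℤ-*-nonzeroʳ (ω a k x y) h))
  where
  head-∈ : y ≡ x ℤ.+ 1ℤ ⊎ y ≡ x → y ∈ x ∷ x ℤ.+ 1ℤ ∷ []
  head-∈ (inj₁ e) = there (here e)
  head-∈ (inj₂ e) = here e

-- One summand of `H`. The indicators extend it by zero to configurations that are not increasing,
-- so that the sum may run over all of `cands x`.
chainTerm : (u w : ℤ → ℤ → ℤ) → ℤ → (x z y : Config n) → ℤ
chainTerm u w p []      []      []      = 1ℤ
chainTerm u w p (x ∷ v) (z ∷ s) (y ∷ r) =
  [ p < y ] ℤ.* (u x y ℤ.* w y z) ℤ.* chainTerm u w y v s r

∑-chainTerm : ∀ u w p (x z : Config n) →
  (∑[ y ∈ cands x ] fromℤ (chainTerm u w p x z y)) ≡ fromℤ (H u w p x z)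
∑-chainTerm u w p []      []      = refl
∑-chainTerm u w p (x ∷ v) (z ∷ s) = begin
  (∑[ y ∈ cands (x ∷ v) ] fromℤ (chainTerm u w p (x ∷ v) (z ∷ s) y))
    ≡⟨ ∑-product _∷_ (x ∷ x ℤ.+ 1ℤ ∷ []) (cands v) (λ y → fromℤ (chainTerm u w p (x ∷ v) (z ∷ s) y)) ⟩
  (∑[ y ∈ x ∷ x ℤ.+ 1ℤ ∷ [] ] ∑[ r ∈ cands v ] fromℤ (c y ℤ.* chainTerm u w y v s r))
    ≡⟨ ∑-cong (x ∷ x ℤ.+ 1ℤ ∷ []) (λ {y} _ → fixed y) ⟩
  fromℤ (c x ℤ.* H u w x v s) ℚ.+ (fromℤ (c (x ℤ.+ 1ℤ) ℤ.* H u w (x ℤ.+ 1ℤ) v s) ℚ.+ 0ℚ)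
    ≡⟨ cong (fromℤ (c x ℤ.* H u w x v s) ℚ.+_) (ℚₚ.+-identityʳ (fromℤ (c (x ℤ.+ 1ℤ) ℤ.* H u w (x ℤ.+ 1ℤ) v s))) ⟩
  fromℤ (c x ℤ.* H u w x v s) ℚ.+ fromℤ (c (x ℤ.+ 1ℤ) ℤ.* H u w (x ℤ.+ 1ℤ) v s)
    ≡⟨ fromℤ-+ (c x ℤ.* H u w x v s) (c (x ℤ.+ 1ℤ) ℤ.* H u w (x ℤ.+ 1ℤ) v s) ⟨
  fromℤ (H u w p (x ∷ v) (z ∷ s)) ∎
  where
  open ≡-Reasoning
  c : ℤ → ℤ
  c y = [ p < y ] ℤ.* (u x y ℤ.* w y z)
  fixed : ∀ y → (∑[ r ∈ cands v ] fromℤ (c y ℤ.* chainTerm u w y v s r)) ≡ fromℤ (c y ℤ.* H u w y v s)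
  fixed y = begin
    (∑[ r ∈ cands v ] fromℤ (c y ℤ.* chainTerm u w y v s r))
      ≡⟨ ∑-cong (cands v) (λ {r} _ → fromℤ-* (c y) (chainTerm u w y v s r)) ⟩
    (∑[ r ∈ cands v ] (fromℤ (c y) ℚ.* fromℤ (chainTerm u w y v s r)))
      ≡⟨ ∑-*ˡ (cands v) (fromℤ (c y)) _ ⟩
    fromℤ (c y) ℚ.* (∑[ r ∈ cands v ] fromℤ (chainTerm u w y v s r))
      ≡⟨ cong (fromℤ (c y) ℚ.*_) (∑-chainTerm u w y v s) ⟩
    fromℤ (c y) ℚ.* fromℤ (H u w y v s)
      ≡⟨ fromℤ-* (c y) (H u w y v s) ⟨
    fromℤ (c y ℤ.* H u w y v s) ∎

chainTerm-wt : ∀ a k b l {p} (x z y : Config n) → Chain p y →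
  chainTerm (ω a k) (ω b l) p x z y ≡ wt a k x y ℤ.* wt b l y z
chainTerm-wt a k b l []      []      []      _           = refl
chainTerm-wt a k b l {p} (x ∷ v) (z ∷ s) (y ∷ r) (p<y , y<r) = trans
  (cong₂ (λ i h → i ℤ.* (ω a k x y ℤ.* ω b l y z) ℤ.* h) ([<]-true p<y) (chainTerm-wt a k b l v s r y<r))
  (rearrange (ω a k x y) (ω b l y z) (wt a k v r) (wt b l r s))
  where
  rearrange : ∀ u w m m′ → 1ℤ ℤ.* (u ℤ.* w) ℤ.* (m ℤ.* m′) ≡ u ℤ.* m ℤ.* (w ℤ.* m′)
  rearrange = solve-∀

chainTerm-nonzero : ∀ u w {p} (x z y : Config n) → chainTerm u w p x z y ≢ 0ℤ → Chain p y
chainTerm-nonzero u w     []      []      []      _ = tt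
chainTerm-nonzero u w {p} (x ∷ v) (z ∷ s) (y ∷ r) h = p<y ,
  chainTerm-nonzero u w v s r (ℤ-*-nonzeroʳ ([ p < y ] ℤ.* (u x y ℤ.* w y z)) h)
  where
  p<y : p ℤ.< y
  p<y with p ℤₚ.<? y
  ... | yes q = q
  ... | no ¬q = ⊥-elim (ℤ-*-nonzeroˡ (u x y ℤ.* w y z)
                  (ℤ-*-nonzeroˡ (chainTerm u w y v s r) h) ([<]-false ¬q))

-- For a = N + S - 1, b = N + t - 1 and k = T - t - S this is membership in 𝔛.
record InDom (a b k x : ℤ) : Set where
  constructor inDom
  field
    0≤x   : 0ℤ ℤ.≤ x
    0≤x+k : 0ℤ ℤ.≤ x ℤ.+ k
    x≤a   : x ℤ.≤ a
    x≤b   : x ℤ.≤ b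

open InDom

record Admissible (a b k : ℤ) (x : Config n) : Set where
  constructor admissible
  field
    domain     : ∀ i → InDom a b k (lookup x i)
    increasing : Increasing x

open Admissible

InDom-swap : ∀ {a b k x} → InDom a b k x → InDom b a k x
InDom-swap (inDom l m r s) = inDom l m s r

Admissible-swap : ∀ {a b k} {x : Config n} → Admissible a b k x → Admissible b a k x
Admissible-swap (admissible d inc) = admissible (InDom-swap ∘ d) inc

i≤j∧i≢j⇒i+1≤j : ∀ {i j} → i ℤ.≤ j → i ≢ j → i ℤ.+ 1ℤ ℤ.≤ j
i≤j∧i≢j⇒i+1≤j i≤j i≢j = i<j⇒i+1≤j (ℤₚ.≤∧≢⇒< i≤j i≢j)

i≤i+1 : ∀ i → i ℤ.≤ i ℤ.+ 1ℤ
i≤i+1 i = ℤₚ.<⇒≤ (i<i+1 i)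

-- The weights vanish exactly where a move would leave the next domain: the jump weight a - x at x =
-- a, the stay weight x + k at x + k = 0. The remaining bounds move along with b and k.
InDom-step : ∀ {a b k x y} → InDom a b k x → ω a k x y ≢ 0ℤ → InDom a (b ℤ.+ 1ℤ) (k ℤ.- 1ℤ) y
InDom-step {a} {b} {k} {x} {y} (inDom 0≤x 0≤x+k x≤a x≤b) h = by-cases (ω-nonzero h)
  where
  by-cases : y ≡ x ℤ.+ 1ℤ ⊎ y ≡ x → InDom a (b ℤ.+ 1ℤ) (k ℤ.- 1ℤ) y
  by-cases (inj₁ refl) = inDom
    (ℤₚ.≤-trans 0≤x (i≤i+1 x))
    (subst (0ℤ ℤ.≤_) (shift x k) 0≤x+k)
    (i≤j∧i≢j⇒i+1≤j x≤a (λ { refl → h (trans (ω-jump a k x refl) (ℤₚ.+-inverseʳ x)) }))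
    (ℤₚ.+-monoˡ-≤ 1ℤ x≤b)
    where
    shift : ∀ x k → x ℤ.+ k ≡ x ℤ.+ 1ℤ ℤ.+ (k ℤ.- 1ℤ)
    shift = solve-∀
  by-cases (inj₂ refl) = inDom
    0≤x
    (subst (0ℤ ℤ.≤_) (shift x k)
      (ℤₚ.+-monoˡ-≤ (ℤ.- 1ℤ) (i≤j∧i≢j⇒i+1≤j 0≤x+k (λ e → h (trans (ω-stay a k x refl) (sym e))))))
    x≤a
    (ℤₚ.≤-trans x≤b (i≤i+1 b))
    where
    shift : ∀ x k → x ℤ.+ k ℤ.- 1ℤ ≡ x ℤ.+ (k ℤ.- 1ℤ)
    shift = solve-∀

wt-nonneg : ∀ {a b k} (x y : Config n) → (∀ i → InDom a b k (lookup x i)) → 0ℤ ℤ.≤ wt a k x y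
wt-nonneg []      []      _ = ℤ.+≤+ z≤n
wt-nonneg {a = a} {b} {k} (x ∷ v) (y ∷ s) d =
  ℤ-*-nonneg (ω-nonneg (y ℤₚ.≟ x ℤ.+ 1ℤ) (y ℤₚ.≟ x)) (wt-nonneg v s (d ∘ suc))
  where
  ℤ-*-nonneg : ∀ {i j} → 0ℤ ℤ.≤ i → 0ℤ ℤ.≤ j → 0ℤ ℤ.≤ i ℤ.* j
  ℤ-*-nonneg {j = j} 0≤i 0≤j = ℤₚ.*-monoʳ-≤-nonNeg j {{ℤ.nonNegative 0≤j}} 0≤i
  ω-nonneg : Dec (y ≡ x ℤ.+ 1ℤ) → Dec (y ≡ x) → 0ℤ ℤ.≤ ω a k x y
  ω-nonneg (yes e) _ = subst (0ℤ ℤ.≤_) (sym (ω-jump a k x e)) (ℤₚ.i≤j⇒0≤j-i (x≤a (d zero)))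
  ω-nonneg (no _) (yes e) = subst (0ℤ ℤ.≤_) (sym (ω-stay a k x e)) (0≤x+k (d zero))
  ω-nonneg (no ne) (no ne′) = ℤₚ.≤-reflexive (sym (ω-zero a k x ne ne′))

Admissible⇒Chain : ∀ {a b k} {x : Config n} → Admissible a b k x → Chain (ℤ.- 1ℤ) x
Admissible⇒Chain {x = x} (admissible d inc) =
  Increasing⇒Chain x (λ i → ℤₚ.<-≤-trans ℤ.-<+ (0≤x (d i))) inc

-- A nonzero summand comes from a chain of steps of nonzero weight, so by `InDom-step` it belongs to
-- L as well as to `cands x`. The initial bound -1 lies below all positions, which are nonnegative.
∑-wt : ∀ {a b k} b′ k′ {x : Config n} (z : Config n) {L : List (Config n)} →
  Unique L → (∀ y → y ∈ L ⇔ Admissible a (b ℤ.+ 1ℤ) (k ℤ.- 1ℤ) y) → Admissible a b k x →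
  (∑[ y ∈ L ] fromℤ (wt a k x y ℤ.* wt b′ k′ y z)) ≡ fromℤ (H (ω a k) (ω b′ k′) (ℤ.- 1ℤ) x z)
∑-wt {a = a} {b} {k} b′ k′ {x} z {L} L! L⇔ (admissible dx _) = begin
  (∑[ y ∈ L ] fromℤ (wt a k x y ℤ.* wt b′ k′ y z))
    ≡⟨ ∑-cong L (λ {y} y∈ → cong fromℤ (sym (chainTerm-wt a k b′ k′ x z y
         (Admissible⇒Chain (Equivalence.to (L⇔ y) y∈))))) ⟩
  ∑ L f
    ≡⟨ ∑-support f L! (cands-unique x) (λ {y} fy≢0 → support y (λ e → fy≢0 (cong fromℤ e))) ⟩
  ∑ (cands x) f
    ≡⟨ ∑-chainTerm (ω a k) (ω b′ k′) (ℤ.- 1ℤ) x z ⟩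
  fromℤ (H (ω a k) (ω b′ k′) (ℤ.- 1ℤ) x z) ∎
  where
  open ≡-Reasoning
  term′ : Config _ → ℤ
  term′ = chainTerm (ω a k) (ω b′ k′) (ℤ.- 1ℤ) x z
  f : Config _ → ℚ
  f y = fromℤ (term′ y)
  support : ∀ y → term′ y ≢ 0ℤ → y ∈ L ⇔ y ∈ cands x
  support y h = mk⇔ (λ _ → wt-nonzero⇒∈cands x y wt≢0)
    (λ _ → Equivalence.from (L⇔ y) (admissible (λ i → InDom-step (dx i) (wt-nonzero x y wt≢0 i)) (Chain⇒Increasing y chain)))
    where
    chain : Chain (ℤ.- 1ℤ) y
    chain = chainTerm-nonzero (ω a k) (ω b′ k′) x z y h
    wt≢0 : wt a k x y ≢ 0ℤ
    wt≢0 = ℤ-*-nonzeroˡ (wt b′ k′ y z) (λ e → h (trans (chainTerm-wt a k b′ k′ x z y chain) e))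

-- The common form of the two matrices and their commutation

∏ℤ-allFin-suc : ∀ (f : Fin (suc n) → ℤ) →
                ∏ℤ (allFin (suc n)) f ≡ f zero ℤ.* ∏ℤ (allFin n) (f ∘ suc)
∏ℤ-allFin-suc f = cong (λ ps → f zero ℤ.* foldr ℤ._*_ 1ℤ ps)
  (trans (Listₚ.map-tabulate suc f) (sym (Listₚ.map-tabulate (λ i → i) (λ i → f (suc i)))))

∏ℤ-cong : ∀ (xs : List A) {f g : A → ℤ} → (∀ {x} → x ∈ xs → f x ≡ g x) → ∏ℤ xs f ≡ ∏ℤ xs g
∏ℤ-cong []       h = refl
∏ℤ-cong (x ∷ xs) h = cong₂ ℤ._*_ (h (here refl)) (∏ℤ-cong xs (h ∘ there))

ℤ-*-pos : ∀ {i j} → 0ℤ ℤ.< i → 0ℤ ℤ.< j → 0ℤ ℤ.< i ℤ.* j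
ℤ-*-pos {i} {j} 0<i 0<j = ℤₚ.*-monoʳ-<-pos j {{ℤ.positive 0<j}} 0<i

∏ℤ-pos : ∀ (xs : List A) {f : A → ℤ} → (∀ {x} → x ∈ xs → 0ℤ ℤ.< f x) → 0ℤ ℤ.< ∏ℤ xs f
∏ℤ-pos []       h = ℤ.+<+ (s≤s z≤n)
∏ℤ-pos (x ∷ xs) h = ℤ-*-pos (h (here refl)) (∏ℤ-pos xs (h ∘ there))

i<j⇒0<j-i : ∀ {i j} → i ℤ.< j → 0ℤ ℤ.< j ℤ.- i
i<j⇒0<j-i {i} {j} i<j = subst (ℤ._< j ℤ.- i) (ℤₚ.+-inverseʳ i) (ℤₚ.+-monoˡ-< (ℤ.- i) i<j)

vandermonde-pos : ∀ (x : Config n) → Increasing x → 0ℤ ℤ.< (∏[i<j] x)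
vandermonde-pos {n} x inc = ∏ℤ-pos (allFin n) λ {i} _ →
  ∏ℤ-pos (filter (i Finₚ.<?_) (allFin n)) λ {j} j∈ →
    i<j⇒0<j-i (inc i j (proj₂ (∈-filter⁻ (i Finₚ.<?_) {xs = allFin n} j∈)))

wt-allFin : ∀ a k (x y : Config n) → (∏ℤ[ i ∈ allFin n ] ω a k (lookup x i) (lookup y i)) ≡ wt a k x y
wt-allFin a k []      []      = refl
wt-allFin a k (x ∷ v) (y ∷ s) = trans (∏ℤ-allFin-suc (λ i → ω a k (lookup (x ∷ v) i) (lookup (y ∷ s) i)))
  (cong (ω a k x y ℤ.*_) (wt-allFin a k v s))

if-dec : ∀ {P : Set} (p? : Dec P) {a b c : A} → (P → a ≡ c) → (¬ P → b ≡ c) → (if does p? then a else b) ≡ c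
if-dec (yes p) e _ = e p
if-dec (no ¬p) _ e = e ¬p

Step⇒jump⊎stay : ∀ (x y : Config n) → Step x y → ∀ i → lookup y i ≡ lookup x i ℤ.+ 1ℤ ⊎ lookup y i ≡ lookup x i
Step⇒jump⊎stay x y st i = by-cases (st i)
  where
  difference : ∀ y x → y ≡ x ℤ.+ (y ℤ.- x)
  difference = solve-∀
  by-cases : (lookup y i ℤ.- lookup x i ≡ 0ℤ) ⊎ (lookup y i ℤ.- lookup x i ≡ 1ℤ) →
             lookup y i ≡ lookup x i ℤ.+ 1ℤ ⊎ lookup y i ≡ lookup x i
  by-cases (inj₁ e) = inj₂ (trans (difference (lookup y i) (lookup x i))
    (trans (cong (λ d → lookup x i ℤ.+ d) e) (ℤₚ.+-identityʳ _)))
  by-cases (inj₂ e) = inj₁ (trans (difference (lookup y i) (lookup x i)) (cong (λ d → lookup x i ℤ.+ d) e))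

-- This is `Pt+` for a = N + S - 1 and d = (T - t)_N, and `PS+` for a = N + t - 1 and d = (T - S)_N.
transition : (a k d : ℤ) → Config n → Config n → ℚ
transition a k d x y =
  fromℤ (∏[i<j] y) ℚ.* fromℤ (wt a k x y) ℚ.* (inv₀ (fromℤ d) ℚ.* inv₀ (fromℤ (∏[i<j] x)))

module _ {n} (a k : ℤ) (x y : Config n) where

  private
    jumps stays : List (Fin n) → List (Fin n)
    jumps = filter (λ i → lookup y i ℤₚ.≟ (lookup x i ℤ.+ 1ℤ))
    stays = filter (λ i → lookup y i ℤₚ.≟ lookup x i)

    jumpWeight stayWeight : Fin n → ℤ
    jumpWeight i = a ℤ.- lookup x i
    stayWeight i = lookup x i ℤ.+ k

  ∏-jumps-stays : Step x y → ∀ is →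
    ∏ℤ (jumps is) jumpWeight ℤ.* ∏ℤ (stays is) stayWeight ≡ (∏ℤ[ i ∈ is ] ω a k (lookup x i) (lookup y i))
  ∏-jumps-stays st []       = refl
  ∏-jumps-stays st (i ∷ is) with lookup y i ℤₚ.≟ (lookup x i ℤ.+ 1ℤ) | lookup y i ℤₚ.≟ lookup x i
  ... | yes e | yes e′ = ⊥-elim (i≢i+1 (lookup x i) (trans (sym e′) e))
  ... | yes e | no _   = trans (ℤₚ.*-assoc (jumpWeight i) _ _)
    (cong₂ ℤ._*_ (sym (ω-jump a k (lookup x i) e)) (∏-jumps-stays st is))
  ... | no _  | yes e  = trans (rearrange (∏ℤ (jumps is) jumpWeight) (stayWeight i) (∏ℤ (stays is) stayWeight))
    (cong₂ ℤ._*_ (sym (ω-stay a k (lookup x i) e)) (∏-jumps-stays st is))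
    where
    rearrange : ∀ j s m → j ℤ.* (s ℤ.* m) ≡ s ℤ.* (j ℤ.* m)
    rearrange = solve-∀
  ... | no ne | no ne′ = ⊥-elim (Sum.[ ne , ne′ ] (Step⇒jump⊎stay x y st i))

  wt-nonzero⇒Step : wt a k x y ≢ 0ℤ → Step x y
  wt-nonzero⇒Step h i = by-cases (ω-nonzero (wt-nonzero x y h i))
    where
    cancel : ∀ x → x ℤ.+ 1ℤ ℤ.- x ≡ 1ℤ
    cancel = solve-∀
    by-cases : lookup y i ≡ lookup x i ℤ.+ 1ℤ ⊎ lookup y i ≡ lookup x i →
               (lookup y i ℤ.- lookup x i ≡ 0ℤ) ⊎ (lookup y i ℤ.- lookup x i ≡ 1ℤ)
    by-cases (inj₁ e) = inj₂ (trans (cong (λ w → w ℤ.- lookup x i) e) (cancel (lookup x i)))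
    by-cases (inj₂ e) = inj₁ (trans (cong (λ w → w ℤ.- lookup x i) e) (ℤₚ.+-inverseʳ (lookup x i)))

  transition-nonzero⇒Step : ∀ d → transition a k d x y ≢ 0ℚ → Step x y
  transition-nonzero⇒Step d h = wt-nonzero⇒Step λ e →
    *-nonzeroʳ {p = fromℤ (∏[i<j] y)} {q = fromℤ (wt a k x y)} (*-nonzeroˡ h) (cong fromℤ e)

  -- On a step every particle either jumps or stays, so the two products merge into `wt`; off steps
  -- some factor of `wt` is zero, in agreement with the guard. `jumpW` and `stayW` absorb the
  -- different bracketing of the weights in the two matrices.
  matrix-transition : ∀ d {jumpW stayW : Fin n → ℤ} →
    (∀ i → jumpW i ≡ jumpWeight i) → (∀ i → stayW i ≡ stayWeight i) →
    (if does (step? x y)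
     then fromℤ ((∏[i<j] y) ℤ.* ∏ℤ (jumping x y) jumpW ℤ.* ∏ℤ (staying x y) stayW)
          ÷₀ fromℤ (d ℤ.* (∏[i<j] x))
     else 0ℚ) ≡ transition a k d x y
  matrix-transition d {jumpW} {stayW} ej es = if-dec (step? x y) on-step off-step
    where
    open ≡-Reasoning
    V : Config n → ℤ
    V x = ∏[i<j] x
    numerator : Step x y → fromℤ (V y ℤ.* ∏ℤ (jumping x y) jumpW ℤ.* ∏ℤ (staying x y) stayW) ≡ fromℤ (V y) ℚ.* fromℤ (wt a k x y)
    numerator st = trans (cong fromℤ (trans (ℤₚ.*-assoc (V y) _ _)
      (cong (V y ℤ.*_) (trans (cong₂ ℤ._*_ (∏ℤ-cong (jumping x y) (λ {i} _ → ej i)) (∏ℤ-cong (staying x y) (λ {i} _ → es i)))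
        (trans (∏-jumps-stays st (allFin n)) (wt-allFin a k x y))))))
      (fromℤ-* (V y) (wt a k x y))
    denominator : inv₀ (fromℤ (d ℤ.* V x)) ≡ inv₀ (fromℤ d) ℚ.* inv₀ (fromℤ (V x))
    denominator = trans (cong inv₀ (fromℤ-* d (V x))) (inv₀-* (fromℤ d) (fromℤ (V x)))
    on-step : Step x y → fromℤ (V y ℤ.* ∏ℤ (jumping x y) jumpW ℤ.* ∏ℤ (staying x y) stayW) ÷₀ fromℤ (d ℤ.* V x) ≡ transition a k d x y
    on-step st = begin
      fromℤ (V y ℤ.* ∏ℤ (jumping x y) jumpW ℤ.* ∏ℤ (staying x y) stayW) ÷₀ fromℤ (d ℤ.* V x)
        ≡⟨ ÷₀-inv₀ (fromℤ (V y ℤ.* ∏ℤ (jumping x y) jumpW ℤ.* ∏ℤ (staying x y) stayW)) (fromℤ (d ℤ.* V x)) ⟩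
      fromℤ (V y ℤ.* ∏ℤ (jumping x y) jumpW ℤ.* ∏ℤ (staying x y) stayW) ℚ.* inv₀ (fromℤ (d ℤ.* V x))
        ≡⟨ cong₂ ℚ._*_ (numerator st) denominator ⟩
      transition a k d x y ∎
    off-step : ¬ Step x y → 0ℚ ≡ transition a k d x y
    off-step ¬st = sym (zero-product (wt≡0 (wt a k x y ℤₚ.≟ 0ℤ)))
      where
      wt≡0 : Dec (wt a k x y ≡ 0ℤ) → wt a k x y ≡ 0ℤ
      wt≡0 (yes e) = e
      wt≡0 (no ne) = ⊥-elim (¬st (wt-nonzero⇒Step ne))
      c = inv₀ (fromℤ d) ℚ.* inv₀ (fromℤ (∏[i<j] x))
      zero-product : wt a k x y ≡ 0ℤ → fromℤ (∏[i<j] y) ℚ.* fromℤ (wt a k x y) ℚ.* c ≡ 0ℚ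
      zero-product e = trans (cong (λ w → fromℤ (∏[i<j] y) ℚ.* fromℤ w ℚ.* c) e)
        (trans (cong (ℚ._* c) (ℚₚ.*-zeroʳ (fromℤ (∏[i<j] y)))) (ℚₚ.*-zeroˡ c))

fromℤ-pos-nonzero : ∀ {i} → 0ℤ ℤ.< i → fromℤ i ≢ 0ℚ
fromℤ-pos-nonzero 0<i = fromℤ-nonzero (λ e → ℤₚ.<⇒≢ 0<i (sym e))

vandermonde-nonzero : ∀ (x : Config n) → Increasing x → fromℤ (∏[i<j] x) ≢ 0ℚ
vandermonde-nonzero x inc = fromℤ-pos-nonzero (vandermonde-pos x inc)

transition-nonneg : ∀ {a b k d} {x : Config n} (y : Config n) → 0ℤ ℤ.< d → Admissible a b k x → Increasing y →
                    0ℚ ℚ.≤ transition a k d x y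
transition-nonneg {x = x} y 0<d (admissible dx incx) incy = *-nonneg
  (*-nonneg (fromℤ-nonneg (ℤₚ.<⇒≤ (vandermonde-pos y incy))) (fromℤ-nonneg (wt-nonneg x y dx)))
  (*-nonneg (inv₀-nonneg (fromℤ-nonneg (ℤₚ.<⇒≤ 0<d)))
            (inv₀-nonneg (fromℤ-nonneg (ℤₚ.<⇒≤ (vandermonde-pos x incx)))))

∑-transitions : ∀ {a b k} b′ k′ d d′ {x : Config n} (z : Config n) {L : List (Config n)} →
  Unique L → (∀ y → y ∈ L ⇔ Admissible a (b ℤ.+ 1ℤ) (k ℤ.- 1ℤ) y) → Admissible a b k x →
  (∑[ y ∈ L ] (transition a k d x y ℚ.* transition b′ k′ d′ y z)) ≡
  fromℤ (∏[i<j] z) ℚ.* inv₀ (fromℤ (∏[i<j] x)) ℚ.* (inv₀ (fromℤ d) ℚ.* inv₀ (fromℤ d′)) ℚ.*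
  fromℤ (H (ω a k) (ω b′ k′) (ℤ.- 1ℤ) x z)
∑-transitions {a = a} {b} {k} b′ k′ d d′ {x} z {L} L! L⇔ ax = begin
  (∑[ y ∈ L ] (transition a k d x y ℚ.* transition b′ k′ d′ y z))
    ≡⟨ ∑-cong L (λ {y} y∈ → cancel y (increasing (Equivalence.to (L⇔ y) y∈))) ⟩
  (∑[ y ∈ L ] (c ℚ.* fromℤ (wt a k x y ℤ.* wt b′ k′ y z)))
    ≡⟨ ∑-*ˡ L c _ ⟩
  c ℚ.* (∑[ y ∈ L ] fromℤ (wt a k x y ℤ.* wt b′ k′ y z))
    ≡⟨ cong (c ℚ.*_) (∑-wt b′ k′ z L! L⇔ ax) ⟩
  c ℚ.* fromℤ (H (ω a k) (ω b′ k′) (ℤ.- 1ℤ) x z) ∎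
  where
  open ≡-Reasoning
  V : Config _ → ℚ
  V x = fromℤ (∏[i<j] x)
  c = V z ℚ.* inv₀ (V x) ℚ.* (inv₀ (fromℤ d) ℚ.* inv₀ (fromℤ d′))
  rearrange : ∀ vy w i ix vz w′ i′ iy → (vy ℚ.* w ℚ.* (i ℚ.* ix)) ℚ.* (vz ℚ.* w′ ℚ.* (i′ ℚ.* iy)) ≡
              (vy ℚ.* iy) ℚ.* (vz ℚ.* ix ℚ.* (i ℚ.* i′) ℚ.* (w ℚ.* w′))
  rearrange = RingSolver.solve-∀ ℚ-ring
  cancel : ∀ y → Increasing y → transition a k d x y ℚ.* transition b′ k′ d′ y z ≡
                                c ℚ.* fromℤ (wt a k x y ℤ.* wt b′ k′ y z)
  cancel y incy = begin
    transition a k d x y ℚ.* transition b′ k′ d′ y z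
      ≡⟨ rearrange (V y) (fromℤ (wt a k x y)) (inv₀ (fromℤ d)) (inv₀ (V x)) (V z) (fromℤ (wt b′ k′ y z)) (inv₀ (fromℤ d′)) (inv₀ (V y)) ⟩
    (V y ℚ.* inv₀ (V y)) ℚ.* (c ℚ.* (fromℤ (wt a k x y) ℚ.* fromℤ (wt b′ k′ y z)))
      ≡⟨ cong₂ ℚ._*_ (inv₀-inverse (vandermonde-nonzero y incy)) (cong (c ℚ.*_) (sym (fromℤ-* (wt a k x y) (wt b′ k′ y z)))) ⟩
    1ℚ ℚ.* (c ℚ.* fromℤ (wt a k x y ℤ.* wt b′ k′ y z))
      ≡⟨ ℚₚ.*-identityˡ _ ⟩
    c ℚ.* fromℤ (wt a k x y ℤ.* wt b′ k′ y z) ∎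

transitions-commute : ∀ {a b k} d d′ {x z : Config n} {L M : List (Config n)} {q} → Unique L → Unique M →
  (∀ y → y ∈ L ⇔ Admissible a (b ℤ.+ 1ℤ) (k ℤ.- 1ℤ) y) →
  (∀ y → y ∈ M ⇔ Admissible (a ℤ.+ 1ℤ) b (k ℤ.- 1ℤ) y) →
  Admissible a b k x → Chain q z →
  (∑[ y ∈ L ] (transition a k d x y ℚ.* transition (b ℤ.+ 1ℤ) (k ℤ.- 1ℤ) d′ y z)) ≡
  (∑[ y ∈ M ] (transition b k d′ x y ℚ.* transition (a ℤ.+ 1ℤ) (k ℤ.- 1ℤ) d y z))
transitions-commute {a = a} {b} {k} d d′ {x} {z} {L} {M} L! M! L⇔ M⇔ ax cz = begin
  (∑[ y ∈ L ] (transition a k d x y ℚ.* transition (b ℤ.+ 1ℤ) (k ℤ.- 1ℤ) d′ y z))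
    ≡⟨ ∑-transitions (b ℤ.+ 1ℤ) (k ℤ.- 1ℤ) d d′ z L! L⇔ ax ⟩
  c ℚ.* (inv₀ (fromℤ d) ℚ.* inv₀ (fromℤ d′)) ℚ.* fromℤ (HA (ℤ.- 1ℤ) x z)
    ≡⟨ cong₂ (λ e h → c ℚ.* e ℚ.* fromℤ h) (ℚₚ.*-comm (inv₀ (fromℤ d)) (inv₀ (fromℤ d′)))
         (exchange (ℤ.- 1ℤ) x z (Admissible⇒Chain ax) cz) ⟩
  c ℚ.* (inv₀ (fromℤ d′) ℚ.* inv₀ (fromℤ d)) ℚ.* fromℤ (HB (ℤ.- 1ℤ) x z)
    ≡⟨ ∑-transitions (a ℤ.+ 1ℤ) (k ℤ.- 1ℤ) d′ d z M!
         -- Admissibility is symmetric in a and b, so the other order is the same computation with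
         -- their roles exchanged.
         (λ y → mk⇔ (Admissible-swap ∘ Equivalence.to (M⇔ y)) (Equivalence.from (M⇔ y) ∘ Admissible-swap))
         (Admissible-swap ax) ⟨
  (∑[ y ∈ M ] (transition b k d′ x y ℚ.* transition (a ℤ.+ 1ℤ) (k ℤ.- 1ℤ) d y z)) ∎
  where
  open ≡-Reasoning
  open Exchange a b k
  c = fromℤ (∏[i<j] z) ℚ.* inv₀ (fromℤ (∏[i<j] x))

-- Signs and Pochhammer products

0≤i+j : ∀ {i j} → 0ℤ ℤ.≤ i → 0ℤ ℤ.≤ j → 0ℤ ℤ.≤ i ℤ.+ j
0≤i+j = ℤₚ.+-mono-≤

0≤+ : ∀ n → 0ℤ ℤ.≤ + n
0≤+ n = ℤ.+≤+ z≤n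

0≤n-1-i : ∀ (i : Fin n) → 0ℤ ℤ.≤ + n ℤ.- 1ℤ ℤ.- + toℕ i
0≤n-1-i {n} i = subst (0ℤ ℤ.≤_) (regroup (+ n) (+ toℕ i)) (ℤₚ.i≤j⇒0≤j-i (ℤ.+≤+ (toℕ<n i)))
  where
  regroup : ∀ n i → n ℤ.- (1ℤ ℤ.+ i) ≡ n ℤ.- 1ℤ ℤ.- i
  regroup = solve-∀

pochhammer-pos : ∀ {i} n → 0ℤ ℤ.< i → 0ℤ ℤ.< pochhammer i n
pochhammer-pos zero    0<i = ℤ.+<+ (s≤s z≤n)
pochhammer-pos (suc n) 0<i = ℤ-*-pos (pochhammer-pos n 0<i) (ℤₚ.+-mono-<-≤ 0<i (0≤+ n))

pochhammer-suc : ∀ i n → pochhammer i (suc n) ≡ i ℤ.* pochhammer (i ℤ.+ 1ℤ) n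
pochhammer-suc i zero    = base i
  where
  base : ∀ i → 1ℤ ℤ.* (i ℤ.+ 0ℤ) ≡ i ℤ.* 1ℤ
  base = solve-∀
pochhammer-suc i (suc n) = trans (cong (ℤ._* (i ℤ.+ + suc n)) (pochhammer-suc i n))
  (regroup i (pochhammer (i ℤ.+ 1ℤ) n) (+ n))
  where
  regroup : ∀ i p n → i ℤ.* p ℤ.* (i ℤ.+ (1ℤ ℤ.+ n)) ≡ i ℤ.* (p ℤ.* (i ℤ.+ 1ℤ ℤ.+ n))
  regroup = solve-∀

-- Staircases

stair : ℤ → ∀ n → Config n
stair c zero    = []
stair c (suc n) = c ∷ stair (c ℤ.+ 1ℤ) n

lookup-stair : ∀ c (i : Fin n) → lookup (stair c n) i ≡ c ℤ.+ + toℕ i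
lookup-stair c zero    = sym (ℤₚ.+-identityʳ c)
lookup-stair c (suc i) = trans (lookup-stair (c ℤ.+ 1ℤ) i) (ℤₚ.+-assoc c 1ℤ (+ toℕ i))

Chain-stair : ∀ {p} c n → p ℤ.< c → Chain p (stair c n)
Chain-stair c zero    _   = tt
Chain-stair c (suc n) p<c = p<c , Chain-stair (c ℤ.+ 1ℤ) n (i<i+1 c)

Increasing-stair : ∀ c n → Increasing (stair c n)
Increasing-stair c n = Chain⇒Increasing (stair c n) (Chain-stair {c ℤ.- 1ℤ} c n
  (subst (c ℤ.- 1ℤ ℤ.<_) (cancel c) (i<i+1 (c ℤ.- 1ℤ))))
  where
  cancel : ∀ c → c ℤ.- 1ℤ ℤ.+ 1ℤ ≡ c
  cancel = solve-∀

Chain-length : ∀ p q (x : Config n) → Chain p x → p ℤ.≤ q → (∀ i → lookup x i ℤ.≤ q) → p ℤ.+ + n ℤ.≤ q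
Chain-length p q []      _           p≤q _   = subst (ℤ._≤ q) (sym (ℤₚ.+-identityʳ p)) p≤q
Chain-length {suc n} p q (x ∷ v) (p<x , x<v) p≤q x≤q = ℤₚ.≤-trans
  (subst (ℤ._≤ x ℤ.+ + n) (ℤₚ.+-assoc p 1ℤ (+ n)) (ℤₚ.+-monoˡ-≤ (+ n) (i<j⇒i+1≤j p<x)))
  (Chain-length x q v x<v (x≤q zero) (x≤q ∘ suc))

-- There are only n places for n particles: if the first one were above `p + 1`, the others would
-- not fit below the upper bound, by `Chain-length`.
Chain-rigid : ∀ p (x : Config n) → Chain p x → (∀ i → lookup x i ℤ.≤ p ℤ.+ + n) → x ≡ stair (p ℤ.+ 1ℤ) n
Chain-rigid p []      _ _ = refl
Chain-rigid {suc n} p (x ∷ v) (p<x , x<v) x≤ = cong₂ _∷_ x≡p+1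
  (trans (Chain-rigid x v x<v (λ i → ℤₚ.≤-trans (x≤ (suc i)) (ℤₚ.≤-reflexive
           (trans (sym (ℤₚ.+-assoc p 1ℤ (+ n))) (cong (ℤ._+ + n) (sym x≡p+1))))))
         (cong (λ c → stair (c ℤ.+ 1ℤ) n) x≡p+1))
  where
  x≡p+1 : x ≡ p ℤ.+ 1ℤ
  x≡p+1 = ℤₚ.≤-antisym
    (subst₂ ℤ._≤_ (cancel x (+ n)) (cancel′ p (+ n))
      (ℤₚ.+-monoˡ-≤ (ℤ.- (+ n)) (Chain-length x (p ℤ.+ + suc n) v x<v (x≤ zero) (x≤ ∘ suc))))
    (i<j⇒i+1≤j p<x)
    where
    cancel : ∀ x n → x ℤ.+ n ℤ.- n ≡ x
    cancel = solve-∀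
    cancel′ : ∀ p n → p ℤ.+ (1ℤ ℤ.+ n) ℤ.- n ≡ p ℤ.+ 1ℤ
    cancel′ = solve-∀

wt-stair-stay : ∀ a k c n → wt a k (stair c n) (stair c n) ≡ pochhammer (c ℤ.+ k) n
wt-stair-stay a k c zero    = refl
wt-stair-stay a k c (suc n) = trans
  (cong₂ ℤ._*_ (ω-stay a k c refl)
    (trans (wt-stair-stay a k (c ℤ.+ 1ℤ) n) (cong (λ i → pochhammer i n) (regroup c k))))
  (sym (pochhammer-suc (c ℤ.+ k) n))
  where
  regroup : ∀ c k → c ℤ.+ 1ℤ ℤ.+ k ≡ c ℤ.+ k ℤ.+ 1ℤ
  regroup = solve-∀

-- The jump weights a - c, a - c - 1, ... decrease along the stair, so the first particle
-- contributes the last factor of the Pochhammer product and the last particle its base.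
wt-stair-jump : ∀ a k c n →
  wt a k (stair c n) (stair (c ℤ.+ 1ℤ) n) ≡ pochhammer (a ℤ.- c ℤ.- + n ℤ.+ 1ℤ) n
wt-stair-jump a k c zero    = refl
wt-stair-jump a k c (suc n) = trans
  (cong₂ ℤ._*_ (ω-jump a k c refl) (wt-stair-jump a k (c ℤ.+ 1ℤ) n))
  (trans (ℤₚ.*-comm (a ℤ.- c) _)
    (cong₂ ℤ._*_ (cong (λ i → pochhammer i n) (regroup a c (+ n))) (regroup′ a c (+ n))))
  where
  regroup : ∀ a c n → a ℤ.- (c ℤ.+ 1ℤ) ℤ.- n ℤ.+ 1ℤ ≡ a ℤ.- c ℤ.- (1ℤ ℤ.+ n) ℤ.+ 1ℤ
  regroup = solve-∀
  regroup′ : ∀ a c n → a ℤ.- c ≡ a ℤ.- c ℤ.- (1ℤ ℤ.+ n) ℤ.+ 1ℤ ℤ.+ n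
  regroup′ = solve-∀

vandermonde-stair : ∀ c n → (∏[i<j] stair (c ℤ.+ 1ℤ) n) ≡ (∏[i<j] stair c n)
vandermonde-stair c n = ∏ℤ-cong (allFin n) λ {i} _ →
  ∏ℤ-cong (filter (i Finₚ.<?_) (allFin n)) λ {j} _ → trans
    (cong₂ ℤ._-_ (lookup-stair (c ℤ.+ 1ℤ) j) (lookup-stair (c ℤ.+ 1ℤ) i))
    (trans (shift c (+ toℕ j) (+ toℕ i))
      (sym (cong₂ ℤ._-_ (lookup-stair c j) (lookup-stair c i))))
  where
  shift : ∀ c j i → (c ℤ.+ 1ℤ ℤ.+ j) ℤ.- (c ℤ.+ 1ℤ ℤ.+ i) ≡ (c ℤ.+ j) ℤ.- (c ℤ.+ i)
  shift = solve-∀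

transition-unit : ∀ a k {d} (x y : Config n) → 0ℤ ℤ.< d → Increasing x → (∏[i<j] y) ≡ (∏[i<j] x) →
  wt a k x y ≡ d → transition a k d x y ≡ 1ℚ
transition-unit a k {d} x y 0<d incx eV ew = begin
  fromℤ (∏[i<j] y) ℚ.* fromℤ (wt a k x y) ℚ.* (inv₀ D ℚ.* inv₀ V)
    ≡⟨ cong₂ (λ v w → fromℤ v ℚ.* fromℤ w ℚ.* (inv₀ D ℚ.* inv₀ V)) eV ew ⟩
  V ℚ.* D ℚ.* (inv₀ D ℚ.* inv₀ V)
    ≡⟨ regroup V D (inv₀ V) (inv₀ D) ⟩
  (V ℚ.* inv₀ V) ℚ.* (D ℚ.* inv₀ D)
    ≡⟨ cong₂ ℚ._*_ (inv₀-inverse (vandermonde-nonzero x incx)) (inv₀-inverse (fromℤ-pos-nonzero 0<d)) ⟩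
  1ℚ ∎
  where
  open ≡-Reasoning
  D = fromℤ d
  V = fromℤ (∏[i<j] x)
  regroup : ∀ v d iv id → v ℚ.* d ℚ.* (id ℚ.* iv) ≡ (v ℚ.* iv) ℚ.* (d ℚ.* id)
  regroup = RingSolver.solve-∀ ℚ-ring

∑-singleton : ∀ {L : List A} {c} → Unique L → c ∈ L → (∀ {x} → x ∈ L → x ≡ c) → (∑[ x ∈ L ] 1ℚ) ≡ 1ℚ
∑-singleton {L = L} {c} L! c∈ h = ∑-support {ys = c ∷ []} (λ _ → 1ℚ) L! ([] ∷ [])
  (λ _ → mk⇔ (λ x∈ → here (h x∈)) (λ { (here refl) → c∈ }))

-- The potential along a path

fact : ℤ → ℤ
fact i = + (ℤ.∣ i ∣ !)

fact-pos : ∀ i → 0ℤ ℤ.< fact i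
fact-pos i = ℤ.+<+ (ℕₚ.1≤n! ℤ.∣ i ∣)

fact-suc : ∀ i → 0ℤ ℤ.≤ i → (i ℤ.+ 1ℤ) ℤ.* fact i ≡ fact (i ℤ.+ 1ℤ)
fact-suc (+ n) _ rewrite ℕₚ.+-comm n 1 = sym (ℤₚ.pos-* (suc n) (n !))

-- Designed so that a step, which lowers k by one, divides out exactly its weight: a jump lowers a -
-- x by one and keeps x + k, staying does the reverse. The absolute value in `fact` only makes it
-- total; on the domain both arguments are nonnegative.
Φ : (a k : ℤ) → Config n → ℤ
Φ a k []      = 1ℤ
Φ a k (x ∷ v) = fact (a ℤ.- x) ℤ.* fact (x ℤ.+ k) ℤ.* Φ a k v

Φ-pos : ∀ a k (x : Config n) → 0ℤ ℤ.< Φ a k x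
Φ-pos a k []      = ℤ.+<+ (s≤s z≤n)
Φ-pos a k (x ∷ v) = ℤ-*-pos (ℤ-*-pos (fact-pos (a ℤ.- x)) (fact-pos (x ℤ.+ k))) (Φ-pos a k v)

ω-fact : ∀ {a b b′ k x y} → InDom a b k x → InDom a b′ (k ℤ.- 1ℤ) y → y ≡ x ℤ.+ 1ℤ ⊎ y ≡ x →
  ω a k x y ℤ.* (fact (a ℤ.- y) ℤ.* fact (y ℤ.+ (k ℤ.- 1ℤ))) ≡ fact (a ℤ.- x) ℤ.* fact (x ℤ.+ k)
ω-fact {a} {b} {b′} {k} {x} dx dy (inj₁ refl) = begin
  ω a k x (x ℤ.+ 1ℤ) ℤ.* (fact (a ℤ.- (x ℤ.+ 1ℤ)) ℤ.* fact (x ℤ.+ 1ℤ ℤ.+ (k ℤ.- 1ℤ)))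
    ≡⟨ cong₂ (λ w i → w ℤ.* (fact (a ℤ.- (x ℤ.+ 1ℤ)) ℤ.* fact i)) (trans (ω-jump a k x refl) (e a x)) (e′ x k) ⟩
  (a ℤ.- (x ℤ.+ 1ℤ) ℤ.+ 1ℤ) ℤ.* (fact (a ℤ.- (x ℤ.+ 1ℤ)) ℤ.* fact (x ℤ.+ k))
    ≡⟨ ℤₚ.*-assoc (a ℤ.- (x ℤ.+ 1ℤ) ℤ.+ 1ℤ) _ _ ⟨
  (a ℤ.- (x ℤ.+ 1ℤ) ℤ.+ 1ℤ) ℤ.* fact (a ℤ.- (x ℤ.+ 1ℤ)) ℤ.* fact (x ℤ.+ k)
    ≡⟨ cong (ℤ._* fact (x ℤ.+ k)) (trans (fact-suc (a ℤ.- (x ℤ.+ 1ℤ)) (ℤₚ.i≤j⇒0≤j-i (x≤a dy))) (cong fact (sym (e a x)))) ⟩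
  fact (a ℤ.- x) ℤ.* fact (x ℤ.+ k) ∎
  where
  open ≡-Reasoning
  e : ∀ a x → a ℤ.- x ≡ a ℤ.- (x ℤ.+ 1ℤ) ℤ.+ 1ℤ
  e = solve-∀
  e′ : ∀ x k → x ℤ.+ 1ℤ ℤ.+ (k ℤ.- 1ℤ) ≡ x ℤ.+ k
  e′ = solve-∀
ω-fact {a} {b} {b′} {k} {x} dx dy (inj₂ refl) = begin
  ω a k x x ℤ.* (fact (a ℤ.- x) ℤ.* fact (x ℤ.+ (k ℤ.- 1ℤ)))
    ≡⟨ cong (ℤ._* (fact (a ℤ.- x) ℤ.* fact (x ℤ.+ (k ℤ.- 1ℤ)))) (trans (ω-stay a k x refl) (e x k)) ⟩
  (x ℤ.+ (k ℤ.- 1ℤ) ℤ.+ 1ℤ) ℤ.* (fact (a ℤ.- x) ℤ.* fact (x ℤ.+ (k ℤ.- 1ℤ)))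
    ≡⟨ regroup (x ℤ.+ (k ℤ.- 1ℤ) ℤ.+ 1ℤ) (fact (a ℤ.- x)) (fact (x ℤ.+ (k ℤ.- 1ℤ))) ⟩
  fact (a ℤ.- x) ℤ.* ((x ℤ.+ (k ℤ.- 1ℤ) ℤ.+ 1ℤ) ℤ.* fact (x ℤ.+ (k ℤ.- 1ℤ)))
    ≡⟨ cong (fact (a ℤ.- x) ℤ.*_) (trans (fact-suc (x ℤ.+ (k ℤ.- 1ℤ)) (0≤x+k dy)) (cong fact (sym (e x k)))) ⟩
  fact (a ℤ.- x) ℤ.* fact (x ℤ.+ k) ∎
  where
  open ≡-Reasoning
  e : ∀ x k → x ℤ.+ k ≡ x ℤ.+ (k ℤ.- 1ℤ) ℤ.+ 1ℤ
  e = solve-∀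
  regroup : ∀ u v w → u ℤ.* (v ℤ.* w) ≡ v ℤ.* (u ℤ.* w)
  regroup = solve-∀

wt-Φ : ∀ {a b b′ k} (x y : Config n) → (∀ i → InDom a b k (lookup x i)) → (∀ i → InDom a b′ (k ℤ.- 1ℤ) (lookup y i)) →
  (∀ i → lookup y i ≡ lookup x i ℤ.+ 1ℤ ⊎ lookup y i ≡ lookup x i) → wt a k x y ℤ.* Φ a (k ℤ.- 1ℤ) y ≡ Φ a k x
wt-Φ []      []      _  _  _ = refl
wt-Φ {a = a} {k = k} (x ∷ v) (y ∷ s) dx dy h = trans
  (regroup (ω a k x y) (wt a k v s) (fact (a ℤ.- y) ℤ.* fact (y ℤ.+ (k ℤ.- 1ℤ))) (Φ a (k ℤ.- 1ℤ) s))
  (cong₂ ℤ._*_ (ω-fact (dx zero) (dy zero) (h zero)) (wt-Φ v s (dx ∘ suc) (dy ∘ suc) (h ∘ suc)))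
  where
  regroup : ∀ u v w z → (u ℤ.* v) ℤ.* (w ℤ.* z) ≡ (u ℤ.* w) ℤ.* (v ℤ.* z)
  regroup = solve-∀

potential : (a k : ℤ) → Config n → ℚ
potential a k x = fromℤ (∏[i<j] x) ℚ.* inv₀ (fromℤ (Φ a k x))

potential-nonzero : ∀ a k (x : Config n) → Increasing x → potential a k x ≢ 0ℚ
potential-nonzero a k x inc = *-nonzero (vandermonde-nonzero x inc) (inv₀-nonzero (fromℤ-pos-nonzero (Φ-pos a k x)))

transition-potential : ∀ {a b b′ k} d {x y : Config n} →
  Admissible a b k x → Admissible a b′ (k ℤ.- 1ℤ) y → Step x y →
  potential a k x ℚ.* transition a k d x y ≡ potential a (k ℤ.- 1ℤ) y ℚ.* inv₀ (fromℤ d)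
transition-potential {a = a} {k = k} d {x} {y} (admissible dx incx) (admissible dy incy) st = begin
  potential a k x ℚ.* transition a k d x y
    ≡⟨ regroup Vx iVx Vy W id F iF ⟩
  (Vx ℚ.* iVx) ℚ.* (Vy ℚ.* (W ℚ.* iF) ℚ.* id)
    ≡⟨ cong₂ (λ u w → u ℚ.* (Vy ℚ.* w ℚ.* id)) (inv₀-inverse (vandermonde-nonzero x incx)) W*iF ⟩
  1ℚ ℚ.* (Vy ℚ.* iG ℚ.* id)
    ≡⟨ ℚₚ.*-identityˡ (Vy ℚ.* iG ℚ.* id) ⟩
  potential a (k ℤ.- 1ℤ) y ℚ.* id ∎
  where
  open ≡-Reasoning
  Vx = fromℤ (∏[i<j] x)
  iVx = inv₀ Vx
  Vy = fromℤ (∏[i<j] y)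
  W = fromℤ (wt a k x y)
  id = inv₀ (fromℤ d)
  F = fromℤ (Φ a k x)
  iF = inv₀ F
  G = fromℤ (Φ a (k ℤ.- 1ℤ) y)
  iG = inv₀ G
  F≢0 = fromℤ-pos-nonzero (Φ-pos a k x)
  G≢0 = fromℤ-pos-nonzero (Φ-pos a (k ℤ.- 1ℤ) y)
  regroup : ∀ Vx iVx Vy W id F iF → Vx ℚ.* iF ℚ.* (Vy ℚ.* W ℚ.* (id ℚ.* iVx)) ≡ (Vx ℚ.* iVx) ℚ.* (Vy ℚ.* (W ℚ.* iF) ℚ.* id)
  regroup = RingSolver.solve-∀ ℚ-ring
  W*G : W ℚ.* G ≡ F
  W*G = trans (sym (fromℤ-* (wt a k x y) (Φ a (k ℤ.- 1ℤ) y))) (cong fromℤ (wt-Φ x y dx dy (Step⇒jump⊎stay x y st)))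
  swap : ∀ w i g → (w ℚ.* i) ℚ.* g ≡ (w ℚ.* g) ℚ.* i
  swap = RingSolver.solve-∀ ℚ-ring
  W*iF : W ℚ.* iF ≡ iG
  W*iF = *-cancelʳ G G≢0 (begin
    (W ℚ.* iF) ℚ.* G   ≡⟨ swap W iF G ⟩
    (W ℚ.* G) ℚ.* iF   ≡⟨ cong (ℚ._* iF) W*G ⟩
    F ℚ.* iF           ≡⟨ inv₀-inverse F≢0 ⟩
    1ℚ                 ≡⟨ inv₀-inverse G≢0 ⟨
    G ℚ.* iG           ≡⟨ ℚₚ.*-comm G iG ⟩
    iG ℚ.* G           ∎)

-- The ratios of consecutive values of f are kept in cross-multiplied form, so that no division by f
-- occurs.
∏-telescope : ∀ n (f : Fin (suc n) → ℚ) (P I : Fin n → ℚ) →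
  (∀ t → f (inject₁ t) ℚ.* P t ≡ f (suc t) ℚ.* I t) →
  f zero ℚ.* ∏ (allFin n) P ≡ f (fromℕ n) ℚ.* ∏ (allFin n) I
∏-telescope zero    f P I h = refl
∏-telescope (suc n) f P I h = begin
  f zero ℚ.* ∏ (allFin (suc n)) P
    ≡⟨ cong (f zero ℚ.*_) (∏-allFin-suc P) ⟩
  f zero ℚ.* (P zero ℚ.* ∏P)
    ≡⟨ ℚₚ.*-assoc (f zero) (P zero) ∏P ⟨
  f zero ℚ.* P zero ℚ.* ∏P
    ≡⟨ cong (ℚ._* ∏P) (h zero) ⟩
  f (suc zero) ℚ.* I zero ℚ.* ∏P
    ≡⟨ regroup (f (suc zero)) (I zero) ∏P ⟩
  I zero ℚ.* (f (suc zero) ℚ.* ∏P)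
    ≡⟨ cong (I zero ℚ.*_) (∏-telescope n (f ∘ suc) (P ∘ suc) (I ∘ suc) (h ∘ suc)) ⟩
  I zero ℚ.* (f (fromℕ (suc n)) ℚ.* ∏I)
    ≡⟨ regroup′ (f (fromℕ (suc n))) (I zero) ∏I ⟩
  f (fromℕ (suc n)) ℚ.* (I zero ℚ.* ∏I)
    ≡⟨ cong (f (fromℕ (suc n)) ℚ.*_) (∏-allFin-suc I) ⟨
  f (fromℕ (suc n)) ℚ.* ∏ (allFin (suc n)) I ∎
  where
  open ≡-Reasoning
  ∏P = ∏ (allFin n) (P ∘ suc)
  ∏I = ∏ (allFin n) (I ∘ suc)
  regroup : ∀ a b c → a ℚ.* b ℚ.* c ≡ b ℚ.* (a ℚ.* c)
  regroup = RingSolver.solve-∀ ℚ-ring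
  regroup′ : ∀ a b c → b ℚ.* (a ℚ.* c) ≡ a ℚ.* (b ℚ.* c)
  regroup′ = RingSolver.solve-∀ ℚ-ring

-- The matrices at actual times and levels

module Levels (N T : ℕ) where

  -- `top S` and `top t` are the upper ends of the domain imposed by the level and by the time, the
  -- parameters a and b above; `gap S t` is the parameter k.
  top : ℕ → ℤ
  top s = + N ℤ.+ + s ℤ.- 1ℤ

  gap : ℕ → ℕ → ℤ
  gap S t = + T ℤ.- + t ℤ.- + S

  top-suc : ∀ s → top (suc s) ≡ top s ℤ.+ 1ℤ
  top-suc s = shift (+ N) (+ s)
    where
    shift : ∀ n s → n ℤ.+ (1ℤ ℤ.+ s) ℤ.- 1ℤ ≡ n ℤ.+ s ℤ.- 1ℤ ℤ.+ 1ℤ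
    shift = solve-∀

  gap-suc-time : ∀ S t → gap S (suc t) ≡ gap S t ℤ.- 1ℤ
  gap-suc-time S t = shift (+ T) (+ t) (+ S)
    where
    shift : ∀ T t S → T ℤ.- (1ℤ ℤ.+ t) ℤ.- S ≡ T ℤ.- t ℤ.- S ℤ.- 1ℤ
    shift = solve-∀

  gap-suc-level : ∀ S t → gap (suc S) t ≡ gap S t ℤ.- 1ℤ
  gap-suc-level S t = shift (+ T) (+ t) (+ S)
    where
    shift : ∀ T t S → T ℤ.- t ℤ.- (1ℤ ℤ.+ S) ≡ T ℤ.- t ℤ.- S ℤ.- 1ℤ
    shift = solve-∀

  remaining : ℕ → ℤ
  remaining t = pochhammer (+ T ℤ.- + t) N

  remaining-pos : ∀ {t} → t ℕ.< T → 0ℤ ℤ.< remaining t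
  remaining-pos t<T = pochhammer-pos N (i<j⇒0<j-i (ℤ.+<+ t<T))

  private
    comm : ∀ s n → s ℤ.+ n ℤ.- 1ℤ ≡ n ℤ.+ s ℤ.- 1ℤ
    comm = solve-∀

  𝔛⇒InDom : ∀ {S t x} → 𝔛 N T S t x → InDom (top S) (top t) (gap S t) x
  𝔛⇒InDom {S} {t} {x} (l , u) = inDom
    (ℤₚ.≤-trans (ℤₚ.i≤i⊔j 0ℤ _) l)
    (subst (0ℤ ℤ.≤_) (shift x (+ t) (+ S) (+ T)) (ℤₚ.i≤j⇒0≤j-i (ℤₚ.≤-trans (ℤₚ.i≤j⊔i 0ℤ _) l)))
    (ℤₚ.≤-trans u (ℤₚ.≤-trans (ℤₚ.i⊓j≤j _ _) (ℤₚ.≤-reflexive (comm (+ S) (+ N)))))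
    (ℤₚ.≤-trans u (ℤₚ.≤-trans (ℤₚ.i⊓j≤i _ _) (ℤₚ.≤-reflexive (comm (+ t) (+ N)))))
    where
    shift : ∀ x t S T → x ℤ.- (t ℤ.+ S ℤ.- T) ≡ x ℤ.+ (T ℤ.- t ℤ.- S)
    shift = solve-∀

  InDom⇒𝔛 : ∀ {S t x} → InDom (top S) (top t) (gap S t) x → 𝔛 N T S t x
  InDom⇒𝔛 {S} {t} {x} (inDom l m r s) =
      ℤₚ.⊔-lub l (ℤₚ.0≤i-j⇒j≤i (subst (0ℤ ℤ.≤_) (shift x (+ t) (+ S) (+ T)) m))
    , ℤₚ.⊓-glb (ℤₚ.≤-trans s (ℤₚ.≤-reflexive (comm (+ N) (+ t))))
               (ℤₚ.≤-trans r (ℤₚ.≤-reflexive (comm (+ N) (+ S))))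
    where
    shift : ∀ x t S T → x ℤ.+ (T ℤ.- t ℤ.- S) ≡ x ℤ.- (t ℤ.+ S ℤ.- T)
    shift = solve-∀

  ∈-𝒳s⇔Admissible : ∀ S t x → x ∈ 𝒳s N T S t ⇔ Admissible (top S) (top t) (gap S t) x
  ∈-𝒳s⇔Admissible S t x = mk⇔
    (λ x∈ → let d , inc = Equivalence.to (∈-𝒳s N T S t x) x∈ in admissible (𝔛⇒InDom {S} {t} ∘ d) inc)
    (λ { (admissible d inc) → Equivalence.from (∈-𝒳s N T S t x) (InDom⇒𝔛 {S} {t} ∘ d , inc) })

  ∈⇒Admissible : ∀ S t {x} → x ∈ 𝒳s N T S t → Admissible (top S) (top t) (gap S t) x
  ∈⇒Admissible S t {x} = Equivalence.to (∈-𝒳s⇔Admissible S t x)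

  ∈⇒Increasing : ∀ S t {x} → x ∈ 𝒳s N T S t → Increasing x
  ∈⇒Increasing S t x∈ = increasing (∈⇒Admissible S t x∈)

  private
    jump : ∀ n s x → n ℤ.+ s ℤ.- x ℤ.- 1ℤ ≡ n ℤ.+ s ℤ.- 1ℤ ℤ.- x
    jump = solve-∀
    stay : ∀ x T t S → x ℤ.+ T ℤ.- t ℤ.- S ≡ x ℤ.+ (T ℤ.- t ℤ.- S)
    stay = solve-∀

  Pt+-transition : ∀ S t x y → Pt+ N T S t x y ≡ transition (top S) (gap S t) (remaining t) x y
  Pt+-transition S t x y = matrix-transition (top S) (gap S t) x y (remaining t)
    (λ i → jump (+ N) (+ S) (lookup x i)) (λ i → stay (lookup x i) (+ T) (+ t) (+ S))

  PS+-transition : ∀ S t x y → PS+ N T S t x y ≡ transition (top t) (gap S t) (remaining S) x y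
  PS+-transition S t x y = matrix-transition (top t) (gap S t) x y (remaining S)
    (λ i → jump (+ N) (+ t) (lookup x i)) (λ i → stay (lookup x i) (+ T) (+ t) (+ S))

  Pt+-nonneg : ∀ S t {x y} → t ℕ.< T → x ∈ 𝒳s N T S t → Increasing y → 0ℚ ℚ.≤ Pt+ N T S t x y
  Pt+-nonneg S t {x} {y} t<T x∈ inc = subst (0ℚ ℚ.≤_) (sym (Pt+-transition S t x y))
    (transition-nonneg y (remaining-pos t<T) (∈⇒Admissible S t x∈) inc)

  PS+-nonneg : ∀ S t {x y} → S ℕ.< T → x ∈ 𝒳s N T S t → Increasing y → 0ℚ ℚ.≤ PS+ N T S t x y
  PS+-nonneg S t {x} {y} S<T x∈ inc = subst (0ℚ ℚ.≤_) (sym (PS+-transition S t x y))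
    (transition-nonneg y (remaining-pos S<T) (Admissible-swap (∈⇒Admissible S t x∈)) inc)

  Pt+-nonzero⇒Step : ∀ S t x y → Pt+ N T S t x y ≢ 0ℚ → Step x y
  Pt+-nonzero⇒Step S t x y h = transition-nonzero⇒Step (top S) (gap S t) x y (remaining t)
    (λ e → h (trans (Pt+-transition S t x y) e))

  Pt+-PS+-commute : ∀ S t {x z} → x ∈ 𝒳s N T S t → z ∈ 𝒳s N T (suc S) (suc t) →
    (∑[ y ∈ 𝒳s N T S (suc t) ] (Pt+ N T S t x y ℚ.* PS+ N T S (suc t) y z)) ≡
    (∑[ y ∈ 𝒳s N T (suc S) t ] (PS+ N T S t x y ℚ.* Pt+ N T (suc S) t y z))
  Pt+-PS+-commute S t {x} {z} x∈ z∈ = begin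
    (∑[ y ∈ 𝒳s N T S (suc t) ] (Pt+ N T S t x y ℚ.* PS+ N T S (suc t) y z))
      ≡⟨ ∑-cong (𝒳s N T S (suc t)) (λ {y} _ → cong₂ ℚ._*_ (Pt+-transition S t x y)
           (trans (PS+-transition S (suc t) y z)
             (cong₂ (λ a k → transition a k (remaining S) y z) (top-suc t) (gap-suc-time S t)))) ⟩
    (∑[ y ∈ 𝒳s N T S (suc t) ] (transition a k (remaining t) x y ℚ.* transition (b ℤ.+ 1ℤ) (k ℤ.- 1ℤ) (remaining S) y z))
      ≡⟨ transitions-commute (remaining t) (remaining S) (𝒳s-unique N T S (suc t)) (𝒳s-unique N T (suc S) t)
           (λ y → subst₂ (λ b k → y ∈ 𝒳s N T S (suc t) ⇔ Admissible a b k y) (top-suc t) (gap-suc-time S t)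
             (∈-𝒳s⇔Admissible S (suc t) y))
           (λ y → subst₂ (λ a k → y ∈ 𝒳s N T (suc S) t ⇔ Admissible a b k y) (top-suc S) (gap-suc-level S t)
             (∈-𝒳s⇔Admissible (suc S) t y))
           (∈⇒Admissible S t x∈) (Admissible⇒Chain (∈⇒Admissible (suc S) (suc t) z∈)) ⟩
    (∑[ y ∈ 𝒳s N T (suc S) t ] (transition b k (remaining S) x y ℚ.* transition (a ℤ.+ 1ℤ) (k ℤ.- 1ℤ) (remaining t) y z))
      ≡⟨ ∑-cong (𝒳s N T (suc S) t) (λ {y} _ → cong₂ ℚ._*_ (PS+-transition S t x y)
           (trans (Pt+-transition (suc S) t y z)
             (cong₂ (λ a k → transition a k (remaining t) y z) (top-suc S) (gap-suc-level S t)))) ⟨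
    (∑[ y ∈ 𝒳s N T (suc S) t ] (PS+ N T S t x y ℚ.* Pt+ N T (suc S) t y z)) ∎
    where
    open ≡-Reasoning
    a = top S
    b = top t
    k = gap S t

  -- At time 0 the domain has only the N sites 0, ..., N - 1; at time T, in `end-stair`, only S,
  -- ..., S + N - 1. Either way the N particles fill it.
  start-stair : ∀ S {x} → x ∈ 𝒳s N T S 0 → x ≡ stair 0ℤ N
  start-stair S {x} x∈ = Chain-rigid (ℤ.- 1ℤ) x (Admissible⇒Chain ad)
    (λ i → ℤₚ.≤-trans (x≤b (domain ad i)) (ℤₚ.≤-reflexive (shift (+ N))))
    where
    ad = ∈⇒Admissible S 0 x∈
    shift : ∀ n → n ℤ.+ 0ℤ ℤ.- 1ℤ ≡ ℤ.- 1ℤ ℤ.+ n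
    shift = solve-∀

  end-stair : ∀ S {x} → x ∈ 𝒳s N T S T → x ≡ stair (+ S) N
  end-stair S {x} x∈ = trans
    (Chain-rigid (+ S ℤ.- 1ℤ) x
      (Increasing⇒Chain x (λ i → ℤₚ.<-≤-trans S-1<S (S≤ i)) (increasing ad))
      (λ i → ℤₚ.≤-trans (x≤a (domain ad i)) (ℤₚ.≤-reflexive (shift (+ N) (+ S)))))
    (cong (λ c → stair c N) (cancel (+ S)))
    where
    ad = ∈⇒Admissible S T x∈
    cancel : ∀ s → s ℤ.- 1ℤ ℤ.+ 1ℤ ≡ s
    cancel = solve-∀
    shift : ∀ n s → n ℤ.+ s ℤ.- 1ℤ ≡ s ℤ.- 1ℤ ℤ.+ n
    shift = solve-∀
    shift′ : ∀ x t s → x ℤ.+ (t ℤ.- t ℤ.- s) ≡ x ℤ.- s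
    shift′ = solve-∀
    S-1<S : + S ℤ.- 1ℤ ℤ.< + S
    S-1<S = subst (+ S ℤ.- 1ℤ ℤ.<_) (cancel (+ S)) (i<i+1 (+ S ℤ.- 1ℤ))
    S≤ : ∀ i → + S ℤ.≤ lookup x i
    S≤ i = ℤₚ.0≤i-j⇒j≤i (subst (0ℤ ℤ.≤_) (shift′ (lookup x i) (+ T) (+ S)) (0≤x+k (domain ad i)))

  stair-∈ : ∀ S t c → 0ℤ ℤ.≤ c → 0ℤ ℤ.≤ c ℤ.+ gap S t → c ℤ.≤ + S → c ℤ.≤ + t → stair c N ∈ 𝒳s N T S t
  stair-∈ S t c 0≤c 0≤c+k c≤S c≤t = Equivalence.from (∈-𝒳s⇔Admissible S t (stair c N))
    (admissible (λ i → subst (InDom (top S) (top t) (gap S t)) (sym (lookup-stair c i)) (position i)) (Increasing-stair c N))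
    where
    swap : ∀ c i k → c ℤ.+ k ℤ.+ i ≡ c ℤ.+ i ℤ.+ k
    swap = solve-∀
    below : ∀ n i s c → (n ℤ.- 1ℤ ℤ.- i) ℤ.+ (s ℤ.- c) ≡ n ℤ.+ s ℤ.- 1ℤ ℤ.- (c ℤ.+ i)
    below = solve-∀
    position : ∀ (i : Fin N) → InDom (top S) (top t) (gap S t) (c ℤ.+ + toℕ i)
    position i = inDom
      (0≤i+j 0≤c (0≤+ (toℕ i)))
      (subst (0ℤ ℤ.≤_) (swap c (+ toℕ i) (gap S t)) (0≤i+j 0≤c+k (0≤+ (toℕ i))))
      (ℤₚ.0≤i-j⇒j≤i (subst (0ℤ ℤ.≤_) (below (+ N) (+ toℕ i) (+ S) c) (0≤i+j (0≤n-1-i i) (ℤₚ.i≤j⇒0≤j-i c≤S))))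
      (ℤₚ.0≤i-j⇒j≤i (subst (0ℤ ℤ.≤_) (below (+ N) (+ toℕ i) (+ t) c) (0≤i+j (0≤n-1-i i) (ℤₚ.i≤j⇒0≤j-i c≤t))))

  start-∈ : ∀ S → S ℕ.≤ T → stair 0ℤ N ∈ 𝒳s N T S 0
  start-∈ S S≤T = stair-∈ S 0 0ℤ ℤₚ.≤-refl (subst (0ℤ ℤ.≤_) (shift (+ T) (+ S)) (ℤₚ.i≤j⇒0≤j-i (ℤ.+≤+ S≤T))) (0≤+ S) ℤₚ.≤-refl
    where
    shift : ∀ t s → t ℤ.- s ≡ 0ℤ ℤ.+ (t ℤ.- 0ℤ ℤ.- s)
    shift = solve-∀

  end-∈ : ∀ S → S ℕ.≤ T → stair (+ S) N ∈ 𝒳s N T S T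
  end-∈ S S≤T = stair-∈ S T (+ S) (0≤+ S) (ℤₚ.≤-reflexive (cancel (+ T) (+ S))) ℤₚ.≤-refl (ℤ.+≤+ S≤T)
    where
    cancel : ∀ t s → 0ℤ ≡ s ℤ.+ (t ℤ.- t ℤ.- s)
    cancel = solve-∀

  -- All particles stay, with weights T - S, ..., T - S + N - 1, whose product is the normalising
  -- factor (T - S)_N.
  PS+-start : ∀ S {x y} → S ℕ.< T → x ∈ 𝒳s N T S 0 → y ∈ 𝒳s N T (suc S) 0 → PS+ N T S 0 x y ≡ 1ℚ
  PS+-start S {x} {y} S<T x∈ y∈ = begin
    PS+ N T S 0 x y                                            ≡⟨ PS+-transition S 0 x y ⟩
    transition (top 0) (gap S 0) (remaining S) x y             ≡⟨ cong₂ (transition (top 0) (gap S 0) (remaining S)) (start-stair S x∈) (start-stair (suc S) y∈) ⟩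
    transition (top 0) (gap S 0) (remaining S) s s             ≡⟨ transition-unit (top 0) (gap S 0) s s (remaining-pos S<T)
                                                                    (Increasing-stair 0ℤ N) refl
                                                                    (trans (wt-stair-stay (top 0) (gap S 0) 0ℤ N)
                                                                      (cong (λ i → pochhammer i N) (shift (+ T) (+ S)))) ⟩
    1ℚ                                                         ∎
    where
    open ≡-Reasoning
    s = stair 0ℤ N
    shift : ∀ t s → 0ℤ ℤ.+ (t ℤ.- 0ℤ ℤ.- s) ≡ t ℤ.- s
    shift = solve-∀

  -- All particles jump, and their weights N + T - 1 - S - i run through the factors of (T - S)_N
  -- downwards; the Vandermonde factor is invariant under the shift.
  PS+-end : ∀ S {x y} → S ℕ.< T → x ∈ 𝒳s N T S T → y ∈ 𝒳s N T (suc S) T → PS+ N T S T x y ≡ 1ℚ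
  PS+-end S {x} {y} S<T x∈ y∈ = begin
    PS+ N T S T x y                                            ≡⟨ PS+-transition S T x y ⟩
    transition (top T) (gap S T) (remaining S) x y             ≡⟨ cong₂ (transition (top T) (gap S T) (remaining S)) (end-stair S x∈)
                                                                    (trans (end-stair (suc S) y∈) (cong (λ c → stair c N) (ℤₚ.+-comm 1ℤ (+ S)))) ⟩
    transition (top T) (gap S T) (remaining S) s s′            ≡⟨ transition-unit (top T) (gap S T) s s′ (remaining-pos S<T)
                                                                    (Increasing-stair (+ S) N) (vandermonde-stair (+ S) N)
                                                                    (trans (wt-stair-jump (top T) (gap S T) (+ S) N)
                                                                      (cong (λ i → pochhammer i N) (shift (+ N) (+ T) (+ S)))) ⟩
    1ℚ                                                         ∎
    where
    open ≡-Reasoning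
    s = stair (+ S) N
    s′ = stair (+ S ℤ.+ 1ℤ) N
    shift : ∀ n t s → n ℤ.+ t ℤ.- 1ℤ ℤ.- s ℤ.- n ℤ.+ 1ℤ ≡ t ℤ.- s
    shift = solve-∀

  -- Along a path both the position τ and the lag σ = t - τ are nondecreasing. Comparing each with
  -- its values at times 0 and T gives the four bounds of the domain.
  Ω⇒∈ : ∀ S {X} → Ω N T S X → ∀ t → lookup X t ∈ 𝒳s N T S (toℕ t)
  Ω⇒∈ S {X} (start , end , steps , inc) t = Equivalence.from (∈-𝒳s⇔Admissible S (toℕ t) (lookup X t))
    (admissible position (inc t))
    where
    position : ∀ i → InDom (top S) (top (toℕ t)) (gap S (toℕ t)) (lookup (lookup X t) i)
    position i = inDom
      (ℤₚ.≤-trans (subst (0ℤ ℤ.≤_) (sym (start i)) (0≤+ (toℕ i))) (first≤ τ τ-mono t))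
      (subst (0ℤ ℤ.≤_) gap-identity (0≤i+j (ℤₚ.i≤j⇒0≤j-i (≤last σ σ-mono t)) (0≤+ (toℕ i))))
      (ℤₚ.0≤i-j⇒j≤i (subst (0ℤ ℤ.≤_) (above (+ N) (+ S) (+ toℕ i) (τ t))
        (0≤i+j (ℤₚ.i≤j⇒0≤j-i (ℤₚ.≤-trans (≤last τ τ-mono t) (ℤₚ.≤-reflexive (end i)))) (0≤n-1-i i))))
      (ℤₚ.0≤i-j⇒j≤i (subst (0ℤ ℤ.≤_) (above′ (+ N) (+ toℕ t) (+ toℕ i) (τ t))
        (0≤i+j (ℤₚ.i≤j⇒0≤j-i (subst (λ z → 0ℤ ℤ.- z ℤ.≤ σ t) (start i) (first≤ σ σ-mono t))) (0≤n-1-i i))))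
      where
      τ σ : Fin (suc T) → ℤ
      τ s = lookup (lookup X s) i
      σ s = + toℕ s ℤ.- τ s
      τ-mono : ∀ s → τ (inject₁ s) ℤ.≤ τ (suc s)
      τ-mono s = step-≤ (steps s i)
      σ-mono : ∀ s → σ (inject₁ s) ℤ.≤ σ (suc s)
      σ-mono s = ℤₚ.0≤i-j⇒j≤i (subst (0ℤ ℤ.≤_)
        (trans (regroup (+ toℕ s) (τ (suc s)) (τ (inject₁ s)))
               (cong (λ m → (1ℤ ℤ.+ + toℕ s) ℤ.- τ (suc s) ℤ.- (+ m ℤ.- τ (inject₁ s))) (sym (toℕ-inject₁ s))))
        (bound (steps s i)))
        where
        regroup : ∀ s y x → 1ℤ ℤ.- (y ℤ.- x) ≡ (1ℤ ℤ.+ s) ℤ.- y ℤ.- (s ℤ.- x)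
        regroup = solve-∀
        bound : ∀ {d} → (d ≡ 0ℤ) ⊎ (d ≡ 1ℤ) → 0ℤ ℤ.≤ 1ℤ ℤ.- d
        bound (inj₁ refl) = 0≤+ 1
        bound (inj₂ refl) = 0≤+ 0
      gap-identity : (σ (fromℕ T) ℤ.- σ t) ℤ.+ + toℕ i ≡ τ t ℤ.+ gap S (toℕ t)
      gap-identity = trans
        (cong₂ (λ m e → ((+ m ℤ.- e) ℤ.- σ t) ℤ.+ + toℕ i) (toℕ-fromℕ T) (end i))
        (regroup (+ T) (+ S) (+ toℕ i) (+ toℕ t) (τ t))
        where
        regroup : ∀ T S i t x → ((T ℤ.- (S ℤ.+ i)) ℤ.- (t ℤ.- x)) ℤ.+ i ≡ x ℤ.+ (T ℤ.- t ℤ.- S)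
        regroup = solve-∀
      above : ∀ n s i x → (s ℤ.+ i ℤ.- x) ℤ.+ (n ℤ.- 1ℤ ℤ.- i) ≡ n ℤ.+ s ℤ.- 1ℤ ℤ.- x
      above = solve-∀
      above′ : ∀ n t i x → (t ℤ.- x ℤ.- (0ℤ ℤ.- i)) ℤ.+ (n ℤ.- 1ℤ ℤ.- i) ≡ n ℤ.+ t ℤ.- 1ℤ ℤ.- x
      above′ = solve-∀

  ∈⇒Ω : ∀ S {X} → (∀ t → lookup X t ∈ 𝒳s N T S (toℕ t)) →
        (∀ (t : Fin T) → Step (lookup X (inject₁ t)) (lookup X (suc t))) → Ω N T S X
  ∈⇒Ω S {X} X∈ steps =
      (λ i → trans (cong (λ x → lookup x i) (start-stair S (X∈ zero))) (lookup-stair 0ℤ i))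
    , (λ i → trans (cong (λ x → lookup x i) (end-stair S (subst (λ t → lookup X (fromℕ T) ∈ 𝒳s N T S t) (toℕ-fromℕ T) (X∈ (fromℕ T)))))
                   (lookup-stair (+ S) i))
    , steps
    , (λ t → ∈⇒Increasing S (toℕ t) (X∈ t))

  Pt+-path : ∀ S → Family N T → ℚ
  Pt+-path S = pathWeight (λ t → Pt+ N T S (toℕ t))

  private
    U : ∀ S → Family N T → Fin (suc T) → ℚ
    U S X t = potential (top S) (gap S (toℕ t)) (lookup X t)

    U-step : ∀ S {X} → Ω N T S X → ∀ t →
      U S X (inject₁ t) ℚ.* Pt+ N T S (toℕ t) (lookup X (inject₁ t)) (lookup X (suc t)) ≡
      U S X (suc t) ℚ.* inv₀ (fromℤ (remaining (toℕ t)))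
    U-step S {X} ΩX@(_ , _ , steps , _) t = begin
      U S X (inject₁ t) ℚ.* Pt+ N T S (toℕ t) x y
        ≡⟨ cong₂ (λ m p → potential (top S) (gap S m) x ℚ.* p) (toℕ-inject₁ t) (Pt+-transition S (toℕ t) x y) ⟩
      potential (top S) (gap S (toℕ t)) x ℚ.* transition (top S) (gap S (toℕ t)) (remaining (toℕ t)) x y
        ≡⟨ transition-potential (remaining (toℕ t)) ad-x ad-y (steps t) ⟩
      potential (top S) (gap S (toℕ t) ℤ.- 1ℤ) y ℚ.* inv₀ (fromℤ (remaining (toℕ t)))
        ≡⟨ cong (λ k → potential (top S) k y ℚ.* inv₀ (fromℤ (remaining (toℕ t)))) (gap-suc-time S (toℕ t)) ⟨
      U S X (suc t) ℚ.* inv₀ (fromℤ (remaining (toℕ t))) ∎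
      where
      open ≡-Reasoning
      x = lookup X (inject₁ t)
      y = lookup X (suc t)
      ad-x : Admissible (top S) (top (toℕ t)) (gap S (toℕ t)) x
      ad-x = ∈⇒Admissible S (toℕ t) (∈-inject₁ (𝒳s N T S) X (Ω⇒∈ S {X} ΩX) t)
      ad-y : Admissible (top S) (top (suc (toℕ t))) (gap S (toℕ t) ℤ.- 1ℤ) y
      ad-y = subst (λ k → Admissible (top S) (top (suc (toℕ t))) k y) (gap-suc-time S (toℕ t))
        (∈⇒Admissible S (suc (toℕ t)) (Ω⇒∈ S {X} ΩX (suc t)))

    U-nonzero : ∀ S {X} → Ω N T S X → ∀ t → U S X t ≢ 0ℚ
    U-nonzero S {X} (_ , _ , _ , inc) t = potential-nonzero (top S) (gap S (toℕ t)) (lookup X t) (inc t)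

    U-boundary : ∀ S {X Y} → Ω N T S X → Ω N T S Y → U S X zero ≡ U S Y zero × U S X (fromℕ T) ≡ U S Y (fromℕ T)
    U-boundary S {X} {Y} ΩX ΩY =
        cong (potential (top S) (gap S 0)) (trans (start-stair S (Ω⇒∈ S {X} ΩX zero)) (sym (start-stair S (Ω⇒∈ S {Y} ΩY zero))))
      , cong (potential (top S) (gap S (toℕ (fromℕ T)))) (trans (end X ΩX) (sym (end Y ΩY)))
      where
      end : ∀ X → Ω N T S X → lookup X (fromℕ T) ≡ stair (+ S) N
      end X ΩX = end-stair S (subst (λ t → lookup X (fromℕ T) ∈ 𝒳s N T S t) (toℕ-fromℕ T) (Ω⇒∈ S {X} ΩX (fromℕ T)))

  -- Read off from `U-step`: its right side is a nonzero potential divided by a positive Pochhammer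
  -- product.
  Pt+-nonzero : ∀ S {X} → Ω N T S X → ∀ t → Pt+ N T S (toℕ t) (lookup X (inject₁ t)) (lookup X (suc t)) ≢ 0ℚ
  Pt+-nonzero S {X} ΩX t = *-nonzeroʳ {p = U S X (inject₁ t)} (λ e →
    *-nonzero (U-nonzero S {X} ΩX (suc t)) (inv₀-nonzero (fromℤ-pos-nonzero (remaining-pos (toℕ<n t))))
      (trans (sym (U-step S {X} ΩX t)) e))

  Pt+-path-nonzero : ∀ S {X} → Ω N T S X → Pt+-path S X ≢ 0ℚ
  Pt+-path-nonzero S {X} ΩX = ∏-nonzero (allFin T) (λ {t} _ → Pt+-nonzero S {X} ΩX t)

  Pt+-path-constant : ∀ S {X Y} → Ω N T S X → Ω N T S Y → Pt+-path S X ≡ Pt+-path S Y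
  Pt+-path-constant S {X} {Y} ΩX ΩY = *-cancelʳ (U S Y zero) (U-nonzero S {Y} ΩY zero) (begin
    Pt+-path S X ℚ.* U S Y zero        ≡⟨ cong (Pt+-path S X ℚ.*_) (proj₁ boundary) ⟨
    Pt+-path S X ℚ.* U S X zero        ≡⟨ ℚₚ.*-comm (Pt+-path S X) (U S X zero) ⟩
    U S X zero ℚ.* Pt+-path S X        ≡⟨ ∏-telescope T (U S X) _ I (U-step S {X} ΩX) ⟩
    U S X (fromℕ T) ℚ.* ∏ (allFin T) I ≡⟨ cong (ℚ._* ∏ (allFin T) I) (proj₂ boundary) ⟩
    U S Y (fromℕ T) ℚ.* ∏ (allFin T) I ≡⟨ ∏-telescope T (U S Y) _ I (U-step S {Y} ΩY) ⟨
    U S Y zero ℚ.* Pt+-path S Y        ≡⟨ ℚₚ.*-comm (U S Y zero) (Pt+-path S Y) ⟩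
    Pt+-path S Y ℚ.* U S Y zero        ∎)
    where
    open ≡-Reasoning
    boundary = U-boundary S {X} {Y} ΩX ΩY
    I : Fin T → ℚ
    I t = inv₀ (fromℤ (remaining (toℕ t)))

-- From level S + 1 to level S

module Backward (N T S : ℕ) (S<T : S ℕ.< T) where

  open Levels N T

  private
    L M : ℕ → List (Config N)
    L = 𝒳s N T S
    M = 𝒳s N T (suc S)

    p r : Fin T → Config N → Config N → ℚ
    p t = Pt+ N T S (toℕ t)
    r t = Pt+ N T (suc S) (toℕ t)

    q : Fin (suc T) → Config N → Config N → ℚ
    q t = PS+ N T S (toℕ t)

  open Intertwining T L M p r q
    (λ t {x} {y} {z} x∈ y∈ z∈ → *-nonneg
      (Pt+-nonneg S (toℕ t) {y = y} (toℕ<n t) x∈ (∈⇒Increasing S (suc (toℕ t)) y∈))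
      (PS+-nonneg S (suc (toℕ t)) {y = z} S<T y∈ (∈⇒Increasing (suc S) (suc (toℕ t)) z∈)))
    (λ t {x} {y} {z} x∈ y∈ z∈ → *-nonneg
      (subst (λ m → 0ℚ ℚ.≤ PS+ N T S m x y) (sym (toℕ-inject₁ t))
        (PS+-nonneg S (toℕ t) {y = y} S<T x∈ (∈⇒Increasing (suc S) (toℕ t) y∈)))
      (Pt+-nonneg (suc S) (toℕ t) {y = z} (toℕ<n t) y∈ (∈⇒Increasing (suc S) (suc (toℕ t)) z∈)))
    (λ t {x} {z} x∈ z∈ → subst
      (λ m → (∑[ y ∈ L (suc (toℕ t)) ] (p t x y ℚ.* q (suc t) y z)) ≡
             (∑[ y ∈ M (toℕ t) ] (PS+ N T S m x y ℚ.* r t y z)))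
      (sym (toℕ-inject₁ t)) (Pt+-PS+-commute S (toℕ t) x∈ z∈))
    (PS+-start S S<T)
    (λ {x} {y} x∈ y∈ → subst (λ m → PS+ N T S m x y ≡ 1ℚ) (sym (toℕ-fromℕ T)) (PS+-end S S<T x∈ y∈))
    (∑-singleton (𝒳s-unique N T S 0) (start-∈ S (ℕₚ.<⇒≤ S<T)) (start-stair S))
    (∑-singleton (𝒳s-unique N T (suc S) T) (end-∈ (suc S) S<T) (end-stair (suc S)))

  private
    K : Family N T → Family N T → ℚ
    K X Y = pathWeight (λ t x y → kernel t x y (lookup X (suc t))) Y

    -- If a product of nonnegative denominators is not positive, it is zero, and then so is the
    -- product of the total quotients, since `inv₀` is multiplicative and vanishes at 0. Hence both
    -- branches of the guard agree with the plain product.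
    guard : ∀ (num den : Fin T → ℚ) → (∀ t → 0ℚ ℚ.≤ den t) →
      (if does (0ℚ ℚₚ.<? (∏[ t ∈ allFin T ] den t)) then (∏[ t ∈ allFin T ] (num t ÷₀ den t)) else 0ℚ)
      ≡ (∏[ t ∈ allFin T ] (num t ÷₀ den t))
    guard num den den≥0 = if-dec (0ℚ ℚₚ.<? ∏ (allFin T) den) (λ _ → refl) (λ ¬pos → sym (vanish ¬pos))
      where
      open ≡-Reasoning
      vanish : ¬ (0ℚ ℚ.< ∏ (allFin T) den) → (∏[ t ∈ allFin T ] (num t ÷₀ den t)) ≡ 0ℚ
      vanish ¬pos = begin
        (∏[ t ∈ allFin T ] (num t ÷₀ den t))                     ≡⟨ ∏-cong (allFin T) (λ {t} _ → ÷₀-inv₀ (num t) (den t)) ⟩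
        (∏[ t ∈ allFin T ] (num t ℚ.* inv₀ (den t)))             ≡⟨ ∏-* (allFin T) num (inv₀ ∘ den) ⟩
        ∏ (allFin T) num ℚ.* (∏[ t ∈ allFin T ] inv₀ (den t))    ≡⟨ cong (∏ (allFin T) num ℚ.*_) (trans (∏-inv₀ (allFin T) den)
                                                                      (inv₀-zero (ℚₚ.≤-antisym (ℚₚ.≮⇒≥ ¬pos) (∏-nonneg (allFin T) (λ {t} _ → den≥0 t))))) ⟩
        ∏ (allFin T) num ℚ.* 0ℚ                                  ≡⟨ ℚₚ.*-zeroʳ (∏ (allFin T) num) ⟩
        0ℚ                                                       ∎

    P↦-kernel : ∀ {X Y} → Ω N T (suc S) X → Ω N T S Y → P↦ N T (suc S) X Y ≡ K X Y
    P↦-kernel {X} {Y} ΩX ΩY = guard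
      (λ t → p t (lookup Y (inject₁ t)) (lookup Y (suc t)) ℚ.* q (suc t) (lookup Y (suc t)) (lookup X (suc t)))
      (λ t → Δ t (lookup Y (inject₁ t)) (lookup X (suc t)))
      (λ t → Δ-nonneg t (∈-inject₁ L Y (Ω⇒∈ S {Y} ΩY) t) (Ω⇒∈ (suc S) {X} ΩX (suc t)))

    pathWeight-nonzero : ∀ {k : Fin T → Config N → Config N → ℚ} {X : Family N T} → pathWeight k X ≢ 0ℚ →
                         ∀ t → k t (lookup X (inject₁ t)) (lookup X (suc t)) ≢ 0ℚ
    pathWeight-nonzero h t e = h (∏-zero-term (allFin T) (∈-allFin t) e)

    -- The members of `Ωs` are the sequences in the product of the state lists that move by steps;
    -- the end points are imposed by the one-element lists at times 0 and T. The product form allows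
    -- summation one time at a time.
    ∑-Ωs : ∀ S (f : Family N T → ℚ) →
      (∀ X → f X ≢ 0ℚ → ∀ (t : Fin T) → Step (lookup X (inject₁ t)) (lookup X (suc t))) →
      ∑ (Ωs N T S) f ≡ ∑ (sections (𝒳s N T S) (suc T)) f
    ∑-Ωs S f steps = ∑-support f (Ωs-unique N T S) (sections-unique (𝒳s-unique N T S) (suc T))
      λ {X} fX≢0 → mk⇔
        (λ X∈ → ∈-sections⁺ {L = 𝒳s N T S} X (Ω⇒∈ S {X} (Equivalence.to (∈-Ωs N T S X) X∈)))
        (λ X∈ → Equivalence.from (∈-Ωs N T S X) (∈⇒Ω S {X} (∈-sections⁻ (𝒳s N T S) X∈) (steps X fX≢0)))

    ∈⇒Ω′ : ∀ S {X} → X ∈ Ωs N T S → Ω N T S X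
    ∈⇒Ω′ S {X} = Equivalence.to (∈-Ωs N T S X)

  nonneg : ∀ {X Y} → Ω N T (suc S) X → Ω N T S Y → 0ℚ ℚ.≤ P↦ N T (suc S) X Y
  nonneg {X} {Y} ΩX ΩY = subst (0ℚ ℚ.≤_) (sym (P↦-kernel {X} {Y} ΩX ΩY))
    (∏-nonneg (allFin T) (λ {t} _ → kernel-nonneg t (∈-inject₁ L Y (Ω⇒∈ S {Y} ΩY) t)
      (Ω⇒∈ S {Y} ΩY (suc t)) (Ω⇒∈ (suc S) {X} ΩX (suc t))))

  row-sum : ∀ {X} → Ω N T (suc S) X → (∑[ Y ∈ Ωs N T S ] P↦ N T (suc S) X Y) ≡ 1ℚ
  row-sum {X} ΩX = begin
    (∑[ Y ∈ Ωs N T S ] P↦ N T (suc S) X Y)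
      ≡⟨ ∑-cong (Ωs N T S) (λ {Y} Y∈ → P↦-kernel {X} {Y} ΩX (∈⇒Ω′ S {Y} Y∈)) ⟩
    (∑[ Y ∈ Ωs N T S ] K X Y)
      ≡⟨ ∑-Ωs S (K X) steps ⟩
    (∑[ Y ∈ sections L (suc T) ] K X Y)
      ≡⟨ kernel-stochastic X (Ω⇒∈ (suc S) {X} ΩX) (Pt+-nonzero (suc S) {X} ΩX) ⟩
    1ℚ ∎
    where
    open ≡-Reasoning
    steps : ∀ Y → K X Y ≢ 0ℚ → ∀ t → Step (lookup Y (inject₁ t)) (lookup Y (suc t))
    steps Y h t = Pt+-nonzero⇒Step S (toℕ t) y y′
      (*-nonzeroˡ {p t y y′} {q (suc t) y′ x′} (*-nonzeroˡ {p t y y′ ℚ.* q (suc t) y′ x′} {inv₀ (Δ t y x′)}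
        (λ e → pathWeight-nonzero {λ t x y → kernel t x y (lookup X (suc t))} {Y} h t (trans (÷₀-inv₀ (p t y y′ ℚ.* q (suc t) y′ x′) (Δ t y x′)) e))))
      where
      y = lookup Y (inject₁ t)
      y′ = lookup Y (suc t)
      x′ = lookup X (suc t)

  column-sum : ∀ {Y} → Ω N T S Y →
    (∑[ X ∈ Ωs N T (suc S) ] (P↦ N T (suc S) X Y ℚ.* Pt+-path (suc S) X)) ≡ Pt+-path S Y
  column-sum {Y} ΩY = begin
    (∑[ X ∈ Ωs N T (suc S) ] (P↦ N T (suc S) X Y ℚ.* Pt+-path (suc S) X))
      ≡⟨ ∑-cong (Ωs N T (suc S)) (λ {X} X∈ → cong (ℚ._* Pt+-path (suc S) X) (P↦-kernel {X} {Y} (∈⇒Ω′ (suc S) {X} X∈) ΩY)) ⟩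
    (∑[ X ∈ Ωs N T (suc S) ] (K X Y ℚ.* Pt+-path (suc S) X))
      ≡⟨ ∑-Ωs (suc S) (λ X → K X Y ℚ.* Pt+-path (suc S) X) (λ X h t → Pt+-nonzero⇒Step (suc S) (toℕ t) (lookup X (inject₁ t)) (lookup X (suc t))
           (pathWeight-nonzero {r} {X} (*-nonzeroʳ {p = K X Y} h) t)) ⟩
    (∑[ X ∈ sections M (suc T) ] (K X Y ℚ.* Pt+-path (suc S) X))
      ≡⟨ kernel-transport Y (Ω⇒∈ S {Y} ΩY) (Pt+-nonzero S {Y} ΩY) ⟩
    Pt+-path S Y ∎
    where open ≡-Reasoning

  -- Every path has the same Pt+-weight C at level S + 1 and C′ at level S, so each column
  -- of P↦ sums to C′ / C; double counting the total sum of P↦ then gives C · |Ω′| = C′ · |Ω|.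
  uniform : ∀ {Y} → Ω N T S Y →
    μ N T S Y ≡ (∑[ X ∈ Ωs N T (suc S) ] (P↦ N T (suc S) X Y ℚ.* μ N T (suc S) X))
  uniform {Y} ΩY = from-element (nonempty (Ωs N T (suc S)) refl)
    where
    open ≡-Reasoning
    C′ = Pt+-path S Y
    C′≢0 = Pt+-path-nonzero S {Y} ΩY
    #Ω = fromℤ (+ length (Ωs N T (suc S)))
    #Ω′ = fromℤ (+ length (Ωs N T S))

    nonempty : ∀ Xs → Xs ≡ Ωs N T (suc S) → ∃ λ X → X ∈ Ωs N T (suc S)
    -- An empty upper level would make the sum in `column-sum` zero, whereas its value is the
    -- nonzero weight of Y.
    nonempty []      e = ⊥-elim (C′≢0 (trans (sym (column-sum {Y} ΩY))
      (cong (λ Xs → ∑ Xs (λ X → P↦ N T (suc S) X Y ℚ.* Pt+-path (suc S) X)) (sym e))))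
    nonempty (X ∷ _) e = X , subst (X ∈_) e (here refl)

    #-nonzero : ∀ {A : Set} {x : A} {xs} → x ∈ xs → fromℤ (+ length xs) ≢ 0ℚ
    #-nonzero {xs = _ ∷ xs} _ = fromℤ-nonzero {+ suc (length xs)} (λ ())

    μ-Ω : ∀ S {X} → Ω N T S X → μ N T S X ≡ inv₀ (fromℤ (+ length (Ωs N T S)))
    μ-Ω S {X} ΩX = if-dec (Ω? N T S X) (λ _ → refl) (λ ¬ΩX → ⊥-elim (¬ΩX ΩX))

    from-element : ∃ (λ X → X ∈ Ωs N T (suc S)) →
      μ N T S Y ≡ (∑[ X ∈ Ωs N T (suc S) ] (P↦ N T (suc S) X Y ℚ.* μ N T (suc S) X))
    from-element (X₀ , X₀∈) = begin
      μ N T S Y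
        ≡⟨ μ-Ω S {Y} ΩY ⟩
      inv₀ #Ω′
        ≡⟨ *-cancelʳ (C ℚ.* #Ω) C#Ω≢0 cross ⟩
      σ ℚ.* inv₀ #Ω
        ≡⟨ ∑-*ʳ (Ωs N T (suc S)) (inv₀ #Ω) (λ X → P↦ N T (suc S) X Y) ⟨
      (∑[ X ∈ Ωs N T (suc S) ] (P↦ N T (suc S) X Y ℚ.* inv₀ #Ω))
        ≡⟨ ∑-cong (Ωs N T (suc S)) (λ {X} X∈ → cong (P↦ N T (suc S) X Y ℚ.*_) (sym (μ-Ω (suc S) {X} (∈⇒Ω′ (suc S) {X} X∈)))) ⟩
      (∑[ X ∈ Ωs N T (suc S) ] (P↦ N T (suc S) X Y ℚ.* μ N T (suc S) X)) ∎
      where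
      C = Pt+-path (suc S) X₀
      ΩX₀ = ∈⇒Ω′ (suc S) {X₀} X₀∈
      σ = ∑[ X ∈ Ωs N T (suc S) ] P↦ N T (suc S) X Y
      #Ω≢0 = #-nonzero X₀∈
      #Ω′≢0 = #-nonzero (Equivalence.from (∈-Ωs N T S Y) ΩY)
      C#Ω≢0 = *-nonzero (Pt+-path-nonzero (suc S) {X₀} ΩX₀) #Ω≢0
      column : ∀ {Z} → Ω N T S Z → (∑[ X ∈ Ωs N T (suc S) ] P↦ N T (suc S) X Z) ℚ.* C ≡ C′
      column {Z} ΩZ = begin
        (∑[ X ∈ Ωs N T (suc S) ] P↦ N T (suc S) X Z) ℚ.* C
          ≡⟨ ∑-*ʳ (Ωs N T (suc S)) C (λ X → P↦ N T (suc S) X Z) ⟨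
        (∑[ X ∈ Ωs N T (suc S) ] (P↦ N T (suc S) X Z ℚ.* C))
          ≡⟨ ∑-cong (Ωs N T (suc S)) (λ {X} X∈ → cong (P↦ N T (suc S) X Z ℚ.*_)
               (Pt+-path-constant (suc S) {X₀} {X} ΩX₀ (∈⇒Ω′ (suc S) {X} X∈))) ⟩
        (∑[ X ∈ Ωs N T (suc S) ] (P↦ N T (suc S) X Z ℚ.* Pt+-path (suc S) X))
          ≡⟨ column-sum {Z} ΩZ ⟩
        Pt+-path S Z
          ≡⟨ Pt+-path-constant S {Z} {Y} ΩZ ΩY ⟩
        C′ ∎
      double-count : C ℚ.* #Ω ≡ C′ ℚ.* #Ω′
      double-count = begin
        C ℚ.* #Ω
          ≡⟨ ∑-const (Ωs N T (suc S)) C ⟨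
        (∑[ X ∈ Ωs N T (suc S) ] C)
          ≡⟨ ∑-cong (Ωs N T (suc S)) (λ {X} X∈ → trans (sym (ℚₚ.*-identityˡ C))
               (cong (ℚ._* C) (sym (row-sum {X} (∈⇒Ω′ (suc S) {X} X∈))))) ⟩
        (∑[ X ∈ Ωs N T (suc S) ] (∑[ Z ∈ Ωs N T S ] P↦ N T (suc S) X Z) ℚ.* C)
          ≡⟨ ∑-*ʳ (Ωs N T (suc S)) C (λ X → ∑[ Z ∈ Ωs N T S ] P↦ N T (suc S) X Z) ⟩
        (∑[ X ∈ Ωs N T (suc S) ] ∑[ Z ∈ Ωs N T S ] P↦ N T (suc S) X Z) ℚ.* C
          ≡⟨ cong (ℚ._* C) (∑-swap (Ωs N T (suc S)) (Ωs N T S) (P↦ N T (suc S))) ⟩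
        (∑[ Z ∈ Ωs N T S ] ∑[ X ∈ Ωs N T (suc S) ] P↦ N T (suc S) X Z) ℚ.* C
          ≡⟨ ∑-*ʳ (Ωs N T S) C (λ Z → ∑[ X ∈ Ωs N T (suc S) ] P↦ N T (suc S) X Z) ⟨
        (∑[ Z ∈ Ωs N T S ] (∑[ X ∈ Ωs N T (suc S) ] P↦ N T (suc S) X Z) ℚ.* C)
          ≡⟨ ∑-cong (Ωs N T S) (λ {Z} Z∈ → column {Z} (∈⇒Ω′ S {Z} Z∈)) ⟩
        (∑[ Z ∈ Ωs N T S ] C′)
          ≡⟨ ∑-const (Ωs N T S) C′ ⟩
        C′ ℚ.* #Ω′ ∎
      regroup : ∀ i c n → i ℚ.* (c ℚ.* n) ≡ c ℚ.* (n ℚ.* i)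
      regroup = RingSolver.solve-∀ ℚ-ring
      regroup′ : ∀ s i c n → (s ℚ.* i) ℚ.* (c ℚ.* n) ≡ (s ℚ.* c) ℚ.* (n ℚ.* i)
      regroup′ = RingSolver.solve-∀ ℚ-ring
      -- After multiplication by C · |Ω| both sides equal C′: the left one by double counting, the
      -- right one because the column of Y sums to C′ / C.
      cross : inv₀ #Ω′ ℚ.* (C ℚ.* #Ω) ≡ (σ ℚ.* inv₀ #Ω) ℚ.* (C ℚ.* #Ω)
      cross = begin
        inv₀ #Ω′ ℚ.* (C ℚ.* #Ω)               ≡⟨ cong (inv₀ #Ω′ ℚ.*_) double-count ⟩
        inv₀ #Ω′ ℚ.* (C′ ℚ.* #Ω′)             ≡⟨ regroup (inv₀ #Ω′) C′ #Ω′ ⟩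
        C′ ℚ.* (#Ω′ ℚ.* inv₀ #Ω′)             ≡⟨ cong (C′ ℚ.*_) (trans (inv₀-inverse #Ω′≢0) (sym (inv₀-inverse #Ω≢0))) ⟩
        C′ ℚ.* (#Ω ℚ.* inv₀ #Ω)               ≡⟨ cong (ℚ._* (#Ω ℚ.* inv₀ #Ω)) (column {Y} ΩY) ⟨
        (σ ℚ.* C) ℚ.* (#Ω ℚ.* inv₀ #Ω)        ≡⟨ regroup′ σ (inv₀ #Ω) C #Ω ⟨
        (σ ℚ.* inv₀ #Ω) ℚ.* (C ℚ.* #Ω)        ∎

theorem3p2 : (N T S : ℕ) → 1 ≤ N → 1 ≤ T → 1 ≤ S → S ≤ T →
    (∀ X Y → Ω N T S X → Ω N T (S ∸ 1) Y → 0ℚ ℚ.≤ P↦ N T S X Y)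
    × (∀ X → Ω N T S X → (∑[ Y ∈ Ωs N T (S ∸ 1) ] P↦ N T S X Y) ≡ 1ℚ)
    × (∀ Y → Ω N T (S ∸ 1) Y →
    μ N T (S ∸ 1) Y ≡ (∑[ X ∈ Ωs N T S ] (P↦ N T S X Y ℚ.* μ N T S X)))
-- For `suc S` the bound by T is the strict inequality `S < T`, which makes the normalising factor
-- (T - S)_N of `PS+` positive.
theorem3p2 N T (suc S) _ _ _ S<T =
    (λ X Y ΩX ΩY → nonneg {X} {Y} ΩX ΩY)
  , (λ X ΩX → row-sum {X} ΩX)
  , (λ Y ΩY → uniform {Y} ΩY)
  where open Backward N T S S<T
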